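{- Let $G$ be a connected bipartite graph with $n\geq 3$ vertices. If $G$ is isomorphic neither to $C_4$ nor to $K_{2,3}$, then $$\ell_2(G)+\textsc{br}(G)\geq n.$$
   Context: Graphs are finite and simple. For a connected graph $G=(V,E)$, $d$ denotes the shortest-path distance. For distinct vertices $x,y$, the line generated by $x$ and $y$ is $\overline{xy}^G=\{z\in V: d(x,y)=d(x,z)+d(z,y)\ \text{or}\ d(x,y)=|d(x,z)-d(z,y)|\}$. $\ell_2(G)$ denotes the number of distinct sets $\overline{xy}^G$ over all pairs of vertices $x,y$ with $d(x,y)=2$. $\textsc{br}(G)$ denotes the number of bridges (cut edges) of $G$. -}

module Defs where

open import Data.Nat using (ℕ; zero; suc; _+_; _≡ᵇ_; ∣_-_∣; _<ᵇ_)
open import Data.Bool using (Bool; true; false; _∧_; _∨_; not; if_then_else_; T; _xor_)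
open import Data.Fin using (Fin; toℕ)
open import Data.Fin.Properties using () renaming (_≟_ to _≟ᶠ_)
open import Data.List using (List; []; _∷_; allFin; filterᵇ; length; concatMap; map; deduplicate)
open import Data.Bool.ListAction using (any)
open import Data.Vec using (Vec; tabulate)
import Data.Vec.Properties as VP
import Data.Bool.Properties as BP
open import Data.Product using (Σ; _×_; ∃; _,_)
open import Function.Bundles using (_↔_; Inverse)
open import Relation.Nullary using (¬_; does)
open import Relation.Binary.PropositionalEquality using (_≡_)

record Graph (n : ℕ) : Set where
  field
    adj   : Fin n → Fin n → Bool
    sym   : ∀ x y → adj x y ≡ adj y x
    irrefl : ∀ x → adj x x ≡ false
open Graph public

module _ {n : ℕ} where

  _==_ : Fin n → Fin n → Bool
  x == y = does (x ≟ᶠ y)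

  reach : (Fin n → Fin n → Bool) → ℕ → Fin n → Fin n → Bool
  reach a zero x y = x == y
  reach a (suc k) x y = reach a k x y ∨ any (λ z → reach a k x z ∧ a z y) (allFin n)

  -- connectedness of adjacency a: every pair joined by a walk
  -- (walks of length ≤ n suffice on n vertices)
  ConnectedAdj : (Fin n → Fin n → Bool) → Set
  ConnectedAdj a = ∀ x y → T (reach a n x y)

  Connected : Graph n → Set
  Connected G = ConnectedAdj (adj G)

  -- shortest-path distance: least k with a walk of length ≤ k
  -- (search k = 0,1,..,n; the fallback value n is never used for connected graphs)
  distFrom : (Fin n → Fin n → Bool) → ℕ → ℕ → Fin n → Fin n → ℕ
  distFrom a k zero x y = k
  distFrom a k (suc fuel) x y = if reach a k x y then k else distFrom a (suc k) fuel x y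

  dist : Graph n → Fin n → Fin n → ℕ
  dist G x y = distFrom (adj G) 0 n x y

  line : Graph n → Fin n → Fin n → Vec Bool n
  line G x y = tabulate λ z →
    (dist G x y ≡ᵇ (dist G x z + dist G z y)) ∨ (dist G x y ≡ᵇ ∣ dist G x z - dist G z y ∣)

  pairs : List (Fin n × Fin n)
  pairs = concatMap (λ x → map (λ y → (x , y)) (allFin n)) (allFin n)

  ℓ₂ : Graph n → ℕ
  ℓ₂ G = length (deduplicate (VP.≡-dec BP._≟_)
           (map (λ p → line G (Data.Product.proj₁ p) (Data.Product.proj₂ p))
                (filterᵇ (λ p → dist G (Data.Product.proj₁ p) (Data.Product.proj₂ p) ≡ᵇ 2) pairs)))

  removeEdge : Graph n → Fin n → Fin n → Fin n → Fin n → Bool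
  removeEdge G u v x y = adj G x y ∧ not ((x == u ∧ y == v) ∨ (x == v ∧ y == u))

  isBridge : Graph n → Fin n → Fin n → Bool
  isBridge G u v = adj G u v ∧ not (reach (removeEdge G u v) n u v)

  br : Graph n → ℕ
  br G = length (filterᵇ (λ p → (toℕ (Data.Product.proj₁ p) <ᵇ toℕ (Data.Product.proj₂ p))
                                 ∧ isBridge G (Data.Product.proj₁ p) (Data.Product.proj₂ p)) pairs)

  Bipartite : Graph n → Set
  Bipartite G = Σ (Fin n → Bool) λ c → ∀ x y → T (adj G x y) → ¬ (c x ≡ c y)

_≅_ : {n m : ℕ} → Graph n → Graph m → Set
_≅_ {n} {m} G H = Σ (Fin n ↔ Fin m) λ f →
  ∀ x y → adj G x y ≡ adj H (Inverse.to f x) (Inverse.to f y)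

sideGraph : {n : ℕ} → (Fin n → Bool) → Graph n
sideGraph s = record
  { adj = λ x y → s x xor s y
  ; sym = λ x y → BP.xor-comm (s x) (s y)
  ; irrefl = λ x → BP.xor-same (s x) }

-- C₄ = K_{2,2}: vertices 0,1,2,3; sides {0,2} and {1,3} (cycle 0-1-2-3-0)
C4 : Graph 4
C4 = sideGraph (λ x → toℕ x Data.Nat.% 2 ≡ᵇ 0)

K23 : Graph 5
K23 = sideGraph (λ x → toℕ x <ᵇ 2)

{-# OPTIONS --safe #-}

-- Let d a b = 2. The line of a and b misses exactly the vertices equidistant from a and b that
-- are not their common neighbours. If the graph has no cut vertex and neither of the neighbourhoods
-- of a and b contains the other, then no other pair generates this line: the middles of two pairs
-- with the same line would be nested, and the line could not be left from its outer side. Hence, when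
-- no neighbourhood strictly contains another one, distinct pairs at distance 2 generate distinct lines
-- (twins being easy), and since every vertex has at least two vertices at distance 2 there are at least
-- n of them. The other graphs are reduced by induction, within the ambient metric d, to isometric
-- subsets: one removes a leaf, a twin, or a strictly dominated vertex of minimal degree, possibly
-- together with a neighbour or two, and exhibits as many new lines as needed; the parts at a cut vertex
-- share at most the universal line, and every bridge of a part is a bridge of the whole. Graphs of
-- diameter at most 3, where the exceptional C₄ and K₂,₃ could arise as reducts, are counted directly.

module Submission where

open import Defs hiding (sym)
open import Data.Bool using (Bool; true; false; _∧_; _∨_; not; _xor_; T) renaming (_≟_ to _≟ᵇ_)
open import Data.Bool.Properties as Boolₚ using (T-∧; T-∨; T-≡; T?)
open import Data.Empty using (⊥; ⊥-elim)
open import Data.Fin using (Fin; toℕ)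
open import Data.Fin.Properties using (injective⇒≤; toℕ-injective) renaming (_≟_ to _≟ᶠ_)
open import Data.List using (List; []; _∷_; length; lookup; map; _++_; filter; allFin; cartesianProduct)
open import Data.List.Membership.Propositional using (_∈_; lose; find)
open import Data.List.Membership.Propositional.Properties using (∈-lookup; ∈-filter⁺; ∈-filter⁻; ∈-allFin; ∈-cartesianProduct⁺; ∈-++⁺ˡ; ∈-++⁺ʳ; ∈-map⁺; ∈-map⁻; ∈-concatMap⁺; ∈-deduplicate⁺)
open import Data.List.Properties using (length-++; length-map; length-tabulate)
open import Data.List.Relation.Unary.All as All using (All; []; _∷_)
open import Data.List.Relation.Unary.All.Properties using () renaming (++⁺ to All-++⁺; map⁺ to All-map⁺)
open import Data.List.Relation.Unary.AllPairs as AllPairs using (AllPairs; []; _∷_)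
open import Data.List.Relation.Unary.AllPairs.Properties using () renaming (++⁺ to AllPairs-++⁺; map⁺ to AllPairs-map⁺)
open import Data.List.Relation.Unary.Any using (here; there; index)
open import Data.List.Relation.Unary.Any.Properties using (any⁺; any⁻; lookup-index)
open import Data.List.Relation.Unary.Unique.Propositional using (Unique)
import Data.List.Relation.Unary.Unique.Propositional.Properties as Uniqueₚ
open import Data.Nat using (ℕ; zero; suc; _+_; _%_; _≤_; _<_; _≥_; z≤n; s≤s; _≟_; _≤?_; _<?_; _≡ᵇ_; _<ᵇ_; ∣_-_∣)
open import Data.Nat.Properties
  using (≤-refl; ≤-reflexive; ≤-trans; ≤-antisym; ≤-pred; ≰⇒>; ≮⇒≥; ≤∧≢⇒<; <⇒≤; <⇒<ᵇ; <-asym; <-cmp; n≮n; m≤n+m; suc-injective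
        ; +-suc; +-comm; +-identityʳ; +-cancelʳ-≡; +-mono-≤; +-monoˡ-≤; +-monoʳ-≤; +-mono-<-≤; ≡⇒≡ᵇ; ∣n-n∣≡0)
open import Data.Product using (∃; _×_; _,_; proj₁; proj₂)
open import Data.Sum using (_⊎_; inj₁; inj₂; [_,_]′)
open import Data.Unit using (⊤; tt)
open import Data.Vec using () renaming (lookup to lookupᵛ)
import Data.Vec.Properties as Vecₚ
open import Function using (_∘_)
open import Function.Bundles using (mk↔ₛ′; Equivalence)
open import Relation.Binary using (tri<; tri≈; tri>)
open import Relation.Binary.Definitions using (Symmetric)
open import Relation.Binary.PropositionalEquality using (_≡_; _≢_; refl; sym; trans; cong; cong₂; subst)
open import Relation.Nullary using (¬_; yes; no; Dec; does; ¬?; _×-dec_; _⊎-dec_)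
open import Relation.Nullary.Decidable using (map′; decidable-stable)

-- The accounting shapes the case analysis. C₄ has one line for four vertices and K₂,₃ has four
-- lines for five, so a deletion that ends in one of them leaves a debt; it is usable only if the
-- reduct is provably neither of them, or if the debt is paid by hand. A second obstacle is that a
-- bridge of a reduct need not be a bridge of the whole: an edge at a dominating vertex may become a
-- bridge when the dominated vertex is removed. The third vertex required for deleting a twin, and
-- later the absence of cut vertices, exclude this.
--
-- Lines cause no such trouble: inside a fixed metric, the line of a pair in a smaller set is the
-- trace of its line in the larger one, so distinct lines stay distinct. This is why distances are
-- never recomputed and why the induction runs over subsets of one vertex set.
--
-- The induction is stated with a double negation, so that a counterexample can be refuted without
-- first deciding which special vertices exist. The final inequality is decidable, which removes the
-- negations.

module _ {A : Set} where

  lookup-injective : {xs : List A} → Unique xs → ∀ i j → lookup xs i ≡ lookup xs j → i ≡ j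
  lookup-injective (_ ∷ _) Fin.zero Fin.zero _ = refl
  lookup-injective (x≢ ∷ _) Fin.zero (Fin.suc j) eq = ⊥-elim (All.lookup x≢ (∈-lookup j) eq)
  lookup-injective (x≢ ∷ _) (Fin.suc i) Fin.zero eq = ⊥-elim (All.lookup x≢ (∈-lookup i) (sym eq))
  lookup-injective (_ ∷ u) (Fin.suc i) (Fin.suc j) eq = cong Fin.suc (lookup-injective u i j eq)

  unique-⊆⇒length≤ : {xs ys : List A} → Unique xs → (∀ {x} → x ∈ xs → x ∈ ys) → length xs ≤ length ys
  unique-⊆⇒length≤ {xs} {ys} u sub = injective⇒≤ {f = f} inj
    where
    f : Fin (length xs) → Fin (length ys)
    f i = index (sub (∈-lookup i))
    look : ∀ i → lookup ys (f i) ≡ lookup xs i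
    look i = sym (lookup-index (sub (∈-lookup i)))
    inj : ∀ {i j} → f i ≡ f j → i ≡ j
    inj {i} {j} eq = lookup-injective u i j (trans (sym (look i)) (trans (cong (lookup ys) eq) (look j)))

  AllPairs-remove : {R : A → A → Set} → Symmetric R → {t : A} {ts : List A} → t ∈ ts → AllPairs R ts →
    ∃ λ us → length ts ≡ suc (length us) × (∀ {x} → x ∈ us → x ∈ ts) × All (R t) us × AllPairs R us
  AllPairs-remove sy (here refl) (r ∷ rs) = _ , refl , there , r , rs
  AllPairs-remove sy {t} (there {x = x} t∈) (r ∷ rs) with AllPairs-remove sy t∈ rs
  ... | us , len , us⊆ , r' , rs' =
    x ∷ us , cong suc len , (λ { (here e) → here e ; (there p) → there (us⊆ p) })
    , sy (All.lookup r t∈) ∷ r' , All.tabulate (λ p → All.lookup r (us⊆ p)) ∷ rs'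

  AllPairs-strengthen : {R Q : A → A → Set} {P : A → Set} → (∀ {x y} → P x → P y → R x y → Q x y) →
    {xs : List A} → All P xs → AllPairs R xs → AllPairs Q xs
  AllPairs-strengthen f [] [] = []
  AllPairs-strengthen f (p ∷ ps) (r ∷ rs) =
    All.tabulate (λ y∈ → f p (All.lookup ps y∈) (All.lookup r y∈)) ∷ AllPairs-strengthen f ps rs

  two-each : {R : A → A → Set} (xs : List A) → Unique xs →
    (∀ {x} → x ∈ xs → ∃ λ y → ∃ λ z → y ≢ z × R x y × R x z) →
    ∃ λ (ps : List (A × A)) → length ps ≡ length xs + length xs × Unique ps
      × (∀ {p} → p ∈ ps → proj₁ p ∈ xs × R (proj₁ p) (proj₂ p))
  two-each [] [] f = [] , refl , [] , λ ()
  two-each {R} (x ∷ xs) (x∉ ∷ u) f with f (here refl) | two-each xs u (f ∘ there)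
  ... | y , z , y≢z , Rxy , Rxz | ps , len , ups , ok =
    (x , y) ∷ (x , z) ∷ ps
    , trans (cong (suc ∘ suc) len) (cong suc (sym (+-suc _ _)))
    , ((y≢z ∘ cong proj₂) ∷ fresh y) ∷ fresh z ∷ ups
    , λ { (here refl) → here refl , Rxy ; (there (here refl)) → here refl , Rxz
        ; (there (there p)) → there (proj₁ (ok p)) , proj₂ (ok p) }
    where
    fresh : ∀ w → All ((x , w) ≢_) ps
    fresh w = All.tabulate λ p∈ eq → All.lookup x∉ (proj₁ (ok p∈)) (cong proj₁ eq)

-- Bipartite metrics and the lines of pairs at distance 2

-- `d-step` provides geodesics, and `d-alternates` is bipartiteness in metric form: no vertex is
-- equidistant from the two ends of an edge.
record BipartiteMetric (N : ℕ) : Set where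
  field
    d : Fin N → Fin N → ℕ
    d-refl : ∀ x → d x x ≡ 0
    d-zero : ∀ {x y} → d x y ≡ 0 → x ≡ y
    d-sym : ∀ x y → d x y ≡ d y x
    d-triangle : ∀ x y z → d x z ≤ d x y + d y z
    d-step : ∀ {x y k} → d x y ≡ suc k → ∃ λ z → d x z ≡ 1 × d z y ≡ k
    d-alternates : ∀ {u v} → d u v ≡ 1 → ∀ x → d x v ≡ suc (d x u) ⊎ d x u ≡ suc (d x v)

private
  Consecutive : ℕ → ℕ → Set
  Consecutive m n = n ≡ suc m ⊎ m ≡ suc n

  two-consecutive : ∀ {a m b} → Consecutive a m → Consecutive m b → a ≡ b ⊎ b ≡ 2 + a ⊎ a ≡ 2 + b
  two-consecutive (inj₁ refl) (inj₁ refl) = inj₂ (inj₁ refl)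
  two-consecutive (inj₁ refl) (inj₂ refl) = inj₁ refl
  two-consecutive (inj₂ refl) (inj₁ refl) = inj₁ refl
  two-consecutive (inj₂ refl) (inj₂ refl) = inj₂ (inj₂ refl)

  -- The difference of the two distances would jump from 2 to -2, while each of them changes by only
  -- 1 along an edge.
  no-edge-across : ∀ {a b a' b'} → b ≡ 2 + a → a' ≡ 2 + b' → Consecutive a a' → Consecutive b b' → ⊥
  no-edge-across refl refl (inj₁ refl) (inj₁ ())
  no-edge-across refl refl (inj₁ refl) (inj₂ ())
  no-edge-across refl refl (inj₂ refl) (inj₁ ())
  no-edge-across refl refl (inj₂ refl) (inj₂ ())

  boundary : ∀ {a b a' b'} → a ≡ 2 + b → a' ≡ b' → Consecutive a a' → Consecutive b b' → b' ≡ suc b × a ≡ suc a'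
  boundary refl refl (inj₁ refl) (inj₁ ())
  boundary refl refl (inj₁ refl) (inj₂ ())
  boundary refl refl (inj₂ refl) (inj₁ refl) = refl , refl
  boundary refl refl (inj₂ refl) (inj₂ ())

module Metric {N : ℕ} (M : BipartiteMetric N) where
  open BipartiteMetric M

  V : Set
  V = Fin N

  infix 4 _~_ _∈ₛ_

  _~_ : V → V → Set
  u ~ v = d u v ≡ 1

  _~?_ : ∀ u v → Dec (u ~ v)
  u ~? v = d u v ≟ 1

  ~-sym : ∀ {u v} → u ~ v → v ~ u
  ~-sym {u} {v} e = trans (d-sym v u) e

  ~-irrefl : ∀ {u} → ¬ (u ~ u)
  ~-irrefl {u} e with trans (sym (d-refl u)) e
  ... | ()

  ~⇒≢ : ∀ {u v} → u ~ v → u ≢ v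
  ~⇒≢ e refl = ~-irrefl e

  d2⇒≢ : ∀ {u v} → d u v ≡ 2 → u ≢ v
  d2⇒≢ {u} e refl with trans (sym (d-refl u)) e
  ... | ()

  d2⇒≁ : ∀ {u v} → d u v ≡ 2 → ¬ (u ~ v)
  d2⇒≁ e e' with trans (sym e) e'
  ... | ()

  common-nbr⇒d2 : ∀ {w x y} → x ~ w → y ~ w → x ≢ y → d x y ≡ 2
  common-nbr⇒d2 {w} {x} {y} xw yw x≢y with d-alternates (~-sym yw) x
  ... | inj₁ e = trans e (cong suc xw)
  ... | inj₂ e = ⊥-elim (x≢y (d-zero (suc-injective (trans (sym e) xw))))

  nbrs≁ : ∀ {w x y} → x ~ w → y ~ w → ¬ (x ~ y)
  nbrs≁ {w} {x} {y} xw yw xy with x ≟ᶠ y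
  ... | yes refl = ~-irrefl xy
  ... | no x≢y = d2⇒≁ (common-nbr⇒d2 xw yw x≢y) xy

  case-≟ : ∀ (t u : V) {A : Set} → (t ≢ u → A) → t ≡ u ⊎ A
  case-≟ t u f with t ≟ᶠ u
  ... | yes e = inj₁ e
  ... | no n = inj₂ (f n)

  -- For d a b ≡ 2, parity leaves exactly these vertices off the line of a and b.
  NotOnLine : V → V → V → Set
  NotOnLine a b z = d a z ≡ d b z × d a z ≢ 1

  swapNot : ∀ {a b z} → NotOnLine a b z → NotOnLine b a z
  swapNot (e , n) = sym e , n ∘ trans e

  Near : V → V → V → Set
  Near a b z = d b z ≡ 2 + d a z

  -- Meant for d a b ≡ 2, when the distances of z to a and b differ by 0 or 2.
  data Position (a b z : V) : Set where
    near₁ : Near a b z → Position a b z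
    near₂ : Near b a z → Position a b z
    mid   : a ~ z → b ~ z → Position a b z
    off   : NotOnLine a b z → Position a b z

  -- The distances from z to a and to b both differ by exactly 1 from the distance to a middle m, so
  -- they are equal or differ by 2.
  position : ∀ {a b} → d a b ≡ 2 → ∀ z → Position a b z
  position {a} {b} dab z with d-step dab
  ... | m , am , mb with two-consecutive (d-alternates am z) (d-alternates mb z)
  ... | inj₂ (inj₁ e) = near₁ (trans (d-sym b z) (trans e (cong (2 +_) (d-sym z a))))
  ... | inj₂ (inj₂ e) = near₂ (trans (d-sym a z) (trans e (cong (2 +_) (d-sym z b))))
  ... | inj₁ e with d a z ≟ 1
  ...   | yes az = mid az (trans (d-sym b z) (trans (sym e) (trans (d-sym z a) az)))
  ...   | no ¬az = off (trans (d-sym a z) (trans e (d-sym z b)) , ¬az)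

  near-separated : ∀ {a b v v'} → Near a b v → Near b a v' → ¬ (v ~ v')
  near-separated {a} {b} n n' e = no-edge-across n n' (d-alternates e a) (d-alternates e b)

  near-on : ∀ {a b z} → Near a b z → ¬ NotOnLine a b z
  near-on n (e , _) = lem (trans e n)
    where
    lem : ∀ {k} → k ≡ 2 + k → ⊥
    lem ()

  near-on' : ∀ {a b z} → Near b a z → ¬ NotOnLine a b z
  near-on' n p = near-on n (swapNot p)

  near-mid : ∀ {a b z} → Near a b z → b ~ z → ⊥
  near-mid n e with trans (sym n) e
  ... | ()

  near-asym : ∀ {a b z} → Near a b z → Near b a z → ⊥
  near-asym n n' = lem n n'
    where
    lem : ∀ {p q} → p ≡ 2 + q → q ≡ 2 + p → ⊥
    lem refl ()

  near-self : ∀ {a b} → d a b ≡ 2 → Near b a b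
  near-self {a} {b} e = trans e (cong (2 +_) (sym (d-refl b)))

  -- A step from a middle changes both distances, which are 1, by one. A decrease means arrival at a
  -- or b; otherwise z has distance 2 from both.
  mid-nbr : ∀ {a b w z} → a ~ w → b ~ w → w ~ z → z ≡ a ⊎ z ≡ b ⊎ NotOnLine a b z
  mid-nbr {a} {b} {w} {z} aw bw wz with d-alternates wz a | d-alternates wz b
  ... | inj₂ e | _ = inj₁ (sym (d-zero (suc-injective (trans (sym e) aw))))
  ... | _ | inj₂ e = inj₂ (inj₁ (sym (d-zero (suc-injective (trans (sym e) bw)))))
  ... | inj₁ e | inj₁ e' = inj₂ (inj₂ (trans e (trans (cong suc (trans aw (sym bw))) (sym e')) , d2⇒≁ (trans e (cong suc aw))))

  off-near : ∀ {a b v z} → Near b a v → NotOnLine a b z → v ~ z → d b z ≡ suc (d b v) × d a v ≡ suc (d a z)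
  off-near {a} {b} n (e , _) vz = boundary n e (d-alternates vz a) (d-alternates vz b)

  -- A step towards b cannot leave the side of b: edges to off-line vertices lead away from b by
  -- `off-near`, and if v₁ were a middle, v would have distance 2 from b and 4 from a.
  near-step : ∀ {a b v v₁} → d a b ≡ 2 → Near b a v → v ~ v₁ → d b v ≡ suc (d b v₁) → Near b a v₁
  near-step {a} {b} {v} {v₁} dab n e s with position dab v₁
  ... | near₁ n₁ = ⊥-elim (near-separated n n₁ e)
  ... | near₂ n₁ = n₁
  ... | mid a₁ b₁ = ⊥-elim (lem (trans s (cong suc b₁)) n (d-alternates e a) a₁)
    where
    lem : ∀ {p q r} → p ≡ 2 → q ≡ 2 + p → Consecutive q r → r ≡ 1 → ⊥
    lem refl refl (inj₁ refl) ()
    lem refl refl (inj₂ refl) ()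
  ... | off o with off-near n o e
  ...   | e' , _ = ⊥-elim (lem s e')
    where
    lem : ∀ {p q} → p ≡ suc q → q ≡ suc p → ⊥
    lem refl ()

  on-nbr : ∀ {a b z} → a ~ z → ¬ NotOnLine a b z
  on-nbr e (_ , n) = n e

  on-nbr' : ∀ {a b z} → b ~ z → ¬ NotOnLine a b z
  on-nbr' e p = on-nbr e (swapNot p)

  on-self : ∀ {a b} → d a b ≡ 2 → ¬ NotOnLine a b a
  on-self {a} {b} e (e' , _) with trans (sym (d-refl a)) (trans e' (trans (d-sym b a) e))
  ... | ()

  on-self' : ∀ {a b} → d a b ≡ 2 → ¬ NotOnLine a b b
  on-self' {a} {b} e p = on-self (trans (d-sym b a) e) (swapNot p)

  d2-off : ∀ {a b z} → d a z ≡ 2 → d b z ≡ 2 → NotOnLine a b z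
  d2-off e e' = trans e (sym e') , d2⇒≁ e

  Subset : Set
  Subset = V → Bool

  -- A record around the equation, so that unification can recover `x` and `S`.
  record _∈ₛ_ (x : V) (S : Subset) : Set where
    constructor mem
    field holds : S x ≡ true

  -- By iteration, S contains a geodesic between any two of its vertices, so `d` restricted to S is
  -- the distance of the induced subgraph.
  Isometric : Subset → Set
  Isometric S = ∀ {x y} → x ∈ₛ S → y ∈ₛ S → x ≢ y → ∃ λ z → z ∈ₛ S × x ~ z × d y x ≡ suc (d y z)

  SameLine : Subset → V → V → V → V → Set
  SameLine S a b c e = ∀ {z} → z ∈ₛ S → (NotOnLine a b z → NotOnLine c e z) × (NotOnLine c e z → NotOnLine a b z)

  SamePair : V → V → V → V → Set
  SamePair a b c e = (a ≡ c × b ≡ e) ⊎ (a ≡ e × b ≡ c)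

  -- b is dominated by a: inside S, the neighbourhood of b is contained in that of a.
  Dom : Subset → V → V → Set
  Dom S b a = ∀ {t} → t ∈ₛ S → t ~ b → t ~ a

  record CutVertex (S : Subset) : Set where
    field
      v s t : V
      v∈ : v ∈ₛ S
      s∈ : s ∈ₛ S
      side : Subset
      side⊆ : ∀ {x} → x ∈ₛ side → x ∈ₛ S
      v∉ : ¬ (v ∈ₛ side)
      t∈ : t ∈ₛ side
      s∉ : ¬ (s ∈ₛ side)
      s≢v : s ≢ v
      sep : ∀ {x y} → x ∈ₛ side → y ∈ₛ S → ¬ (y ∈ₛ side) → y ≢ v → ¬ (x ~ y)

  sameLine-sym : ∀ {S a b c e} → SameLine S a b c e → SameLine S c e a b
  sameLine-sym L z∈ = proj₂ (L z∈) , proj₁ (L z∈)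

  swap₁ : ∀ {S a b c e} → SameLine S a b c e → SameLine S b a c e
  swap₁ L z∈ = proj₁ (L z∈) ∘ swapNot , swapNot ∘ proj₂ (L z∈)

  swap₂ : ∀ {S a b c e} → SameLine S a b c e → SameLine S a b e c
  swap₂ L z∈ = swapNot ∘ proj₁ (L z∈) , proj₂ (L z∈) ∘ swapNot

  infixl 7 _∩_

  _∩_ : Subset → {P : V → Set} → (∀ x → Dec (P x)) → Subset
  (S ∩ P?) x = S x ∧ does (P? x)

  ∈∩⁺ : ∀ {S x} {P : V → Set} (P? : ∀ x → Dec (P x)) → x ∈ₛ S → P x → x ∈ₛ S ∩ P?
  ∈∩⁺ {S} {x} P? (mem x∈) p = mem (lem (S x) (P? x) x∈)
    where
    lem : ∀ b D → b ≡ true → b ∧ does D ≡ true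
    lem true (yes _) _ = refl
    lem true (no ¬p) _ = ⊥-elim (¬p p)

  ∈∩⁻ : ∀ {S x} {P : V → Set} (P? : ∀ x → Dec (P x)) → x ∈ₛ S ∩ P? → x ∈ₛ S × P x
  ∈∩⁻ {S} {x} {P} P? (mem x∈) = lem (S x) (P? x) x∈ refl
    where
    lem : ∀ b (D : Dec (P x)) → b ∧ does D ≡ true → S x ≡ b → x ∈ₛ S × P x
    lem true (yes p) _ e = mem e , p

  near? : ∀ a b z → Dec (Near a b z)
  near? a b z = d b z ≟ 2 + d a z

  module _ {S : Subset} (iso : Isometric S) where

    common-nbr : ∀ {x y} → x ∈ₛ S → y ∈ₛ S → d x y ≡ 2 → ∃ λ m → m ∈ₛ S × x ~ m × y ~ m
    common-nbr {x} {y} x∈ y∈ dxy with iso x∈ y∈ (d2⇒≢ dxy)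
    ... | m , m∈ , xm , s = m , m∈ , xm , suc-injective (trans (sym s) (trans (d-sym y x) dxy))

  -- Uniqueness of lines in the absence of cut vertices

  module _ {S : Subset} (iso : Isometric S) where

    -- The hypotheses place c, e, a, b in this order on a geodesic, e and a possibly equal, with the
    -- middles of c and e on the side of a. The aim is that the side of b then has no edge to an
    -- off-line vertex.
    module Nested {a b c e : V} (a∈ : a ∈ₛ S) (b∈ : b ∈ₛ S) (e∈ : e ∈ₛ S)
      (dab : d a b ≡ 2) (dce : d c e ≡ 2) (L : SameLine S a b c e)
      (ae : Near a b e) (eb : Near e c b)
      (mid-near : ∀ {m} → m ∈ₛ S → c ~ m → e ~ m → Near a b m) where

      -- Induction along a geodesic from v to b, whose next vertex is already on the side of e. An
      -- adjacent vertex cannot be on the opposite side; v is no middle of c and e, since those are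
      -- on the side of a; and it is not off the line, since the lines agree.
      far-side-nested : ∀ k {v} → d b v ≡ k → v ∈ₛ S → Near b a v → Near e c v
      far-side-nested zero eq v∈ n = subst (Near e c) (d-zero eq) eb
      far-side-nested (suc k) {v} eq v∈ n with v ≟ᶠ b
      ... | yes refl = eb
      ... | no v≢b with iso v∈ b∈ v≢b
      ... | v₁ , v₁∈ , vv₁ , s with position dce v
      ...   | near₁ r = ⊥-elim (near-separated r ih vv₁)
        where ih = far-side-nested k (suc-injective (trans (sym s) eq)) v₁∈ (near-step dab n vv₁ s)
      ...   | near₂ r = r
      ...   | mid cv ev = ⊥-elim (near-asym (mid-near v∈ cv ev) n)
      ...   | off o = ⊥-elim (near-on' n (proj₂ (L v∈) o))

      -- A geodesic from v to e stays on the side of e, hence on the line, so it can leave the side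
      -- of b only through b, a middle and then a. Thus a lies on it.
      through-a : ∀ k {v} → d e v ≡ k → v ∈ₛ S → Near b a v → d e a + d a v ≤ d e v
      through-a zero eq v∈ n = ⊥-elim (near-asym ae (subst (Near b a) (sym (d-zero eq)) n))
      through-a (suc k) {v} eq v∈ n with v ≟ᶠ e
      ... | yes refl = ⊥-elim (near-asym ae n)
      ... | no v≢e with iso v∈ e∈ v≢e
      ... | v₁ , v₁∈ , vv₁ , s with near-step dce (far-side-nested _ refl v∈ n) vv₁ s
      ... | nv₁ with position dab v₁
      ...   | near₁ r = ⊥-elim (near-separated r n (~-sym vv₁))
      ...   | off o = ⊥-elim (near-on' nv₁ (proj₁ (L v₁∈) o))
      ...   | near₂ r = subst (d e a + d a v ≤_) (sym s)
                (≤-trans (+-monoʳ-≤ (d e a) av≤) (subst (_≤ suc (d e v₁)) (sym (+-suc (d e a) (d a v₁))) (s≤s ih)))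
        where
        ih = through-a k (suc-injective (trans (sym s) eq)) v₁∈ r
        av≤ : d a v ≤ suc (d a v₁)
        av≤ = ≤-trans (d-triangle a v₁ v) (≤-reflexive (trans (cong (d a v₁ +_) (~-sym vv₁)) (+-comm (d a v₁) 1)))
      ...   | mid av₁ bv₁ with mid-nbr av₁ bv₁ (~-sym vv₁)
      ...     | inj₁ refl = ⊥-elim (near-asym n (near-self (trans (d-sym b a) dab)))
      ...     | inj₂ (inj₂ o) = ⊥-elim (near-on' n o)
      ...     | inj₂ (inj₁ refl) with v₁ ≟ᶠ e
      ...       | yes refl = ⊥-elim (near-mid ae bv₁)
      ...       | no v₁≢e with iso v₁∈ e∈ v₁≢e
      ...         | v₂ , v₂∈ , v₁v₂ , s₂ with mid-nbr av₁ bv₁ v₁v₂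
      ...           | inj₁ refl = ≤-reflexive (trans (cong (d e a +_) dab) (trans (+-comm (d e a) 2) (sym (trans s (cong suc s₂)))))
      ...           | inj₂ (inj₁ refl) = ⊥-elim (lem s s₂)
        where
        lem : ∀ {p q} → p ≡ suc q → q ≡ suc p → ⊥
        lem refl ()
      ...           | inj₂ (inj₂ o) = ⊥-elim (near-on' (near-step dce nv₁ v₁v₂ s₂) (proj₁ (L v₂∈) o))

      -- Seen from e such an edge leads away, seen from a it leads closer. As a lies between e and
      -- v, z would be farther from e than the way through a allows.
      no-boundary-edge : ∀ {v z} → v ∈ₛ S → z ∈ₛ S → Near b a v → NotOnLine a b z → ¬ (v ~ z)
      no-boundary-edge {v} {z} v∈ z∈ n o vz =
        lem (d e a) (proj₂ (off-near n o vz)) (proj₁ (off-near (far-side-nested _ refl v∈ n) (proj₁ (L z∈) o) vz))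
          (through-a _ refl v∈ n) (d-triangle e a z)
        where
        lem : ∀ p {q r s t} → q ≡ suc r → s ≡ suc t → p + q ≤ t → s ≤ p + r → ⊥
        lem p {r = r} {t = t} refl refl x y = n≮n _ (≤-trans (subst (_≤ t) (+-suc p r) x) (≤-trans (m≤n+m t 1) y))

    module _ (no-cut : ¬ CutVertex S) where

      -- Without such an edge, the side of b could be left only through b. Then b is a cut vertex,
      -- unless it is alone on its side; in that case all its neighbours are middles and a dominates
      -- it.
      boundary-edge : ∀ {a b} → a ∈ₛ S → b ∈ₛ S → d a b ≡ 2 → ¬ Dom S b a →
        ¬ (∀ {v z} → v ∈ₛ S → z ∈ₛ S → Near b a v → NotOnLine a b z → ¬ (v ~ z))
      boundary-edge {a} {b} a∈ b∈ dab ¬dom no-edge = ¬dom dom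
        where
        P? : ∀ x → Dec (Near b a x × x ≢ b)
        P? x = near? b a x ×-dec ¬? (x ≟ᶠ b)
        sep : ∀ {x y} → x ∈ₛ S ∩ P? → y ∈ₛ S → ¬ (y ∈ₛ S ∩ P?) → y ≢ b → ¬ (x ~ y)
        sep {x} {y} x∈T y∈ y∉T y≢b xy with ∈∩⁻ P? x∈T | position dab y
        ... | x∈ , nx , x≢b | near₁ ny = near-separated ny nx (~-sym xy)
        ... | x∈ , nx , x≢b | near₂ ny = y∉T (∈∩⁺ P? y∈ (ny , y≢b))
        ... | x∈ , nx , x≢b | off o = no-edge x∈ y∈ nx o xy
        ... | x∈ , nx , x≢b | mid ay by with mid-nbr ay by (~-sym xy)
        ...   | inj₁ refl = near-asym nx (near-self (trans (d-sym b a) dab))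
        ...   | inj₂ (inj₁ e) = x≢b e
        ...   | inj₂ (inj₂ o) = near-on' nx o
        dom : Dom S b a
        dom {q} q∈ qb with q ~? a
        ... | yes qa = qa
        ... | no ¬qa with position dab q
        ...   | near₁ n = ⊥-elim (near-mid n (~-sym qb))
        ...   | mid aq _ = ⊥-elim (¬qa (~-sym aq))
        ...   | off o = ⊥-elim (on-nbr' (~-sym qb) o)
        ...   | near₂ n = ⊥-elim (no-cut record
                  { v = b ; s = a ; t = q ; v∈ = b∈ ; s∈ = a∈ ; side = S ∩ P? ; side⊆ = proj₁ ∘ ∈∩⁻ P?
                  ; v∉ = λ b∈T → proj₂ (proj₂ (∈∩⁻ {S} P? b∈T)) refl
                  ; t∈ = ∈∩⁺ P? q∈ (n , ~⇒≢ qb)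
                  ; s∉ = λ a∈T → near-asym (proj₁ (proj₂ (∈∩⁻ {S} P? a∈T))) (near-self (trans (d-sym b a) dab))
                  ; s≢v = d2⇒≢ dab ; sep = sep })

      -- Here e, a, c, b is a path. As the lines agree, geodesics to an off-line z start from c with
      -- a or b and from a with c or e. Since z is equidistant within each pair, it would be both
      -- nearer to a than to c and nearer to c than to a. So nothing is off the line, against
      -- `boundary-edge`.
      middle-not-end′ : ∀ {a b c e} → a ∈ₛ S → b ∈ₛ S → c ∈ₛ S → e ∈ₛ S → d a b ≡ 2 → d c e ≡ 2 →
        ¬ Dom S b a → SameLine S a b c e → a ~ c → b ~ c → a ~ e → ⊥
      middle-not-end′ {a} {b} {c} {e} a∈ b∈ c∈ e∈ dab dce ¬dom L ac bc ae = boundary-edge a∈ b∈ dab ¬dom no-edge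
        where
        from-c : ∀ {z} → z ∈ₛ S → NotOnLine a b z → d z c ≡ suc (d z a)
        from-c {z} z∈ o with iso c∈ z∈ (λ { refl → on-self dce (proj₁ (L c∈) o) })
        ... | t , t∈ , ct , s with mid-nbr ac bc ct
        ...   | inj₁ refl = s
        ...   | inj₂ (inj₁ refl) = trans s (cong suc (trans (d-sym z b) (trans (sym (proj₁ o)) (d-sym a z))))
        ...   | inj₂ (inj₂ o') = ⊥-elim (on-nbr ct (proj₁ (L t∈) o'))
        from-a : ∀ {z} → z ∈ₛ S → NotOnLine a b z → d z a ≡ suc (d z c)
        from-a {z} z∈ o with iso a∈ z∈ (λ { refl → on-self dab o })
        ... | t , t∈ , at , s with mid-nbr (~-sym ac) (~-sym ae) at
        ...   | inj₁ refl = s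
        ...   | inj₂ (inj₁ refl) = trans s (cong suc (trans (d-sym z e) (trans (sym (proj₁ (proj₁ (L z∈) o))) (d-sym c z))))
        ...   | inj₂ (inj₂ o') = ⊥-elim (on-nbr at (proj₂ (L t∈) o'))
        no-edge : ∀ {v z} → v ∈ₛ S → z ∈ₛ S → Near b a v → NotOnLine a b z → ¬ (v ~ z)
        no-edge v∈ z∈ n o vz = lem (from-c z∈ o) (from-a z∈ o)
          where
          lem : ∀ {p q} → p ≡ suc q → q ≡ suc p → ⊥
          lem refl ()

      middle-not-end : ∀ {a b c e} → a ∈ₛ S → b ∈ₛ S → c ∈ₛ S → e ∈ₛ S → d a b ≡ 2 → d c e ≡ 2 →
        ¬ Dom S a b → ¬ Dom S b a → SameLine S a b c e → a ~ c → b ~ c → ⊥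
      middle-not-end {a} {b} a∈ b∈ c∈ e∈ dab dce ¬ab ¬ba L ac bc with common-nbr iso c∈ e∈ dce
      ... | m , m∈ , cm , em with mid-nbr ac bc cm
      ...   | inj₁ refl = middle-not-end′ a∈ b∈ c∈ e∈ dab dce ¬ba L ac bc (~-sym em)
      ...   | inj₂ (inj₁ refl) = middle-not-end′ b∈ a∈ c∈ e∈ (trans (d-sym b a) dab) dce ¬ab (swap₁ {S} L) bc ac (~-sym em)
      ...   | inj₂ (inj₂ o) = on-nbr cm (proj₁ (L m∈) o)

      -- Once middles are excluded as ends and no pair straddles the other, each pair lies on one
      -- side of the other, and the four orientations are instances of `Nested`. Domination is
      -- excluded for a and b alone, so that a new pair can be compared with arbitrary old ones.
      line-unique : ∀ {a b c e} → a ∈ₛ S → b ∈ₛ S → c ∈ₛ S → e ∈ₛ S → d a b ≡ 2 → d c e ≡ 2 →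
        ¬ Dom S a b → ¬ Dom S b a → ¬ SamePair a b c e → ¬ SameLine S a b c e
      line-unique {a} {b} {c} {e} a∈ b∈ c∈ e∈ dab dce ¬ab ¬ba ¬same L = cases (position dab c) (position dab e)
        where
        dba = trans (d-sym b a) dab
        dec = trans (d-sym e c) dce

        c-not-mid : a ~ c → b ~ c → ⊥
        c-not-mid = middle-not-end a∈ b∈ c∈ e∈ dab dce ¬ab ¬ba L
        e-not-mid : a ~ e → b ~ e → ⊥
        e-not-mid = middle-not-end a∈ b∈ e∈ c∈ dab dec ¬ab ¬ba (swap₂ {S} L)

        x-not-mid : ∀ {x} → x ∈ₛ S → (∀ {m} → m ∈ₛ S → a ~ m → b ~ m → x ~ m) → ¬ NotOnLine a b x → c ~ x → e ~ x → ⊥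
        x-not-mid x∈ xm on cx ex with common-nbr iso a∈ b∈ dab
        ... | m , m∈ , am , bm with mid-nbr cx ex (xm m∈ am bm)
        ...   | inj₁ refl = c-not-mid am bm
        ...   | inj₂ (inj₁ refl) = e-not-mid am bm
        ...   | inj₂ (inj₂ o) = on-nbr am (proj₂ (L m∈) o)

        middles-disjoint : ∀ {m} → m ∈ₛ S → a ~ m → b ~ m → c ~ m → e ~ m → ⊥
        middles-disjoint m∈ am bm cm em with mid-nbr am bm (~-sym cm) | mid-nbr am bm (~-sym em)
        ... | inj₂ (inj₂ o) | _ = on-self dce (proj₁ (L c∈) o)
        ... | _ | inj₂ (inj₂ o) = on-self' dce (proj₁ (L e∈) o)
        ... | inj₁ refl | inj₁ refl = d2⇒≢ dce refl
        ... | inj₂ (inj₁ refl) | inj₂ (inj₁ refl) = d2⇒≢ dce refl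
        ... | inj₁ refl | inj₂ (inj₁ refl) = ¬same (inj₁ (refl , refl))
        ... | inj₂ (inj₁ refl) | inj₁ refl = ¬same (inj₂ (refl , refl))

        -- A pair cannot straddle the other, since its middle would be adjacent to both sides. The
        -- argument `eq` lets one proof serve both labellings of c and e.
        same-side : ∀ {x y} → x ≡ c × y ≡ e ⊎ x ≡ e × y ≡ c → Near a b x → Near b a y → ⊥
        same-side eq nx ny with common-nbr iso c∈ e∈ dce
        ... | m , m∈ , cm , em with position dab m | xm eq | ym eq
          where
          xm : ∀ {x y} → x ≡ c × y ≡ e ⊎ x ≡ e × y ≡ c → x ~ m
          xm (inj₁ (refl , refl)) = cm
          xm (inj₂ (refl , refl)) = em
          ym : ∀ {x y} → x ≡ c × y ≡ e ⊎ x ≡ e × y ≡ c → y ~ m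
          ym (inj₁ (refl , refl)) = em
          ym (inj₂ (refl , refl)) = cm
        ... | near₁ nm | _ | ym = near-separated nm ny (~-sym ym)
        ... | near₂ nm | xm | _ = near-separated nx nm xm
        ... | mid am bm | _ | _ = middles-disjoint m∈ am bm cm em
        ... | off o | _ | _ = on-nbr cm (proj₁ (L m∈) o)

        same-side′ : ∀ {x y} → x ≡ a × y ≡ b ⊎ x ≡ b × y ≡ a → Near c e x → Near e c y → ⊥
        same-side′ eq nx ny with common-nbr iso a∈ b∈ dab
        ... | m , m∈ , am , bm with position dce m | xm eq | ym eq
          where
          xm : ∀ {x y} → x ≡ a × y ≡ b ⊎ x ≡ b × y ≡ a → x ~ m
          xm (inj₁ (refl , refl)) = am
          xm (inj₂ (refl , refl)) = bm
          ym : ∀ {x y} → x ≡ a × y ≡ b ⊎ x ≡ b × y ≡ a → y ~ m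
          ym (inj₁ (refl , refl)) = bm
          ym (inj₂ (refl , refl)) = am
        ... | near₁ nm | _ | ym = near-separated nm ny (~-sym ym)
        ... | near₂ nm | xm | _ = near-separated nx nm xm
        ... | mid cm em | _ | _ = middles-disjoint m∈ am bm cm em
        ... | off o | _ | _ = on-nbr am (proj₂ (L m∈) o)

        mid-near₁ : Near a b c → ∀ {m} → m ∈ₛ S → c ~ m → e ~ m → Near a b m
        mid-near₁ nc {m} m∈ cm em with position dab m
        ... | near₁ n = n
        ... | near₂ n = ⊥-elim (near-separated nc n cm)
        ... | mid am bm = ⊥-elim (middles-disjoint m∈ am bm cm em)
        ... | off o = ⊥-elim (on-nbr cm (proj₁ (L m∈) o))

        mid-near₂ : Near b a c → ∀ {m} → m ∈ₛ S → c ~ m → e ~ m → Near b a m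
        mid-near₂ nc {m} m∈ cm em with position dab m
        ... | near₂ n = n
        ... | near₁ n = ⊥-elim (near-separated n nc (~-sym cm))
        ... | mid am bm = ⊥-elim (middles-disjoint m∈ am bm cm em)
        ... | off o = ⊥-elim (on-nbr cm (proj₁ (L m∈) o))

        a-not-mid : c ~ a → e ~ a → ⊥
        a-not-mid = x-not-mid a∈ (λ _ am _ → am) (on-self dab)
        b-not-mid : c ~ b → e ~ b → ⊥
        b-not-mid = x-not-mid b∈ (λ _ _ bm → bm) (on-self' dab)

        ends : (Near e c a → Near e c b → ⊥) → (Near c e a → Near c e b → ⊥) → ⊥
        ends f g with position dce a | position dce b
        ... | mid ca ea | _ = a-not-mid ca ea
        ... | _ | mid cb eb = b-not-mid cb eb
        ... | off o | _ = on-self dab (proj₂ (L a∈) o)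
        ... | _ | off o = on-self' dab (proj₂ (L b∈) o)
        ... | near₁ na | near₁ nb = g na nb
        ... | near₂ na | near₂ nb = f na nb
        ... | near₁ na | near₂ nb = same-side′ (inj₁ (refl , refl)) na nb
        ... | near₂ na | near₁ nb = same-side′ (inj₂ (refl , refl)) nb na

        cases : Position a b c → Position a b e → ⊥
        cases (mid ac bc) _ = c-not-mid ac bc
        cases _ (mid ae be) = e-not-mid ae be
        cases (off o) _ = on-self dce (proj₁ (L c∈) o)
        cases _ (off o) = on-self' dce (proj₁ (L e∈) o)
        cases (near₁ nc) (near₂ ne) = same-side (inj₁ (refl , refl)) nc ne
        cases (near₂ nc) (near₁ ne) = same-side (inj₂ (refl , refl)) ne nc
        cases (near₁ nc) (near₁ ne) = ends
          (λ _ eb → boundary-edge a∈ b∈ dab ¬ba (Nested.no-boundary-edge a∈ b∈ e∈ dab dce L ne eb (mid-near₁ nc)))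
          (λ _ cb → boundary-edge a∈ b∈ dab ¬ba (Nested.no-boundary-edge a∈ b∈ c∈ dab dec (swap₂ {S} L) nc cb
                      (λ m∈ em cm → mid-near₁ nc m∈ cm em)))
        cases (near₂ nc) (near₂ ne) = ends
          (λ ea _ → boundary-edge b∈ a∈ dba ¬ab (Nested.no-boundary-edge b∈ a∈ e∈ dba dce (swap₁ {S} L) ne ea (mid-near₂ nc)))
          (λ ca _ → boundary-edge b∈ a∈ dba ¬ab (Nested.no-boundary-edge b∈ a∈ c∈ dba dec (swap₁ {S} (swap₂ {S} L)) nc ca
                      (λ m∈ em cm → mid-near₂ nc m∈ cm em)))

  -- Isometric subsets and families of distinct lines and bridges

  infixl 7 _∖_
  infix 4 _⊆_

  _⊆_ : Subset → Subset → Set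
  S′ ⊆ S = ∀ {x} → x ∈ₛ S′ → x ∈ₛ S

  _∖_ : Subset → V → Subset
  S ∖ b = S ∩ λ x → ¬? (x ≟ᶠ b)

  ∖⁺ : ∀ {S b x} → x ∈ₛ S → x ≢ b → x ∈ₛ S ∖ b
  ∖⁺ {b = b} = ∈∩⁺ (λ x → ¬? (x ≟ᶠ b))

  ∖⁻ : ∀ {S b x} → x ∈ₛ S ∖ b → x ∈ₛ S × x ≢ b
  ∖⁻ {b = b} = ∈∩⁻ (λ x → ¬? (x ≟ᶠ b))

  ∖-⊆ : ∀ {S b} → S ∖ b ⊆ S
  ∖-⊆ = proj₁ ∘ ∖⁻

  _∈ₛ?_ : ∀ x S → Dec (x ∈ₛ S)
  x ∈ₛ? S = map′ mem _∈ₛ_.holds (S x ≟ᵇ true)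

  members : Subset → List V
  members S = filter (_∈ₛ? S) (allFin N)

  size : Subset → ℕ
  size S = length (members S)

  members⁺ : ∀ {S x} → x ∈ₛ S → x ∈ members S
  members⁺ {S} x∈ = ∈-filter⁺ (_∈ₛ? S) (∈-allFin _) x∈

  members⁻ : ∀ {S x} → x ∈ members S → x ∈ₛ S
  members⁻ {S} = proj₂ ∘ ∈-filter⁻ (_∈ₛ? S) {xs = allFin N}

  members-unique : ∀ S → Unique (members S)
  members-unique S = Uniqueₚ.filter⁺ (_∈ₛ? S) (Uniqueₚ.allFin⁺ N)

  size≤ : ∀ {S xs} → (∀ {x} → x ∈ₛ S → x ∈ xs) → size S ≤ length xs
  size≤ {S} cover = unique-⊆⇒length≤ (members-unique S) (cover ∘ members⁻)

  size≥ : ∀ {S xs} → Unique xs → (∀ {x} → x ∈ xs → x ∈ₛ S) → length xs ≤ size S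
  size≥ u inside = unique-⊆⇒length≤ u (members⁺ ∘ inside)

  size-∖≤ : ∀ {S b} → size S ≤ suc (size (S ∖ b))
  size-∖≤ {S} {b} = size≤ {xs = b ∷ members (S ∖ b)} λ {x} x∈ → case x x∈
    where
    case : ∀ x → x ∈ₛ S → x ∈ b ∷ members (S ∖ b)
    case x x∈ with x ≟ᶠ b
    ... | yes refl = here refl
    ... | no x≢b = there (members⁺ (∖⁺ x∈ x≢b))

  size-∖< : ∀ {S b} → b ∈ₛ S → suc (size (S ∖ b)) ≤ size S
  size-∖< {S} {b} b∈ = size≥ {xs = b ∷ members (S ∖ b)}
    (All.tabulate (λ x∈ b≡x → proj₂ (∖⁻ (members⁻ x∈)) (sym b≡x)) ∷ members-unique (S ∖ b))
    (λ { (here refl) → b∈ ; (there x∈) → ∖-⊆ (members⁻ x∈) })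

  Nearer : V → V → V → Set
  Nearer x u v = d x v ≡ suc (d x u)

  nearer-asym : ∀ {x u v} → Nearer x u v → Nearer x v u → ⊥
  nearer-asym p q = lem p q
    where
    lem : ∀ {m n} → m ≡ suc n → n ≡ suc m → ⊥
    lem refl ()

  -- In a bipartite graph every vertex is nearer to one end of the edge uv than to the other, and
  -- uv is a bridge iff no other edge joins the two sides.
  record Bridge (S : Subset) (u v : V) : Set where
    constructor mkBridge
    field
      u∈ : u ∈ₛ S
      v∈ : v ∈ₛ S
      edge : u ~ v
      only : ∀ {x y} → x ∈ₛ S → y ∈ₛ S → x ~ y → Nearer x u v → Nearer y v u → x ≡ u × y ≡ v

  -- The theorem adds two counts, so a single list with entries of both kinds is used to bound their
  -- sum from below.
  data Token : Set where
    lineToken bridgeToken : V → V → Token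

  Valid : Subset → Token → Set
  Valid S (lineToken a b) = a ∈ₛ S × b ∈ₛ S × d a b ≡ 2
  Valid S (bridgeToken u v) = Bridge S u v

  Distinct : Subset → Token → Token → Set
  Distinct S (lineToken a b) (lineToken c e) = ¬ SameLine S a b c e
  Distinct S (bridgeToken u v) (bridgeToken u′ v′) = ¬ SamePair u v u′ v′
  Distinct S _ _ = ⊤

  distinct-sym : ∀ {S s t} → Distinct S s t → Distinct S t s
  distinct-sym {S} {lineToken a b} {lineToken c e} D L = D (sameLine-sym {S} L)
  distinct-sym {s = lineToken _ _} {bridgeToken _ _} _ = tt
  distinct-sym {s = bridgeToken _ _} {lineToken _ _} _ = tt
  distinct-sym {s = bridgeToken _ _} {bridgeToken _ _} D (inj₁ (p , q)) = D (inj₁ (sym p , sym q))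
  distinct-sym {s = bridgeToken _ _} {bridgeToken _ _} D (inj₂ (p , q)) = D (inj₂ (sym q , sym p))

  -- Equal lines of S have equal traces on S′.
  distinct-mono : ∀ {S′ S s t} → S′ ⊆ S → Distinct S′ s t → Distinct S s t
  distinct-mono {s = lineToken a b} {lineToken c e} sub D L = D (L ∘ sub)
  distinct-mono {s = lineToken _ _} {bridgeToken _ _} _ _ = tt
  distinct-mono {s = bridgeToken _ _} {lineToken _ _} _ _ = tt
  distinct-mono {s = bridgeToken _ _} {bridgeToken _ _} _ D = D

  separating : ∀ {S a b c e z} → z ∈ₛ S → NotOnLine a b z → ¬ NotOnLine c e z → ¬ SameLine S a b c e
  separating z∈ o on L = on (proj₁ (L z∈) o)

  separating′ : ∀ {S a b c e z} → z ∈ₛ S → ¬ NotOnLine a b z → NotOnLine c e z → ¬ SameLine S a b c e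
  separating′ z∈ on o L = on (proj₂ (L z∈) o)

  record Tokens (S : Subset) : Set where
    constructor tokens
    field
      list : List Token
      valid : All (Valid S) list
      distinct : AllPairs (Distinct S) list

    count : ℕ
    count = length list

  Good : Subset → Set
  Good S = ∃ λ (T : Tokens S) → size S ≤ Tokens.count T

  lift : ∀ {S′ S} → S′ ⊆ S → (T : Tokens S′) → (∀ {u v} → bridgeToken u v ∈ Tokens.list T → Bridge S′ u v → Bridge S u v) → Tokens S
  lift {S′} {S} sub (tokens ts val dis) br = tokens ts (All.tabulate λ {t} t∈ → ok t t∈ (All.lookup val t∈))
    (AllPairs.map (λ {s} {t} → distinct-mono {s = s} {t} sub) dis)
    where
    ok : ∀ t → t ∈ ts → Valid S′ t → Valid S t
    ok (lineToken a b) _ (a∈ , b∈ , e) = sub a∈ , sub b∈ , e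
    ok (bridgeToken u v) t∈ B = br t∈ B

  append : ∀ {S} (T₁ T₂ : Tokens S) → All (λ s → All (Distinct S s) (Tokens.list T₂)) (Tokens.list T₁) → Tokens S
  append (tokens ts val dis) (tokens ts′ val′ dis′) D = tokens (ts ++ ts′) (All-++⁺ val val′) (AllPairs-++⁺ dis dis′ D)

  append-count : ∀ {S} (T₁ T₂ : Tokens S) D → Tokens.count (append T₁ T₂ D) ≡ Tokens.count T₁ + Tokens.count T₂
  append-count T₁ T₂ D = length-++ (Tokens.list T₁)

  drop-token : ∀ {S} (T : Tokens S) {t} → t ∈ Tokens.list T →
    ∃ λ (T′ : Tokens S) → Tokens.count T ≡ suc (Tokens.count T′) × (∀ {x} → x ∈ Tokens.list T′ → x ∈ Tokens.list T × Distinct S t x)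
  drop-token {S} (tokens ts val dis) {t} t∈ with AllPairs-remove (λ {s} {t} → distinct-sym {S} {s} {t}) t∈ dis
  ... | us , len , us⊆ , fresh , dis′ =
    tokens us (All.tabulate (λ p → All.lookup val (us⊆ p))) dis′ , len , λ p → us⊆ p , All.lookup fresh p

  New : Subset → Subset → V × V → Set
  New S′ S (a , b) = ∀ {c e} → c ∈ₛ S′ → e ∈ₛ S′ → d c e ≡ 2 → ¬ SameLine S a b c e

  module _ {S : Subset} (iso : Isometric S) where

    -- The first vertex after b on a geodesic from b to t is also a neighbour of a.
    dom-dist : ∀ {a b t} → b ∈ₛ S → t ∈ₛ S → t ≢ b → Dom S b a → d a t ≤ d b t
    dom-dist {a} {b} {t} b∈ t∈ t≢b dom with iso b∈ t∈ (t≢b ∘ sym)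
    ... | z , z∈ , bz , s = ≤-trans (d-triangle a z t) (≤-reflexive
      (trans (cong (_+ d z t) (~-sym (dom z∈ (~-sym bz)))) (trans (cong suc (d-sym z t)) (trans (sym s) (d-sym t b)))))

    -- A geodesic step onto b is replaced by a step onto a: by `dom-dist` a is no farther from the
    -- target than b, and `d-alternates` then leaves only a step closer.
    isometric-∖ : ∀ {a b} → a ∈ₛ S → b ∈ₛ S → a ≢ b → Dom S b a → Isometric (S ∖ b)
    isometric-∖ {a} {b} a∈ b∈ a≢b dom {x} {y} x∈ y∈ x≢y with ∖⁻ x∈ | ∖⁻ y∈
    ... | x∈′ , x≢b | y∈′ , y≢b with iso x∈′ y∈′ x≢y
    ... | z , z∈ , xz , s with z ≟ᶠ b
    ...   | no z≢b = z , ∖⁺ z∈ z≢b , xz , s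
    ...   | yes refl = a , ∖⁺ a∈ a≢b , dom x∈′ xz ,
            lem (d-alternates (dom x∈′ xz) y) s (subst (_≤ d y b) (d-sym a y) (subst (d a y ≤_) (d-sym b y) (dom-dist b∈ y∈′ y≢b dom)))
      where
      lem : ∀ {p q r} → q ≡ suc p ⊎ p ≡ suc q → p ≡ suc r → q ≤ r → p ≡ suc q
      lem (inj₂ e) _ _ = e
      lem (inj₁ refl) refl le = ⊥-elim (n≮n _ (≤-trans (m≤n+m _ 1) le))

    twin-dist : ∀ {w w′ t} → w ∈ₛ S → w′ ∈ₛ S → Dom S w w′ → Dom S w′ w → t ∈ₛ S → t ≢ w → t ≢ w′ → d w t ≡ d w′ t
    twin-dist w∈ w′∈ dom dom′ t∈ t≢w t≢w′ = ≤-antisym (dom-dist w′∈ t∈ t≢w′ dom′) (dom-dist w∈ t∈ t≢w dom)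

    module Twins {w w′} (w∈ : w ∈ₛ S) (w′∈ : w′ ∈ₛ S) (dom : Dom S w w′) (dom′ : Dom S w′ w) (dww′ : d w w′ ≡ 2) where

      on-twin-line : ∀ {x} → x ∈ₛ S → ¬ NotOnLine w w′ x → x ≡ w ⊎ x ≡ w′ ⊎ w ~ x
      on-twin-line {x} x∈ on with x ≟ᶠ w | x ≟ᶠ w′ | w ~? x
      ... | yes e | _ | _ = inj₁ e
      ... | _ | yes e | _ = inj₂ (inj₁ e)
      ... | _ | _ | yes e = inj₂ (inj₂ e)
      ... | no x≢w | no x≢w′ | no ¬wx = ⊥-elim (on (twin-dist w∈ w′∈ dom dom′ x∈ x≢w x≢w′ , ¬wx))

      -- The line of the twins consists of w, w′ and their common neighbours, so another pair with
      -- this line is formed by two of those neighbours. Then `extra` supplies one more vertex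
      -- adjacent to c or e: it lies on their line but not on that of the twins.
      twin-line-unique : ∀ {c e} → c ∈ₛ S → e ∈ₛ S → d c e ≡ 2 → ¬ SamePair w w′ c e →
        (w ~ c → w ~ e → ∃ λ t → t ∈ₛ S × t ≢ w × t ≢ w′ × (t ~ c ⊎ t ~ e)) → ¬ SameLine S w w′ c e
      twin-line-unique {c} {e} c∈ e∈ dce ¬same extra L
        with on-twin-line c∈ (on-self dce ∘ proj₁ (L c∈)) | on-twin-line e∈ (on-self' dce ∘ proj₁ (L e∈))
      ... | inj₁ refl | inj₁ refl = d2⇒≢ dce refl
      ... | inj₁ refl | inj₂ (inj₁ refl) = ¬same (inj₁ (refl , refl))
      ... | inj₁ refl | inj₂ (inj₂ we) = d2⇒≁ dce we
      ... | inj₂ (inj₁ refl) | inj₁ refl = ¬same (inj₂ (refl , refl))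
      ... | inj₂ (inj₁ refl) | inj₂ (inj₁ refl) = d2⇒≢ dce refl
      ... | inj₂ (inj₁ refl) | inj₂ (inj₂ we) = d2⇒≁ dce (~-sym (dom e∈ (~-sym we)))
      ... | inj₂ (inj₂ wc) | inj₁ refl = d2⇒≁ dce (~-sym wc)
      ... | inj₂ (inj₂ wc) | inj₂ (inj₁ refl) = d2⇒≁ dce (dom c∈ (~-sym wc))
      ... | inj₂ (inj₂ wc) | inj₂ (inj₂ we) with extra wc we
      ... | t , t∈ , t≢w , t≢w′ , inj₁ tc with on-twin-line t∈ (on-nbr (~-sym tc) ∘ proj₁ (L t∈))
      ...   | inj₁ t≡w = t≢w t≡w
      ...   | inj₂ (inj₁ t≡w′) = t≢w′ t≡w′
      ...   | inj₂ (inj₂ wt) = nbrs≁ wc tc wt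
      twin-line-unique c∈ e∈ dce ¬same extra L | inj₂ (inj₂ wc) | inj₂ (inj₂ we) | t , t∈ , t≢w , t≢w′ , inj₂ te
        with on-twin-line t∈ (on-nbr' (~-sym te) ∘ proj₁ (L t∈))
      ...   | inj₁ t≡w = t≢w t≡w
      ...   | inj₂ (inj₁ t≡w′) = t≢w′ t≡w′
      ...   | inj₂ (inj₂ wt) = nbrs≁ we te wt

      -- The line of w′ and y contains w′ but not w, while a line of two other vertices cannot separate the twins.
      split-twins : ∀ {y c e} → y ∈ₛ S → d w′ y ≡ 2 → y ≢ w → c ∈ₛ S → e ∈ₛ S → d c e ≡ 2 → c ≢ w′ → e ≢ w′ →
        ¬ SameLine S w′ y c e
      split-twins {y} {c} {e} y∈ dw′y y≢w c∈ e∈ dce c≢w′ e≢w′ L = on-self dw′y (proj₂ (L w′∈) (cases (c ≟ᶠ w) (e ≟ᶠ w)))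
        where
        w-off : NotOnLine c e w
        w-off = proj₁ (L w∈) (d2-off (trans (d-sym w′ w) dww′)
          (trans (d-sym y w) (trans (twin-dist w∈ w′∈ dom dom′ y∈ y≢w (d2⇒≢ dw′y ∘ sym)) dw′y)))
        same : ∀ {x} → x ∈ₛ S → x ≢ w → x ≢ w′ → d x w ≡ d x w′
        same {x} x∈ x≢w x≢w′ = trans (d-sym x w) (trans (twin-dist w∈ w′∈ dom dom′ x∈ x≢w x≢w′) (d-sym w′ x))
        cases : Dec (c ≡ w) → Dec (e ≡ w) → NotOnLine c e w′
        cases (yes refl) _ = ⊥-elim (on-self dce w-off)
        cases _ (yes refl) = ⊥-elim (on-self' dce w-off)
        cases (no c≢w) (no e≢w) =
          trans (sym (same c∈ c≢w c≢w′)) (trans (proj₁ w-off) (same e∈ e≢w e≢w′))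
          , λ cw′ → proj₂ w-off (trans (same c∈ c≢w c≢w′) cw′)

  -- Bridges and the exceptional graphs

  bridge-swap : ∀ {S u v} → Bridge S u v → Bridge S v u
  bridge-swap (mkBridge u∈ v∈ e only) = mkBridge v∈ u∈ (~-sym e) λ x∈ y∈ xy nx ny →
    let (p , q) = only y∈ x∈ (~-sym xy) ny nx in q , p

  -- The opposite edge of the 4-cycle joins the same two sides.
  bridge-no-4-cycle : ∀ {S u v p q} → Bridge S u v → p ∈ₛ S → q ∈ₛ S → v ~ p → p ~ q → q ~ u → p ≢ u → q ≢ v → ⊥
  bridge-no-4-cycle B p∈ q∈ vp pq qu p≢u q≢v = ~⇒≢ qu (proj₁ (Bridge.only B q∈ p∈ (~-sym pq)
    (trans (common-nbr⇒d2 qu (~-sym (Bridge.edge B)) q≢v) (cong suc (sym qu)))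
    (trans (common-nbr⇒d2 (~-sym vp) (Bridge.edge B) p≢u) (cong suc (sym (~-sym vp))))))

  -- A geodesic to u that starts on the side of u stays on that side.
  nearer-step : ∀ {b w u v} → b ~ w → u ~ v → d u b ≡ suc (d u w) → Nearer b u v → Nearer w u v
  nearer-step {b} {w} {u} {v} bw uv s n with d-alternates uv w
  ... | inj₁ n′ = n′
  ... | inj₂ n′ = ⊥-elim (lem (d-alternates bw v) (trans s (cong suc (trans (d-sym u w) (trans n′ (cong suc (d-sym w v))))))
                             (trans (d-sym v b) (trans n (cong suc (d-sym b u)))))
    where
    lem : ∀ {p q r} → q ≡ suc p ⊎ p ≡ suc q → r ≡ 2 + q → p ≡ suc r → ⊥
    lem (inj₁ refl) refl ()
    lem (inj₂ refl) refl ()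

  module _ {S : Subset} (iso : Isometric S) where

    -- An edge b y that crosses from the side of u to that of v can be traded for one that avoids b:
    -- the edge a y if a is on the side of u, and otherwise w a, where w follows b on a geodesic to
    -- u. That edge must be uv, which then joins a to a neighbour of b, the excluded case.
    bridge-∖-dominated : ∀ {a b u v} → a ∈ₛ S → b ∈ₛ S → a ≢ b → Dom S b a → Bridge (S ∖ b) u v →
      ¬ (u ≡ a × v ~ b) → ¬ (v ≡ a × u ~ b) → Bridge S u v
    bridge-∖-dominated {a} {b} {u} {v} a∈ b∈ a≢b dom B ¬uv ¬vu =
      mkBridge (∖-⊆ (Bridge.u∈ B)) (∖-⊆ (Bridge.v∈ B)) (Bridge.edge B) only
      where
      through-b : ∀ {u v y} → Bridge (S ∖ b) u v → ¬ (u ≡ a × v ~ b) → ¬ (v ≡ a × u ~ b) →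
        y ∈ₛ S → b ~ y → Nearer b u v → Nearer y v u → ⊥
      through-b {u} {v} {y} B ¬uv ¬vu y∈ by nb ny with d-alternates (Bridge.edge B) a
      ... | inj₁ na with Bridge.only B (∖⁺ a∈ a≢b) (∖⁺ y∈ (~⇒≢ by ∘ sym)) (~-sym (dom y∈ (~-sym by))) na ny
      ...   | a≡u , refl = ¬uv (sym a≡u , ~-sym by)
      through-b {u} {v} {y} B ¬uv ¬vu y∈ by nb ny | inj₂ na with ∖⁻ (Bridge.u∈ B)
      ... | u∈ , u≢b with iso b∈ u∈ (u≢b ∘ sym)
      ... | w , w∈ , bw , s with Bridge.only B (∖⁺ w∈ (~⇒≢ bw ∘ sym)) (∖⁺ a∈ a≢b) (dom w∈ (~-sym bw))
                                  (nearer-step bw (Bridge.edge B) s nb) na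
      ...   | refl , a≡v = ¬vu (sym a≡v , ~-sym bw)
      only : ∀ {x y} → x ∈ₛ S → y ∈ₛ S → x ~ y → Nearer x u v → Nearer y v u → x ≡ u × y ≡ v
      only {x} {y} x∈ y∈ xy nx ny with x ≟ᶠ b | y ≟ᶠ b
      ... | no x≢b | no y≢b = Bridge.only B (∖⁺ x∈ x≢b) (∖⁺ y∈ y≢b) xy nx ny
      ... | yes refl | _ = ⊥-elim (through-b B ¬uv ¬vu y∈ xy nx ny)
      ... | _ | yes refl = ⊥-elim (through-b (bridge-swap B) ¬vu ¬uv x∈ (~-sym xy) ny nx)

    module Leaf {b w} (b∈ : b ∈ₛ S) (w∈ : w ∈ₛ S) (bw : b ~ w) (leaf : ∀ {t} → t ∈ₛ S → t ~ b → t ≡ w) where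

      leaf-dist : ∀ {t} → t ∈ₛ S → t ≢ b → d t b ≡ suc (d t w)
      leaf-dist t∈ t≢b with iso b∈ t∈ (t≢b ∘ sym)
      ... | z , z∈ , bz , s with leaf z∈ (~-sym bz)
      ...   | refl = s

      leaf-bridge : Bridge S b w
      leaf-bridge = mkBridge b∈ w∈ bw only
        where
        only : ∀ {x y} → x ∈ₛ S → y ∈ₛ S → x ~ y → Nearer x b w → Nearer y w b → x ≡ b × y ≡ w
        only {x} {y} x∈ y∈ xy nx ny with x ≟ᶠ b
        ... | yes refl = refl , leaf y∈ (~-sym xy)
        ... | no x≢b = ⊥-elim (nearer-asym nx (leaf-dist x∈ x≢b))

      bridge-∖-leaf : ∀ {u v} → Bridge (S ∖ b) u v → Bridge S u v
      bridge-∖-leaf {u} {v} B = mkBridge (∖-⊆ (Bridge.u∈ B)) (∖-⊆ (Bridge.v∈ B)) (Bridge.edge B) only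
        where
        through-b : ∀ {u v y} → Bridge (S ∖ b) u v → y ∈ₛ S → b ~ y → Nearer b u v → Nearer y v u → ⊥
        through-b B y∈ by nb ny with leaf y∈ (~-sym by) | ∖⁻ (Bridge.u∈ B)
        ... | refl | u∈ , u≢b = nearer-asym (nearer-step bw (Bridge.edge B) (leaf-dist u∈ u≢b) nb) ny
        only : ∀ {x y} → x ∈ₛ S → y ∈ₛ S → x ~ y → Nearer x u v → Nearer y v u → x ≡ u × y ≡ v
        only {x} {y} x∈ y∈ xy nx ny with x ≟ᶠ b | y ≟ᶠ b
        ... | no x≢b | no y≢b = Bridge.only B (∖⁺ x∈ x≢b) (∖⁺ y∈ y≢b) xy nx ny
        ... | yes refl | _ = ⊥-elim (through-b B y∈ xy nx ny)
        ... | _ | yes refl = ⊥-elim (through-b (bridge-swap B) x∈ (~-sym xy) ny nx)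

  -- In S, the far side of a bridge of S′ can only be left through its endpoint x.
  bridge-cut : ∀ {S S′ u x x′} → S′ ⊆ S → Bridge S′ u x →
    (∀ {s t} → s ∈ₛ S → ¬ (s ∈ₛ S′) → t ∈ₛ S′ → Nearer t x u → t ≢ x → ¬ (t ~ s)) →
    x′ ∈ₛ S′ → x′ ~ x → x′ ≢ u → CutVertex S
  bridge-cut {S} {S′} {u} {x} {x′} sub B out x′∈ x′x x′≢u = record
    { v = x ; s = u ; t = x′ ; v∈ = sub (Bridge.v∈ B) ; s∈ = sub (Bridge.u∈ B) ; side = S′ ∩ P?
    ; side⊆ = sub ∘ proj₁ ∘ ∈∩⁻ P?
    ; v∉ = λ x∈T → proj₂ (proj₂ (∈∩⁻ {S′} P? x∈T)) refl
    ; t∈ = ∈∩⁺ P? x′∈ (trans (common-nbr⇒d2 x′x (Bridge.edge B) x′≢u) (cong suc (sym x′x)) , ~⇒≢ x′x)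
    ; s∉ = λ u∈T → u-far (proj₁ (proj₂ (∈∩⁻ {S′} P? u∈T)))
    ; s≢v = ~⇒≢ (Bridge.edge B) ; sep = sep }
    where
    P? : ∀ t → Dec (Nearer t x u × t ≢ x)
    P? t = (d t u ≟ suc (d t x)) ×-dec ¬? (t ≟ᶠ x)
    u-far : ¬ Nearer u x u
    u-far n with trans (sym (d-refl u)) n
    ... | ()
    sep : ∀ {t s} → t ∈ₛ S′ ∩ P? → s ∈ₛ S → ¬ (s ∈ₛ S′ ∩ P?) → s ≢ x → ¬ (t ~ s)
    sep {t} {s} t∈T s∈ s∉T s≢x ts with ∈∩⁻ P? t∈T | s ∈ₛ? S′
    ... | t∈ , nt , t≢x | no s∉ = out s∈ s∉ t∈ nt t≢x ts
    ... | t∈ , nt , t≢x | yes s∈′ with d-alternates (Bridge.edge B) s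
    ...   | inj₁ ns = t≢x (proj₂ (Bridge.only B s∈′ t∈ (~-sym ts) ns nt))
    ...   | inj₂ ns = s∉T (∈∩⁺ P? s∈′ (ns , s≢x))

  record Biclique (S : Subset) (xs ys : List V) : Set where
    field
      xs-unique : Unique xs
      ys-unique : Unique ys
      xs-in : ∀ {x} → x ∈ xs → x ∈ₛ S
      ys-in : ∀ {y} → y ∈ ys → y ∈ₛ S
      joined : ∀ {x y} → x ∈ xs → y ∈ ys → x ~ y
      cover : ∀ {s} → s ∈ₛ S → s ∈ xs ⊎ s ∈ ys

  IsC₄ IsK₂₃ : Subset → Set
  IsC₄ S = ∃ λ x₁ → ∃ λ x₂ → ∃ λ y₁ → ∃ λ y₂ → Biclique S (x₁ ∷ x₂ ∷ []) (y₁ ∷ y₂ ∷ [])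
  IsK₂₃ S = ∃ λ x₁ → ∃ λ x₂ → ∃ λ y₁ → ∃ λ y₂ → ∃ λ y₃ → Biclique S (x₁ ∷ x₂ ∷ []) (y₁ ∷ y₂ ∷ y₃ ∷ [])

  flip : ∀ {S xs ys} → Biclique S xs ys → Biclique S ys xs
  flip K = record { xs-unique = ys-unique ; ys-unique = xs-unique ; xs-in = ys-in ; ys-in = xs-in
                  ; joined = λ x∈ y∈ → ~-sym (joined y∈ x∈) ; cover = λ s∈ → swap⊎ (cover s∈) }
    where
    open Biclique K
    swap⊎ : ∀ {A B : Set} → A ⊎ B → B ⊎ A
    swap⊎ (inj₁ a) = inj₂ a
    swap⊎ (inj₂ b) = inj₁ b

  swap-xs : ∀ {S x₁ x₂ ys} → Biclique S (x₁ ∷ x₂ ∷ []) ys → Biclique S (x₂ ∷ x₁ ∷ []) ys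
  swap-xs K = record
    { xs-unique = sw-unique xs-unique ; ys-unique = ys-unique ; xs-in = xs-in ∘ sw ; ys-in = ys-in
    ; joined = joined ∘ sw ; cover = λ s∈ → sw⊎ (cover s∈) }
    where
    open Biclique K
    sw : ∀ {a b x : V} → x ∈ a ∷ b ∷ [] → x ∈ b ∷ a ∷ []
    sw (here e) = there (here e)
    sw (there (here e)) = here e
    sw⊎ : ∀ {a b x : V} {B : Set} → x ∈ a ∷ b ∷ [] ⊎ B → x ∈ b ∷ a ∷ [] ⊎ B
    sw⊎ (inj₁ p) = inj₁ (sw p)
    sw⊎ (inj₂ q) = inj₂ q
    sw-unique : ∀ {a b : V} → Unique (a ∷ b ∷ []) → Unique (b ∷ a ∷ [])
    sw-unique ((n ∷ []) ∷ [] ∷ []) = ((n ∘ sym) ∷ []) ∷ [] ∷ []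

  biclique-d≤2 : ∀ {S x₀ xs y₀ ys} → Biclique S (x₀ ∷ xs) (y₀ ∷ ys) → ∀ {s t} → s ∈ₛ S → t ∈ₛ S → d s t ≤ 2
  biclique-d≤2 K {s} {t} s∈ t∈ with s ≟ᶠ t
  ... | yes refl = ≤-trans (≤-reflexive (d-refl s)) z≤n
  ... | no s≢t with Biclique.cover K s∈ | Biclique.cover K t∈
  ...   | inj₁ p | inj₁ q = ≤-reflexive (common-nbr⇒d2 (Biclique.joined K p (here refl)) (Biclique.joined K q (here refl)) s≢t)
  ...   | inj₂ p | inj₂ q = ≤-reflexive (common-nbr⇒d2 (~-sym (Biclique.joined K (here refl) p)) (~-sym (Biclique.joined K (here refl) q)) s≢t)
  ...   | inj₁ p | inj₂ q = ≤-trans (≤-reflexive (Biclique.joined K p q)) (s≤s z≤n)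
  ...   | inj₂ p | inj₁ q = ≤-trans (≤-reflexive (~-sym (Biclique.joined K q p))) (s≤s z≤n)

  two-nbrs : ∀ {S x₁ x₂ xs y₁ y₂ ys} → Biclique S (x₁ ∷ x₂ ∷ xs) (y₁ ∷ y₂ ∷ ys) → ∀ {s} → s ∈ₛ S →
    ∃ λ t → ∃ λ t′ → t ∈ₛ S × t′ ∈ₛ S × t ≢ t′ × t ~ s × t′ ~ s
  two-nbrs K s∈ with Biclique.cover K s∈ | Biclique.xs-unique K | Biclique.ys-unique K
  ... | inj₁ p | _ | (n ∷ _) ∷ _ = _ , _ , Biclique.ys-in K (here refl) , Biclique.ys-in K (there (here refl)) , n
        , ~-sym (Biclique.joined K p (here refl)) , ~-sym (Biclique.joined K p (there (here refl)))
  ... | inj₂ p | (n ∷ _) ∷ _ | _ = _ , _ , Biclique.xs-in K (here refl) , Biclique.xs-in K (there (here refl)) , n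
        , Biclique.joined K (here refl) p , Biclique.joined K (there (here refl)) p

  -- Each pair from the class of three misses the third vertex, and x₁, x₂ generate the universal
  -- line: one line fewer than vertices.
  K₂₃-tokens : ∀ {S x₁ x₂ y₁ y₂ y₃} → Biclique S (x₁ ∷ x₂ ∷ []) (y₁ ∷ y₂ ∷ y₃ ∷ []) → ∃ λ (T : Tokens S) → Tokens.count T ≡ 4
  K₂₃-tokens {S} {x₁} {x₂} {y₁} {y₂} {y₃} K with Biclique.xs-unique K | Biclique.ys-unique K
  ... | (x₁≢x₂ ∷ []) ∷ _ | (y₁≢y₂ ∷ y₁≢y₃ ∷ []) ∷ (y₂≢y₃ ∷ []) ∷ _ = tokens
    (lineToken y₁ y₂ ∷ lineToken y₁ y₃ ∷ lineToken y₂ y₃ ∷ lineToken x₁ x₂ ∷ [])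
    ((i₁ , i₂ , d₁₂) ∷ (i₁ , i₃ , d₁₃) ∷ (i₂ , i₃ , d₂₃) ∷ (xs-in (here refl) , xs-in (there (here refl)) , dx) ∷ [])
    ( (separating {S} i₃ (d2-off d₁₃ d₂₃) (on-self' d₁₃) ∷ separating {S} i₃ (d2-off d₁₃ d₂₃) (on-self' d₂₃)
        ∷ separating {S} i₃ (d2-off d₁₃ d₂₃) (on-nbr a₃) ∷ [])
    ∷ (separating {S} i₂ (d2-off d₁₂ d₃₂) (on-self d₂₃) ∷ separating {S} i₂ (d2-off d₁₂ d₃₂) (on-nbr a₂) ∷ [])
    ∷ (separating {S} i₁ (d2-off d₂₁ d₃₁) (on-nbr a₁) ∷ []) ∷ [] ∷ [])
    , refl
    where
    open Biclique K
    i₁ = ys-in (here refl)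
    i₂ = ys-in (there (here refl))
    i₃ = ys-in (there (there (here refl)))
    a₁ : x₁ ~ y₁
    a₁ = joined (here refl) (here refl)
    a₂ : x₁ ~ y₂
    a₂ = joined (here refl) (there (here refl))
    a₃ : x₁ ~ y₃
    a₃ = joined (here refl) (there (there (here refl)))
    dx : d x₁ x₂ ≡ 2
    dx = common-nbr⇒d2 (joined (here refl) (here refl)) (joined (there (here refl)) (here refl)) x₁≢x₂
    dy : ∀ {y y′} → x₁ ~ y → x₁ ~ y′ → y ≢ y′ → d y y′ ≡ 2
    dy p q = common-nbr⇒d2 (~-sym p) (~-sym q)
    d₁₂ = dy a₁ a₂ y₁≢y₂
    d₁₃ = dy a₁ a₃ y₁≢y₃
    d₂₃ = dy a₂ a₃ y₂≢y₃
    d₂₁ = dy a₂ a₁ (y₁≢y₂ ∘ sym)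
    d₃₁ = dy a₃ a₁ (y₁≢y₃ ∘ sym)
    d₃₂ = dy a₃ a₂ (y₂≢y₃ ∘ sym)

  -- Splitting at a cut vertex

  record Split (S S₁ S₂ : Subset) (v : V) : Set where
    field
      sub₁ : S₁ ⊆ S
      sub₂ : S₂ ⊆ S
      v∈₁ : v ∈ₛ S₁
      v∈₂ : v ∈ₛ S₂
      covers : ∀ {x} → x ∈ₛ S → x ∈ₛ S₁ ⊎ x ∈ₛ S₂
      meet : ∀ {x} → x ∈ₛ S₁ → x ∈ₛ S₂ → x ≡ v
      no-edge : ∀ {x y} → x ∈ₛ S₁ → x ≢ v → y ∈ₛ S₂ → y ≢ v → ¬ (x ~ y)
      more₁ : ∃ λ x → x ∈ₛ S₁ × x ≢ v
      more₂ : ∃ λ x → x ∈ₛ S₂ × x ≢ v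

  split-sym : ∀ {S S₁ S₂ v} → Split S S₁ S₂ v → Split S S₂ S₁ v
  split-sym P = record
    { sub₁ = sub₂ ; sub₂ = sub₁ ; v∈₁ = v∈₂ ; v∈₂ = v∈₁ ; covers = [ inj₂ , inj₁ ]′ ∘ covers
    ; meet = λ p q → meet q p ; no-edge = λ p n q m e → no-edge q m p n (~-sym e) ; more₁ = more₂ ; more₂ = more₁ }
    where open Split P

  cut-split : ∀ {S} (C : CutVertex S) → Split S (S ∩ λ x → ¬? (x ∈ₛ? CutVertex.side C))
    (S ∩ λ x → (x ∈ₛ? CutVertex.side C) ⊎-dec (x ≟ᶠ CutVertex.v C)) (CutVertex.v C)
  cut-split {S} C = record
    { sub₁ = proj₁ ∘ ∈∩⁻ P? ; sub₂ = proj₁ ∘ ∈∩⁻ Q? ; v∈₁ = ∈∩⁺ P? v∈ v∉ ; v∈₂ = ∈∩⁺ Q? v∈ (inj₂ refl)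
    ; covers = λ {x} x∈ → cov x∈ (x ∈ₛ? side)
    ; meet = λ p q → [ (λ x∈T → ⊥-elim (proj₂ (∈∩⁻ P? p) x∈T)) , (λ e → e) ]′ (proj₂ (∈∩⁻ Q? q))
    ; no-edge = λ p x≢v q y≢v e → [ (λ y∈T → sep y∈T (proj₁ (∈∩⁻ P? p)) (proj₂ (∈∩⁻ P? p)) x≢v (~-sym e)) , y≢v ]′ (proj₂ (∈∩⁻ Q? q))
    ; more₁ = s , ∈∩⁺ P? s∈ s∉ , s≢v
    ; more₂ = t , ∈∩⁺ Q? (side⊆ t∈) (inj₁ t∈) , λ { refl → v∉ t∈ } }
    where
    open CutVertex C
    P? : ∀ x → Dec (¬ (x ∈ₛ side))
    P? x = ¬? (x ∈ₛ? side)
    Q? : ∀ x → Dec (x ∈ₛ side ⊎ x ≡ v)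
    Q? x = (x ∈ₛ? side) ⊎-dec (x ≟ᶠ v)
    cov : ∀ {x} → x ∈ₛ S → Dec (x ∈ₛ side) → x ∈ₛ S ∩ P? ⊎ x ∈ₛ S ∩ Q?
    cov x∈ (yes p) = inj₂ (∈∩⁺ Q? x∈ (inj₁ p))
    cov x∈ (no ¬p) = inj₁ (∈∩⁺ P? x∈ ¬p)

  module Part {S S₁ S₂ : Subset} {v : V} (iso : Isometric S) (P : Split S S₁ S₂ v) where
    open Split P

    inside₁ : ∀ {x} → x ∈ₛ S → ¬ (x ∈ₛ S₂ × x ≢ v) → x ∈ₛ S₁
    inside₁ {x} x∈ n with covers x∈ | x ≟ᶠ v
    ... | inj₁ p | _ = p
    ... | inj₂ _ | yes refl = v∈₁
    ... | inj₂ q | no x≢v = ⊥-elim (n (q , x≢v))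

    closed₁ : ∀ {x y} → x ∈ₛ S₁ → x ≢ v → y ∈ₛ S → y ~ x → y ∈ₛ S₁
    closed₁ x∈ x≢v y∈ yx = inside₁ y∈ λ (q , y≢v) → no-edge x∈ x≢v q y≢v (~-sym yx)

    -- A geodesic from x to y cannot leave S₁ before it reaches v.
    through : ∀ {x y} → x ∈ₛ S₁ → y ∈ₛ S₂ → d x y ≡ d x v + d v y
    through {x} {y} x∈ y∈ = ≤-antisym (d-triangle x v y) (go (d y x) refl x∈)
      where
      go : ∀ k {x} → d y x ≡ k → x ∈ₛ S₁ → d x v + d v y ≤ d x y
      go k {x} e x∈ with x ≟ᶠ v
      ... | yes refl = ≤-reflexive (cong (_+ d v y) (d-refl v))
      ... | no x≢v with iso (sub₁ x∈) (sub₂ y∈) (λ { refl → x≢v (meet x∈ y∈) })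
      go zero e x∈ | no x≢v | z , z∈ , xz , s with trans (sym e) s
      ... | ()
      go (suc k) {x} e x∈ | no x≢v | z , z∈ , xz , s =
        ≤-trans (+-monoˡ-≤ (d v y) (d-triangle x z v)) (≤-trans (≤-reflexive (cong (λ m → m + d z v + d v y) xz))
          (≤-trans (s≤s (go k (suc-injective (trans (sym s) e)) (closed₁ x∈ x≢v z∈ (~-sym xz))))
            (≤-reflexive (trans (cong suc (d-sym z y)) (trans (sym s) (d-sym y x))))))

    -- Only a step from v could lead out of S₁, and by `through` it would lead away from y.
    iso₁ : Isometric S₁
    iso₁ {x} {y} x∈ y∈ x≢y with iso (sub₁ x∈) (sub₁ y∈) x≢y
    ... | z , z∈ , xz , s with x ≟ᶠ v
    ...   | no x≢v = z , closed₁ x∈ x≢v z∈ (~-sym xz) , xz , s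
    ...   | yes refl with covers z∈
    ...     | inj₁ p = z , p , xz , s
    ...     | inj₂ q = ⊥-elim (lem s (trans (through y∈ q) (+-comm (d y v) (d v z))))
      where
      lem : ∀ {p q r} → p ≡ suc q → q ≡ r + p → ⊥
      lem {p} {q} {r} refl e = n≮n q (≤-trans (m≤n+m (suc q) r) (≤-reflexive (sym e)))

    -- Distances to S₂ pass through v, so all of S₂ is on the same side of uw as v and none of its
    -- edges crosses.
    bridge₁ : ∀ {u w} → Bridge S₁ u w → Bridge S u w
    bridge₁ {u} {w} B = mkBridge (sub₁ (Bridge.u∈ B)) (sub₁ (Bridge.v∈ B)) (Bridge.edge B) only
      where
      like-v : ∀ {x a b} → a ∈ₛ S₁ → b ∈ₛ S₁ → x ∈ₛ S₂ → Nearer x a b → Nearer v a b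
      like-v {x} {a} {b} a∈ b∈ x∈ n = +-cancelʳ-≡ (d v x) (d v b) (suc (d v a))
        (trans (cong (_+ d v x) (d-sym v b)) (trans (sym (through b∈ x∈)) (trans (d-sym b x) (trans n (cong suc
          (trans (d-sym x a) (trans (through a∈ x∈) (cong (_+ d v x) (d-sym a v)))))))))
      both : ∀ {x y} → x ∈ₛ S₂ → y ∈ₛ S₂ → Nearer x u w → Nearer y w u → ⊥
      both x∈ y∈ nx ny = nearer-asym (like-v (Bridge.u∈ B) (Bridge.v∈ B) x∈ nx) (like-v (Bridge.v∈ B) (Bridge.u∈ B) y∈ ny)
      only : ∀ {x y} → x ∈ₛ S → y ∈ₛ S → x ~ y → Nearer x u w → Nearer y w u → x ≡ u × y ≡ w
      only {x} {y} x∈ y∈ xy nx ny with covers x∈ | covers y∈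
      ... | inj₁ p | inj₁ q = Bridge.only B p q xy nx ny
      ... | inj₂ p | inj₂ q = ⊥-elim (both p q nx ny)
      ... | inj₁ p | inj₂ q with x ≟ᶠ v | y ≟ᶠ v
      ...   | yes refl | _ = ⊥-elim (both v∈₂ q nx ny)
      ...   | _ | yes refl = Bridge.only B p v∈₁ xy nx ny
      ...   | no x≢v | no y≢v = ⊥-elim (no-edge p x≢v q y≢v xy)
      only {x} {y} x∈ y∈ xy nx ny | inj₂ p | inj₁ q with x ≟ᶠ v | y ≟ᶠ v
      ...   | yes refl | _ = Bridge.only B v∈₁ q xy nx ny
      ...   | _ | yes refl = ⊥-elim (both p v∈₂ nx ny)
      ...   | no x≢v | no y≢v = ⊥-elim (no-edge q y≢v p x≢v (~-sym xy))

    size₁ : suc (size S₁) ≤ size S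
    size₁ with more₂
    ... | x , x∈ , x≢v = size≥ {xs = x ∷ members S₁}
      (All.tabulate (λ { y∈ refl → x≢v (meet (members⁻ y∈) x∈) }) ∷ members-unique S₁)
      (λ { (here refl) → sub₂ x∈ ; (there p) → sub₁ (members⁻ p) })

    -- S₂ hangs from S₁ at v, so a line of S₁ that meets S₂ ∖ v contains S₂.
    full : ∀ {a b c e} → a ∈ₛ S₁ → b ∈ₛ S₁ → d a b ≡ 2 → c ∈ₛ S₂ → e ∈ₛ S₂ → d c e ≡ 2 → SameLine S a b c e →
      ∀ {z} → z ∈ₛ S₂ → ¬ NotOnLine c e z
    full {a} {b} {c} {e} a∈ b∈ dab c∈ e∈ dce L {z} z∈ o = cases (c ≟ᶠ v) (e ≟ᶠ v)
      where
      equidistant : d a v ≡ d b v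
      equidistant = +-cancelʳ-≡ (d v z) (d a v) (d b v)
        (trans (sym (through a∈ z∈)) (trans (proj₁ (proj₂ (L (sub₂ z∈)) o)) (through b∈ z∈)))
      off-part : ∀ {x} → x ∈ₛ S₂ → x ≢ v → NotOnLine a b x
      off-part {x} x∈ x≢v = trans (through a∈ x∈) (trans (cong (_+ d v x) equidistant) (sym (through b∈ x∈))) , not-adjacent
        where
        not-adjacent : ¬ (a ~ x)
        not-adjacent ax with a ≟ᶠ v
        ... | yes refl = d2⇒≢ dab (sym (d-zero (trans (sym equidistant) (d-refl v))))
        ... | no a≢v = no-edge a∈ a≢v x∈ x≢v ax
      cases : Dec (c ≡ v) → Dec (e ≡ v) → ⊥
      cases (no c≢v) _ = on-self dce (proj₁ (L (sub₂ c∈)) (off-part c∈ c≢v))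
      cases _ (no e≢v) = on-self' dce (proj₁ (L (sub₂ e∈)) (off-part e∈ e≢v))
      cases (yes refl) (yes refl) = d2⇒≢ dce refl

  -- The induction

  HasPair : Subset → Set
  HasPair S = ∃ λ x → ∃ λ y → x ∈ₛ S × y ∈ₛ S × d x y ≡ 2

  LinePair : Subset → V × V → Set
  LinePair S (a , b) = a ∈ₛ S × b ∈ₛ S × d a b ≡ 2

  DistinctLines : Subset → V × V → V × V → Set
  DistinctLines S (a , b) (c , e) = ¬ SameLine S a b c e

  lines : List (V × V) → List Token
  lines = map λ (a , b) → lineToken a b

  -- The shape of most deletions: the tokens of the reduct survive, and the new lines `ns` make up
  -- for the deleted vertices and for any token given up.
  good-from : ∀ {S′ S} → S′ ⊆ S → (T : Tokens S′) →
    (∀ {u v} → bridgeToken u v ∈ Tokens.list T → Bridge S′ u v → Bridge S u v) →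
    (ns : List (V × V)) → All (LinePair S) ns → AllPairs (DistinctLines S) ns → All (New S′ S) ns →
    size S ≤ length ns + Tokens.count T → Good S
  good-from {S′} {S} sub T br ns val dis new le =
    append T₁ T₂ D , ≤-trans le (≤-reflexive (trans (cong (_+ Tokens.count T) (sym (length-map _ ns))) (sym (append-count T₁ T₂ D))))
    where
    T₁ : Tokens S
    T₁ = tokens (lines ns) (All-map⁺ val) (AllPairs-map⁺ dis)
    T₂ : Tokens S
    T₂ = lift sub T br
    fresh : ∀ {a b} → New S′ S (a , b) → ∀ {t} → Valid S′ t → Distinct S (lineToken a b) t
    fresh n {lineToken c e} (c∈ , e∈ , dce) = n c∈ e∈ dce
    fresh n {bridgeToken u v} _ = tt
    D : All (λ s → All (Distinct S s) (Tokens.list T₂)) (lines ns)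
    D = All-map⁺ (All.map (λ {p} (n : New S′ S p) → All.tabulate λ {t} t∈ → fresh n {t} (All.lookup (Tokens.valid T) t∈)) new)

  -- S is a minimal counterexample.
  module Step {S : Subset} (iso : Isometric S) (pair : HasPair S) (¬e4 : ¬ IsC₄ S) (¬e5 : ¬ IsK₂₃ S)
    (IH : ∀ {S′} → suc (size S′) ≤ size S → Isometric S′ → HasPair S′ → ¬ IsC₄ S′ → ¬ IsK₂₃ S′ → ¬ ¬ Good S′)
    (bad : ¬ Good S) where

    -- Delete w′ and gain the line of the twins. As w″ is adjacent to every neighbour of w, this
    -- line is new, and with a or a′ each edge at w lies on a 4-cycle of the reduct and is no bridge
    -- there.
    twins-⊥ : ∀ {w w′ w″ a a′} → w ∈ₛ S → w′ ∈ₛ S → w″ ∈ₛ S → a ∈ₛ S → a′ ∈ₛ S →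
      w ≢ w′ → w″ ≢ w → w″ ≢ w′ → Dom S w w′ → Dom S w′ w → Dom S w w″ → a ≢ a′ → a ~ w → a′ ~ w → ⊥
    twins-⊥ {w} {w′} {w″} {a} {a′} w∈ w′∈ w″∈ a∈ a′∈ w≢w′ w″≢w w″≢w′ dom dom′ dom″ a≢a′ aw a′w =
      IH (size-∖< w′∈) (isometric-∖ iso w∈ w′∈ w≢w′ dom′) (w , w″ , ∖⁺ w∈ w≢w′ , ∖⁺ w″∈ w″≢w′ , dww″) exc4 exc5
        λ (T , le) → bad (good-from ∖-⊆ T (λ _ → bridges) ((w , w′) ∷ []) ((w∈ , w′∈ , dww′) ∷ []) ([] ∷ [])
          (new-twin ∷ []) (≤-trans size-∖≤ (s≤s le)))
      where
      aw′ = dom a∈ aw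
      dww′ : d w w′ ≡ 2
      dww′ = common-nbr⇒d2 (~-sym aw) (~-sym aw′) w≢w′
      dww″ : d w w″ ≡ 2
      dww″ = common-nbr⇒d2 (~-sym aw) (~-sym (dom″ a∈ aw)) (w″≢w ∘ sym)
      open Twins iso w∈ w′∈ dom dom′ dww′
      no-bridge : ∀ {v} → Bridge (S ∖ w′) w v → v ~ w′ → ⊥
      no-bridge {v} B vw′ = cases (a ≟ᶠ v)
        where
        cycle : ∀ {q} → q ∈ₛ S → q ~ w → q ≢ v → ⊥
        cycle q∈ qw q≢v = bridge-no-4-cycle B (∖⁺ w″∈ w″≢w′) (∖⁺ q∈ (~⇒≢ (dom q∈ qw)))
          (dom″ (∖-⊆ (Bridge.v∈ B)) (~-sym (Bridge.edge B))) (~-sym (dom″ q∈ qw)) qw w″≢w q≢v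
        cases : Dec (a ≡ v) → ⊥
        cases (yes refl) = cycle a′∈ a′w (a≢a′ ∘ sym)
        cases (no a≢v) = cycle a∈ aw a≢v
      bridges : ∀ {u v} → Bridge (S ∖ w′) u v → Bridge S u v
      bridges B = bridge-∖-dominated iso w∈ w′∈ w≢w′ dom′ B
        (λ { (refl , vw′) → no-bridge B vw′ }) (λ { (refl , uw′) → no-bridge (bridge-swap B) uw′ })
      new-twin : New (S ∖ w′) S (w , w′)
      new-twin c∈ e∈ dce = twin-line-unique (∖-⊆ c∈) (∖-⊆ e∈) dce
        (λ { (inj₁ (_ , w′≡e)) → proj₂ (∖⁻ e∈) (sym w′≡e) ; (inj₂ (_ , w′≡c)) → proj₂ (∖⁻ c∈) (sym w′≡c) })
        (λ wc _ → w″ , w″∈ , w″≢w , w″≢w′ , inj₁ (~-sym (dom″ (∖-⊆ c∈) (~-sym wc))))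

      with-w′ : ∀ {xs ys} → Biclique (S ∖ w′) xs ys → w ∈ xs → Biclique S (w′ ∷ xs) ys
      with-w′ {xs} {ys} K w∈xs = record
        { xs-unique = All.tabulate (λ x∈ w′≡x → proj₂ (∖⁻ (xs-in x∈)) (sym w′≡x)) ∷ xs-unique ; ys-unique = ys-unique
        ; xs-in = λ { (here refl) → w′∈ ; (there p) → ∖-⊆ (xs-in p) } ; ys-in = ∖-⊆ ∘ ys-in
        ; joined = λ { (here refl) y∈ → ~-sym (dom (∖-⊆ (ys-in y∈)) (~-sym (joined w∈xs y∈))) ; (there p) y∈ → joined p y∈ }
        ; cover = λ {s} → cov s }
        where
        open Biclique K
        cov : ∀ s → s ∈ₛ S → s ∈ w′ ∷ xs ⊎ s ∈ ys
        cov s s∈ with s ≟ᶠ w′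
        ... | yes e = inj₁ (here e)
        ... | no s≢w′ with cover (∖⁺ s∈ s≢w′)
        ...   | inj₁ p = inj₁ (there p)
        ...   | inj₂ q = inj₂ q

      exc4 : ¬ IsC₄ (S ∖ w′)
      exc4 (x₁ , x₂ , y₁ , y₂ , K) with Biclique.cover K (∖⁺ w∈ w≢w′)
      ... | inj₁ p = ¬e5 (_ , _ , _ , _ , _ , flip (with-w′ K p))
      ... | inj₂ p = ¬e5 (_ , _ , _ , _ , _ , flip (with-w′ (flip K) p))

      exc5 : ¬ IsK₂₃ (S ∖ w′)
      exc5 (x₁ , x₂ , y₁ , y₂ , y₃ , K) = third
        where
        open Biclique K
        -- K₂,₃ provides only four tokens and S has six vertices, so a second new line is needed:
        -- that of w′ and another vertex t in the class of w.
        finish : ∀ {t} → t ∈ₛ S ∖ w′ → t ≢ w → d w t ≡ 2 → ⊥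
        finish {t} t∈ t≢w dwt with K₂₃-tokens K | ∖⁻ t∈
        ... | T , T≡4 | t∈S , t≢w′ = bad (good-from ∖-⊆ T (λ _ → bridges) ((w , w′) ∷ (w′ , t) ∷ [])
            ((w∈ , w′∈ , dww′) ∷ (w′∈ , t∈S , dw′t) ∷ [])
            ((separating {S} t∈S (d2-off dwt dw′t) (on-self' dw′t) ∷ []) ∷ [] ∷ [])
            (new-twin ∷ (λ c∈ e∈ dce → split-twins t∈S dw′t t≢w (∖-⊆ c∈) (∖-⊆ e∈) dce (proj₂ (∖⁻ c∈)) (proj₂ (∖⁻ e∈))) ∷ [])
            (≤-trans size-∖≤ (s≤s (≤-trans (size≤ {xs = x₁ ∷ x₂ ∷ y₁ ∷ y₂ ∷ y₃ ∷ []} (λ s∈ → flat (cover s∈)))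
              (≤-reflexive (cong suc (sym T≡4)))))))
          where
          dw′t : d w′ t ≡ 2
          dw′t = trans (sym (twin-dist iso w∈ w′∈ dom dom′ t∈S t≢w t≢w′)) dwt
          flat : ∀ {s} → s ∈ x₁ ∷ x₂ ∷ [] ⊎ s ∈ y₁ ∷ y₂ ∷ y₃ ∷ [] → s ∈ x₁ ∷ x₂ ∷ y₁ ∷ y₂ ∷ y₃ ∷ []
          flat (inj₁ (here e)) = here e
          flat (inj₁ (there (here e))) = there (here e)
          flat (inj₂ p) = there (there p)
        third : ⊥
        third with cover (∖⁺ w∈ w≢w′) | xs-unique | ys-unique
        ... | inj₁ (here refl) | (n ∷ _) ∷ _ | _ = finish (xs-in (there (here refl))) (n ∘ sym)
                (common-nbr⇒d2 (joined (here refl) (here refl)) (joined (there (here refl)) (here refl)) n)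
        ... | inj₁ (there (here refl)) | (n ∷ _) ∷ _ | _ = finish (xs-in (here refl)) n
                (common-nbr⇒d2 (joined (there (here refl)) (here refl)) (joined (here refl) (here refl)) (n ∘ sym))
        ... | inj₂ (here refl) | _ | (n ∷ _) ∷ _ = finish (ys-in (there (here refl))) (n ∘ sym)
                (common-nbr⇒d2 (~-sym (joined (here refl) (here refl))) (~-sym (joined (here refl) (there (here refl)))) n)
        ... | inj₂ (there p) | _ | n ∷ _ = finish (ys-in (here refl)) (All.lookup n p)
                (common-nbr⇒d2 (~-sym (joined (here refl) (there p))) (~-sym (joined (here refl) (here refl))) (All.lookup n p ∘ sym))

    -- Edges leave S′ only at v, so vertices of one class other than v have the opposite class as
    -- their whole neighbourhood in S.
    hanging-twins-⊥ : ∀ {S′ xs ys v x x′ w w′ w″} → S′ ⊆ S → Biclique S′ xs ys →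
      (∀ {s t} → s ∈ₛ S′ → s ≢ v → t ∈ₛ S → t ~ s → t ∈ₛ S′) →
      x ∈ xs → x′ ∈ xs → x ≢ x′ → w ∈ ys → w′ ∈ ys → w″ ∈ ys → w ≢ w′ → w″ ≢ w → w″ ≢ w′ → w ≢ v → w′ ≢ v → ⊥
    hanging-twins-⊥ {S′} {xs} {ys} {v} sub K closed x∈ x′∈ x≢x′ w∈ w′∈ w″∈ w≢w′ w″≢w w″≢w′ w≢v w′≢v =
      twins-⊥ (sub (ys-in w∈)) (sub (ys-in w′∈)) (sub (ys-in w″∈)) (sub (xs-in x∈)) (sub (xs-in x′∈))
        w≢w′ w″≢w w″≢w′ (dom w∈ w′∈ w≢v) (dom w′∈ w∈ w′≢v) (dom w∈ w″∈ w≢v) x≢x′ (joined x∈ w∈) (joined x′∈ w∈)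
      where
      open Biclique K
      dom : ∀ {w u} → w ∈ ys → u ∈ ys → w ≢ v → Dom S w u
      dom w∈ u∈ w≢v t∈ tw with cover (closed (ys-in w∈) w≢v t∈ tw)
      ... | inj₁ p = joined p u∈
      ... | inj₂ q = ⊥-elim (nbrs≁ (~-sym (joined x∈ q)) (~-sym (joined x∈ w∈)) tw)

    -- At least two vertices of the class of three differ from v; the remaining one serves as `w″`.
    hanging-K₂₃-⊥ : ∀ {S′ v} → S′ ⊆ S → IsK₂₃ S′ → v ∈ₛ S′ →
      (∀ {s t} → s ∈ₛ S′ → s ≢ v → t ∈ₛ S → t ~ s → t ∈ₛ S′) → ⊥
    hanging-K₂₃-⊥ {S′} {v} sub (x₁ , x₂ , y₁ , y₂ , y₃ , K) v∈ closed with Biclique.cover K v∈ | Biclique.xs-unique K | Biclique.ys-unique K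
    ... | inj₁ p | (x≢ ∷ []) ∷ _ | (y₁₂ ∷ y₁₃ ∷ []) ∷ (y₂₃ ∷ []) ∷ _ =
      hanging-twins-⊥ sub K closed (here refl) (there (here refl)) x≢ (here refl) (there (here refl)) (there (there (here refl)))
        y₁₂ (y₁₃ ∘ sym) (y₂₃ ∘ sym) (λ { refl → ~-irrefl (Biclique.joined K p (here refl)) })
        (λ { refl → ~-irrefl (Biclique.joined K p (there (here refl))) })
    ... | inj₂ (here refl) | (x≢ ∷ []) ∷ _ | (y₁₂ ∷ y₁₃ ∷ []) ∷ (y₂₃ ∷ []) ∷ _ =
      hanging-twins-⊥ sub K closed (here refl) (there (here refl)) x≢ (there (here refl)) (there (there (here refl))) (here refl)
        y₂₃ y₁₂ y₁₃ (y₁₂ ∘ sym) (y₁₃ ∘ sym)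
    ... | inj₂ (there (here refl)) | (x≢ ∷ []) ∷ _ | (y₁₂ ∷ y₁₃ ∷ []) ∷ (y₂₃ ∷ []) ∷ _ =
      hanging-twins-⊥ sub K closed (here refl) (there (here refl)) x≢ (here refl) (there (there (here refl))) (there (here refl))
        y₁₃ (y₁₂ ∘ sym) y₂₃ y₁₂ (y₂₃ ∘ sym)
    ... | inj₂ (there (there (here refl))) | (x≢ ∷ []) ∷ _ | (y₁₂ ∷ y₁₃ ∷ []) ∷ (y₂₃ ∷ []) ∷ _ =
      hanging-twins-⊥ sub K closed (here refl) (there (here refl)) x≢ (here refl) (there (here refl)) (there (there (here refl)))
        y₁₂ (y₁₃ ∘ sym) (y₂₃ ∘ sym) y₁₃ y₂₃

    -- Leaves

    module _ {b w} (b∈ : b ∈ₛ S) (w∈ : w ∈ₛ S) (bw : b ~ w) (leaf : ∀ {t} → t ∈ₛ S → t ~ b → t ≡ w) where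

      open Leaf iso b∈ w∈ bw leaf

      other-nbr : ∃ λ a → a ∈ₛ S × a ~ w × a ≢ b
      other-nbr = from pair
        where
        toward : ∀ {t} → t ∈ₛ S → t ≢ b → t ≢ w → ∃ λ a → a ∈ₛ S × a ~ w × a ≢ b
        toward {t} t∈ t≢b t≢w with iso w∈ t∈ (t≢w ∘ sym)
        ... | z , z∈ , wz , s with z ≟ᶠ b
        ...   | no z≢b = z , z∈ , ~-sym wz , z≢b
        ...   | yes refl = ⊥-elim (nearer-asym (leaf-dist t∈ t≢b) s)
        from : HasPair S → ∃ λ a → a ∈ₛ S × a ~ w × a ≢ b
        from (p , q , p∈ , q∈ , dpq) with p ≟ᶠ b | q ≟ᶠ b | p ≟ᶠ w | q ≟ᶠ w
        ... | no p≢b | _ | no p≢w | _ = toward p∈ p≢b p≢w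
        ... | _ | no q≢b | _ | no q≢w = toward q∈ q≢b q≢w
        ... | yes refl | yes refl | _ | _ = ⊥-elim (d2⇒≢ dpq refl)
        ... | yes refl | no _ | _ | yes refl = ⊥-elim (d2⇒≁ dpq bw)
        ... | no _ | yes refl | yes refl | _ = ⊥-elim (d2⇒≁ dpq (~-sym bw))
        ... | no _ | no _ | yes refl | yes refl = ⊥-elim (d2⇒≢ dpq refl)

      -- S is a C₄ with a pendant edge. The first line misses b, those of b with y₁ and y₂ miss y₂
      -- and y₁ respectively, and that of w and x₂ contains b, y₁ and y₂; with the bridge this makes
      -- five.
      leaf-no-exc4′ : ∀ {x₂ y₁ y₂} → ¬ Biclique (S ∖ b) (w ∷ x₂ ∷ []) (y₁ ∷ y₂ ∷ [])
      leaf-no-exc4′ {x₂} {y₁} {y₂} K with Biclique.xs-unique K | Biclique.ys-unique K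
      ... | (w≢x₂ ∷ []) ∷ _ | (y₁≢y₂ ∷ []) ∷ _ = bad (tokens
        (lineToken y₁ y₂ ∷ lineToken b y₁ ∷ lineToken b y₂ ∷ lineToken w x₂ ∷ bridgeToken b w ∷ [])
        ((y₁∈ , y₂∈ , dyy) ∷ (b∈ , y₁∈ , dby₁) ∷ (b∈ , y₂∈ , dby₂) ∷ (w∈ , ∖-⊆ (xs-in (there (here refl))) , dwx) ∷ leaf-bridge ∷ [])
        ( (separating {S} b∈ yy-off-b (on-self dby₁) ∷ separating {S} b∈ yy-off-b (on-self dby₂)
            ∷ separating {S} b∈ yy-off-b (on-nbr (~-sym bw)) ∷ tt ∷ [])
        ∷ (separating {S} y₂∈ (d2-off dby₂ dyy) (on-self' dby₂) ∷ separating {S} y₂∈ (d2-off dby₂ dyy) (on-nbr wy₂) ∷ tt ∷ [])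
        ∷ (separating {S} y₁∈ (d2-off dby₁ (trans (d-sym y₂ y₁) dyy)) (on-nbr wy₁) ∷ tt ∷ [])
        ∷ (tt ∷ []) ∷ [] ∷ [])
        , ≤-trans size-∖≤ (s≤s (size≤ {xs = w ∷ x₂ ∷ y₁ ∷ y₂ ∷ []} (λ s∈ → flat (cover s∈)))))
        where
        open Biclique K
        y₁∈ = ∖-⊆ (ys-in (here refl))
        y₂∈ = ∖-⊆ (ys-in (there (here refl)))
        wy₁ : w ~ y₁
        wy₁ = joined (here refl) (here refl)
        wy₂ : w ~ y₂
        wy₂ = joined (here refl) (there (here refl))
        dyy : d y₁ y₂ ≡ 2
        dyy = common-nbr⇒d2 (~-sym wy₁) (~-sym wy₂) y₁≢y₂
        dby₁ : d b y₁ ≡ 2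
        dby₁ = common-nbr⇒d2 bw (~-sym wy₁) (proj₂ (∖⁻ (ys-in (here refl))) ∘ sym)
        dby₂ : d b y₂ ≡ 2
        dby₂ = common-nbr⇒d2 bw (~-sym wy₂) (proj₂ (∖⁻ (ys-in (there (here refl)))) ∘ sym)
        dwx : d w x₂ ≡ 2
        dwx = common-nbr⇒d2 wy₁ (joined (there (here refl)) (here refl)) w≢x₂
        yy-off-b : NotOnLine y₁ y₂ b
        yy-off-b = d2-off (trans (d-sym y₁ b) dby₁) (trans (d-sym y₂ b) dby₂)
        flat : ∀ {s} → s ∈ w ∷ x₂ ∷ [] ⊎ s ∈ y₁ ∷ y₂ ∷ [] → s ∈ w ∷ x₂ ∷ y₁ ∷ y₂ ∷ []
        flat (inj₁ (here e)) = here e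
        flat (inj₁ (there (here e))) = there (here e)
        flat (inj₂ p) = there (there p)

      leaf-⊥ : ⊥
      leaf-⊥ = no-pair λ p → IH (size-∖< b∈) iso′ p exc4
          (λ e5 → hanging-K₂₃-⊥ ∖-⊆ e5 w∈′ closed)
          λ (tokens ts val dis , le) → bad (tokens (bridgeToken b w ∷ ts)
              (leaf-bridge ∷ Tokens.valid (T′ ts val dis))
              (All.tabulate (λ {t} t∈ → fresh t (All.lookup val t∈)) ∷ Tokens.distinct (T′ ts val dis))
            , ≤-trans size-∖≤ (s≤s le))
        where
        a = proj₁ other-nbr
        a∈ : a ∈ₛ S
        a∈ = proj₁ (proj₂ other-nbr)
        aw : a ~ w
        aw = proj₁ (proj₂ (proj₂ other-nbr))
        a≢b : a ≢ b
        a≢b = proj₂ (proj₂ (proj₂ other-nbr))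
        w∈′ : w ∈ₛ S ∖ b
        w∈′ = ∖⁺ w∈ (~⇒≢ bw ∘ sym)
        iso′ : Isometric (S ∖ b)
        iso′ = isometric-∖ iso a∈ b∈ a≢b λ t∈ tb → subst (_~ a) (sym (leaf t∈ tb)) (~-sym aw)
        closed : ∀ {s t} → s ∈ₛ S ∖ b → s ≢ w → t ∈ₛ S → t ~ s → t ∈ₛ S ∖ b
        closed s∈ s≢w t∈ ts = ∖⁺ t∈ λ { refl → s≢w (leaf (∖-⊆ s∈) (~-sym ts)) }
        exc4 : ¬ IsC₄ (S ∖ b)
        exc4 (x₁ , x₂ , y₁ , y₂ , K) with Biclique.cover K w∈′
        ... | inj₁ (here refl) = leaf-no-exc4′ K
        ... | inj₁ (there (here refl)) = leaf-no-exc4′ (swap-xs K)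
        ... | inj₂ (here refl) = leaf-no-exc4′ (flip K)
        ... | inj₂ (there (here refl)) = leaf-no-exc4′ (swap-xs (flip K))
        T′ : ∀ ts → All (Valid (S ∖ b)) ts → AllPairs (Distinct (S ∖ b)) ts → Tokens S
        T′ ts val dis = lift ∖-⊆ (tokens ts val dis) (λ _ → bridge-∖-leaf)
        fresh : ∀ t → Valid (S ∖ b) t → Distinct S (bridgeToken b w) t
        fresh (lineToken _ _) _ = tt
        fresh (bridgeToken u v) B (inj₁ (b≡u , _)) = proj₂ (∖⁻ (Bridge.u∈ B)) (sym b≡u)
        fresh (bridgeToken u v) B (inj₂ (b≡v , _)) = proj₂ (∖⁻ (Bridge.v∈ B)) (sym b≡v)
        -- Without a pair at distance 2 the reduct is a single edge, and S is the path b, w, a with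
        -- one line and two bridges.
        no-pair : ¬ ¬ HasPair (S ∖ b)
        no-pair ¬pair = bad (tokens (lineToken b a ∷ bridgeToken b w ∷ bridgeToken a w ∷ [])
            ((b∈ , a∈ , common-nbr⇒d2 bw aw (a≢b ∘ sym)) ∷ leaf-bridge ∷ bridge-∖-leaf (Leaf.leaf-bridge iso′ a∈′ w∈′ aw a-leaf) ∷ [])
            ((tt ∷ tt ∷ []) ∷ ((λ { (inj₁ (e , _)) → a≢b (sym e) ; (inj₂ (e , _)) → ~⇒≢ bw e }) ∷ []) ∷ [] ∷ [])
          , ≤-trans size-∖≤ (s≤s (size≤ {xs = w ∷ a ∷ []} λ {t} → cov t)))
          where
          a∈′ : a ∈ₛ S ∖ b
          a∈′ = ∖⁺ a∈ a≢b
          a-leaf : ∀ {t} → t ∈ₛ S ∖ b → t ~ a → t ≡ w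
          a-leaf {t} t∈ ta with t ≟ᶠ w
          ... | yes e = e
          ... | no t≢w = ⊥-elim (¬pair (t , w , t∈ , w∈′ , common-nbr⇒d2 ta (~-sym aw) t≢w))
          cov : ∀ t → t ∈ₛ S ∖ b → t ∈ w ∷ a ∷ []
          cov t t∈ with t ≟ᶠ w | t ≟ᶠ a
          ... | yes e | _ = here e
          ... | _ | yes e = there (here e)
          ... | no t≢w | no t≢a with iso′ w∈′ t∈ (t≢w ∘ sym)
          ...   | z , z∈ , wz , s with z ≟ᶠ t
          ...     | yes refl = ⊥-elim (¬pair (t , a , t∈ , a∈′ , common-nbr⇒d2 (~-sym wz) aw t≢a))
          ...     | no z≢t with iso′ z∈ t∈ z≢t
          ...       | z₂ , z₂∈ , zz₂ , s₂ = ⊥-elim (¬pair (w , z₂ , w∈′ , z₂∈ , common-nbr⇒d2 wz (~-sym zz₂)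
                        λ { refl → nearer-asym s s₂ }))

    -- No leaf is left, so x has a second neighbour. The negative form delivers it as a variable of
    -- a continuation that ends in `⊥`.
    another-nbr : ∀ {x w} → x ∈ₛ S → w ∈ₛ S → w ~ x → ¬ (∀ {t} → t ∈ₛ S → t ~ x → t ≢ w → ⊥)
    another-nbr {x} {w} x∈ w∈ wx none = leaf-⊥ x∈ w∈ (~-sym wx) only
      where
      only : ∀ {t} → t ∈ₛ S → t ~ x → t ≡ w
      only {t} t∈ tx with t ≟ᶠ w
      ... | yes e = e
      ... | no t≢w = ⊥-elim (none t∈ tx t≢w)

    spread : ∀ {P : V → Set} {b} → b ∈ₛ S → P b → (∀ {s z} → P z → s ∈ₛ S → s ~ z → P s) → ∀ {s} → s ∈ₛ S → P s
    spread {P} {b} b∈ Pb step {s} s∈ = go (d b s) refl s∈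
      where
      go : ∀ k {s} → d b s ≡ k → s ∈ₛ S → P s
      go zero e _ = subst P (d-zero e) Pb
      go (suc k) {s} e s∈ with s ≟ᶠ b
      ... | yes refl = Pb
      ... | no s≢b with iso s∈ b∈ s≢b
      ... | z , z∈ , sz , q = step (go k (suc-injective (trans (sym q) e)) z∈) s∈ sz

    no-C₄-component : ∀ {b v w w′} → b ∈ₛ S → v ∈ₛ S → w ∈ₛ S → w′ ∈ₛ S → b ≢ v → w ≢ w′ →
      b ~ w → b ~ w′ → v ~ w → v ~ w′ →
      (∀ {t} → t ∈ₛ S → t ~ b → t ≡ w ⊎ t ≡ w′) → (∀ {t} → t ∈ₛ S → t ~ v → t ≡ w ⊎ t ≡ w′) →
      (∀ {t} → t ∈ₛ S → t ~ w → t ≡ b ⊎ t ≡ v) → (∀ {t} → t ∈ₛ S → t ~ w′ → t ≡ b ⊎ t ≡ v) → ⊥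
    no-C₄-component {b} {v} {w} {w′} b∈ v∈ w∈ w′∈ b≢v w≢w′ bw bw′ vw vw′ Nb Nv Nw Nw′ = ¬e4 (b , v , w , w′ , record
      { xs-unique = (b≢v ∷ []) ∷ [] ∷ [] ; ys-unique = (w≢w′ ∷ []) ∷ [] ∷ []
      ; xs-in = λ { (here refl) → b∈ ; (there (here refl)) → v∈ }
      ; ys-in = λ { (here refl) → w∈ ; (there (here refl)) → w′∈ }
      ; joined = λ { (here refl) (here refl) → bw ; (here refl) (there (here refl)) → bw′
                   ; (there (here refl)) (here refl) → vw ; (there (here refl)) (there (here refl)) → vw′ }
      ; cover = spread {λ s → s ∈ b ∷ v ∷ [] ⊎ s ∈ w ∷ w′ ∷ []} b∈ (inj₁ (here refl)) λ
          { (inj₁ (here refl)) s∈ sz → inj₂ (list (Nb s∈ sz)) ; (inj₁ (there (here refl))) s∈ sz → inj₂ (list (Nv s∈ sz))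
          ; (inj₂ (here refl)) s∈ sz → inj₁ (list (Nw s∈ sz)) ; (inj₂ (there (here refl))) s∈ sz → inj₁ (list (Nw′ s∈ sz)) } })
      where
      list : ∀ {x p q : V} → x ≡ p ⊎ x ≡ q → x ∈ p ∷ q ∷ []
      list (inj₁ e) = here e
      list (inj₂ e) = there (here e)

    -- Four-cycles attached at one vertex

    module Hanging-C₄ {b v w w′} (b∈ : b ∈ₛ S) (v∈ : v ∈ₛ S) (w∈ : w ∈ₛ S) (w′∈ : w′ ∈ₛ S) (b≢v : b ≢ v) (w≢w′ : w ≢ w′)
      (bw : b ~ w) (bw′ : b ~ w′) (vw : v ~ w) (vw′ : v ~ w′)
      (Nb : ∀ {t} → t ∈ₛ S → t ~ b → t ≡ w ⊎ t ≡ w′)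
      (Nw : ∀ {t} → t ∈ₛ S → t ~ w → t ≡ b ⊎ t ≡ v) (Nw′ : ∀ {t} → t ∈ₛ S → t ~ w′ → t ≡ b ⊎ t ≡ v) where

      dom : Dom S w w′
      dom t∈ tw with Nw t∈ tw
      ... | inj₁ refl = bw′
      ... | inj₂ refl = vw′
      dom′ : Dom S w′ w
      dom′ t∈ tw with Nw′ t∈ tw
      ... | inj₁ refl = bw
      ... | inj₂ refl = vw
      domb : Dom S b v
      domb t∈ tb with Nb t∈ tb
      ... | inj₁ refl = ~-sym vw
      ... | inj₂ refl = ~-sym vw′
      dww′ : d w w′ ≡ 2
      dww′ = common-nbr⇒d2 (~-sym bw) (~-sym bw′) w≢w′
      module W = Twins iso w∈ w′∈ dom dom′ dww′
      module W′ = Twins iso w′∈ w∈ dom′ dom (trans (d-sym w′ w) dww′)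

      S₂ : Subset
      S₂ = S ∖ b ∖ w′
      b≢w = ~⇒≢ bw
      b≢w′ = ~⇒≢ bw′
      in₂ : ∀ {x} → x ∈ₛ S → x ≢ b → x ≢ w′ → x ∈ₛ S₂
      in₂ x∈ x≢b x≢w′ = ∖⁺ (∖⁺ x∈ x≢b) x≢w′
      out₂ : ∀ {x} → x ∈ₛ S₂ → x ∈ₛ S × x ≢ b × x ≢ w′
      out₂ x∈ with ∖⁻ x∈
      ... | p , x≢w′ with ∖⁻ p
      ... | q , x≢b = q , x≢b , x≢w′
      iso₁ : Isometric (S ∖ b)
      iso₁ = isometric-∖ iso v∈ b∈ (b≢v ∘ sym) domb
      iso₂ : Isometric S₂
      iso₂ = isometric-∖ iso₁ (∖⁺ w∈ (b≢w ∘ sym)) (∖⁺ w′∈ (b≢w′ ∘ sym)) w≢w′ (dom′ ∘ ∖-⊆)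
      bridges : ∀ {x y} → Bridge S₂ x y → ¬ SamePair x y v w → Bridge S x y
      bridges {x} {y} B ¬vw = bridge-∖-dominated iso v∈ b∈ (b≢v ∘ sym) domb
        (bridge-∖-dominated iso₁ (∖⁺ w∈ (b≢w ∘ sym)) (∖⁺ w′∈ (b≢w′ ∘ sym)) w≢w′ (dom′ ∘ ∖-⊆) B
          (λ { (refl , yw′) → ¬vw (inj₂ (refl , is-v (Bridge.v∈ B) yw′)) }) (λ { (refl , xw′) → ¬vw (inj₁ (is-v (Bridge.u∈ B) xw′ , refl)) }))
        (λ { (refl , yb) → ¬vw (inj₁ (refl , is-w (Bridge.v∈ B) yb)) }) (λ { (refl , xb) → ¬vw (inj₂ (is-w (Bridge.u∈ B) xb , refl)) })
        where
        is-v : ∀ {t} → t ∈ₛ S₂ → t ~ w′ → t ≡ v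
        is-v t∈ tw′ with out₂ t∈
        ... | t∈S , t≢b , _ with Nw′ t∈S tw′
        ...   | inj₁ e = ⊥-elim (t≢b e)
        ...   | inj₂ e = e
        is-w : ∀ {t} → t ∈ₛ S₂ → t ~ b → t ≡ w
        is-w t∈ tb with out₂ t∈
        ... | t∈S , _ , t≢w′ with Nb t∈S tb
        ...   | inj₁ e = e
        ...   | inj₂ e = ⊥-elim (t≢w′ e)

      new-ww′ : ∀ {S′} → S′ ⊆ S₂ → New S′ S (w , w′)
      new-ww′ sub c∈ e∈ dce with out₂ (sub c∈) | out₂ (sub e∈)
      ... | c∈S , c≢b , c≢w′ | e∈S , e≢b , e≢w′ = W.twin-line-unique c∈S e∈S dce
        (λ { (inj₁ (_ , q)) → e≢w′ (sym q) ; (inj₂ (_ , q)) → c≢w′ (sym q) })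
        (λ wc we → ⊥-elim (clash (Nw c∈S (~-sym wc)) (Nw e∈S (~-sym we))))
        where
        clash : _ ≡ b ⊎ _ ≡ v → _ ≡ b ⊎ _ ≡ v → ⊥
        clash (inj₁ p) _ = c≢b p
        clash _ (inj₁ q) = e≢b q
        clash (inj₂ p) (inj₂ q) = d2⇒≢ dce (trans p (sym q))

      module _ {y} (y∈ : y ∈ₛ S) (yv : y ~ v) (y≢w : y ≢ w) (y≢w′ : y ≢ w′) where

        y≢b : y ≢ b
        y≢b refl = d2⇒≁ (common-nbr⇒d2 bw vw b≢v) yv
        dw′y : d w′ y ≡ 2
        dw′y = common-nbr⇒d2 (~-sym vw′) yv (y≢w′ ∘ sym)
        dwy : d w y ≡ 2
        dwy = common-nbr⇒d2 (~-sym vw) yv (y≢w ∘ sym)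
        new-w′y : ∀ {S′} → S′ ⊆ S₂ → New S′ S (w′ , y)
        new-w′y sub c∈ e∈ dce with out₂ (sub c∈) | out₂ (sub e∈)
        ... | c∈S , _ , c≢w′ | e∈S , _ , e≢w′ = W.split-twins y∈ dw′y y≢w c∈S e∈S dce c≢w′ e≢w′
        off-w : NotOnLine w′ y w
        off-w = d2-off (trans (d-sym w′ w) dww′) (trans (d-sym y w) dwy)

        -- Delete b and w′ but keep w as a leaf, so that the reduct is not exceptional. Its bridge v
        -- w is none in S and may cost a token; hence three new lines for two vertices, the third
        -- provided by y′.
        degree≥4 : ∀ {y′} → y′ ∈ₛ S → y′ ~ v → y′ ≢ w → y′ ≢ w′ → y′ ≢ y → ⊥
        degree≥4 {y′} y′∈ y′v y′≢w y′≢w′ y′≢y =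
          IH (≤-trans (s≤s (≤-trans (m≤n+m _ 1) (size-∖< (∖⁺ w′∈ (b≢w′ ∘ sym))))) (size-∖< b∈)) iso₂
            (w , y , in₂ w∈ (b≢w ∘ sym) w≢w′ , in₂ y∈ y≢b y≢w′ , dwy)
            (λ (_ , _ , _ , _ , K) → no-two (two-nbrs K (in₂ w∈ (b≢w ∘ sym) w≢w′)))
            (λ (_ , _ , _ , _ , _ , K) → no-two (two-nbrs K (in₂ w∈ (b≢w ∘ sym) w≢w′)))
            finish
          where
          no-two : ¬ ∃ λ t → ∃ λ t′ → t ∈ₛ S₂ × t′ ∈ₛ S₂ × t ≢ t′ × t ~ w × t′ ~ w
          no-two (t , t′ , t∈ , t′∈ , t≢t′ , tw , t′w) with out₂ t∈ | out₂ t′∈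
          ... | t∈S , t≢b , _ | t′∈S , t′≢b , _ with Nw t∈S tw | Nw t′∈S t′w
          ...   | inj₁ e | _ = t≢b e
          ...   | _ | inj₁ e = t′≢b e
          ...   | inj₂ e | inj₂ e′ = t≢t′ (trans e (sym e′))
          ns : List (V × V)
          ns = (w , w′) ∷ (w′ , y) ∷ (w′ , y′) ∷ []
          dw′y′ : d w′ y′ ≡ 2
          dw′y′ = common-nbr⇒d2 (~-sym vw′) y′v (y′≢w′ ∘ sym)
          dyy′ : d y y′ ≡ 2
          dyy′ = common-nbr⇒d2 yv y′v (y′≢y ∘ sym)
          off-w′ : NotOnLine w′ y′ w
          off-w′ = d2-off (trans (d-sym w′ w) dww′) (trans (d-sym y′ w) (common-nbr⇒d2 (~-sym vw) y′v (y′≢w ∘ sym)))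
          conclude : (T : Tokens S₂) → (∀ {x z} → bridgeToken x z ∈ Tokens.list T → ¬ SamePair x z v w) → size S₂ ≤ suc (Tokens.count T) → ⊥
          conclude T ok le = bad (good-from (∖-⊆ ∘ ∖-⊆) T (λ p B → bridges B (ok p)) ns
            ((w∈ , w′∈ , dww′) ∷ (w′∈ , y∈ , dw′y) ∷ (w′∈ , y′∈ , dw′y′) ∷ [])
            ( (separating′ {S} w∈ (on-self dww′) off-w ∷ separating′ {S} w∈ (on-self dww′) off-w′ ∷ [])
            ∷ (separating {S} y′∈ (d2-off dw′y′ dyy′) (on-self' dw′y′) ∷ []) ∷ [] ∷ [])
            (new-ww′ (λ p → p) ∷ new-w′y (λ p → p) ∷
              (λ c∈ e∈ dce → W.split-twins y′∈ dw′y′ y′≢w (proj₁ (out₂ c∈)) (proj₁ (out₂ e∈)) dce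
                 (proj₂ (proj₂ (out₂ c∈))) (proj₂ (proj₂ (out₂ e∈)))) ∷ [])
            (≤-trans size-∖≤ (s≤s (≤-trans size-∖≤ (s≤s le)))))
          finish : ¬ Good S₂
          finish (T , le) = conclude T absent (≤-trans le (m≤n+m _ 1))
            where
            same : ∀ {x z x′ z′} → SamePair x z v w → SamePair x′ z′ v w → SamePair x z x′ z′
            same (inj₁ (refl , refl)) (inj₁ (refl , refl)) = inj₁ (refl , refl)
            same (inj₁ (refl , refl)) (inj₂ (refl , refl)) = inj₂ (refl , refl)
            same (inj₂ (refl , refl)) (inj₁ (refl , refl)) = inj₂ (refl , refl)
            same (inj₂ (refl , refl)) (inj₂ (refl , refl)) = inj₁ (refl , refl)
            absent : ∀ {x z} → bridgeToken x z ∈ Tokens.list T → ¬ SamePair x z v w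
            absent p e with drop-token T p
            ... | T′ , cnt , ok = conclude T′ (λ q e′ → proj₂ (ok q) (same e e′)) (≤-trans le (≤-reflexive cnt))

        -- Without y′ the vertex w is deleted too, and with it the edge v w: three vertices against
        -- the lines of w w′, w y and w′ y. In the reduct v has y as its only neighbour, which
        -- excludes C₄ and K₂,₃; a further neighbour of y supplies a pair at distance 2.
        degree-3 : (∀ {y′} → y′ ∈ₛ S → y′ ~ v → y′ ≢ w → y′ ≢ w′ → y′ ≢ y → ⊥) → ⊥
        degree-3 no-y′ = another-nbr y∈ v∈ (~-sym yv) λ {y₂} y₂∈ y₂y y₂≢v →
          IH (≤-trans (s≤s (≤-trans (≤-trans (m≤n+m _ 2) (s≤s (size-∖< w∈₂))) (size-∖< (∖⁺ w′∈ (b≢w′ ∘ sym))))) (size-∖< b∈)) iso₃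
            (v , y₂ , v∈₃ , in₃ y₂∈ (λ { refl → [ y≢w , y≢w′ ]′ (Nb y∈ (~-sym y₂y)) })
                                    (λ { refl → [ y≢b , (~⇒≢ yv) ]′ (Nw′ y∈ (~-sym y₂y)) })
                                    (λ { refl → [ y≢b , (~⇒≢ yv) ]′ (Nw y∈ (~-sym y₂y)) })
              , common-nbr⇒d2 (~-sym yv) y₂y (y₂≢v ∘ sym))
            (λ (_ , _ , _ , _ , K) → no-two (two-nbrs K v∈₃))
            (λ (_ , _ , _ , _ , _ , K) → no-two (two-nbrs K v∈₃))
            λ (T , le) → bad (good-from (∖-⊆ ∘ ∖-⊆ ∘ ∖-⊆) T (λ _ → bridges₃) ((w , w′) ∷ (w , y) ∷ (w′ , y) ∷ [])
              ((w∈ , w′∈ , dww′) ∷ (w∈ , y∈ , dwy) ∷ (w′∈ , y∈ , dw′y) ∷ [])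
              ( (separating′ {S} w′∈ (on-self' dww′) (d2-off dww′ (trans (d-sym y w′) dw′y)) ∷ separating′ {S} w∈ (on-self dww′) off-w ∷ [])
              ∷ (separating′ {S} w∈ (on-self dwy) off-w ∷ []) ∷ [] ∷ [])
              (new-ww′ ∖-⊆
                ∷ (λ c∈ e∈ dce → W′.split-twins y∈ dwy y≢w′ (proj₁ (out₂ (∖-⊆ c∈))) (proj₁ (out₂ (∖-⊆ e∈))) dce (proj₂ (∖⁻ c∈)) (proj₂ (∖⁻ e∈)))
                ∷ new-w′y ∖-⊆ ∷ [])
              (≤-trans size-∖≤ (s≤s (≤-trans size-∖≤ (s≤s (≤-trans size-∖≤ (s≤s le)))))))
          where
          S₃ : Subset
          S₃ = S₂ ∖ w
          w∈₂ : w ∈ₛ S₂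
          w∈₂ = in₂ w∈ (b≢w ∘ sym) w≢w′
          v∈₂ : v ∈ₛ S₂
          v∈₂ = in₂ v∈ (b≢v ∘ sym) (~⇒≢ vw′)
          v∈₃ : v ∈ₛ S₃
          v∈₃ = ∖⁺ v∈₂ (~⇒≢ vw)
          in₃ : ∀ {x} → x ∈ₛ S → x ≢ b → x ≢ w′ → x ≢ w → x ∈ₛ S₃
          in₃ x∈ p q r = ∖⁺ (in₂ x∈ p q) r
          w-leaf : ∀ {t} → t ∈ₛ S₂ → t ~ w → t ≡ v
          w-leaf t∈ tw with out₂ t∈
          ... | t∈S , t≢b , _ with Nw t∈S tw
          ...   | inj₁ e = ⊥-elim (t≢b e)
          ...   | inj₂ e = e
          iso₃ : Isometric S₃
          iso₃ = isometric-∖ iso₂ (in₂ y∈ y≢b y≢w′) w∈₂ y≢w λ t∈ tw → subst (_~ y) (sym (w-leaf t∈ tw)) (~-sym yv)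
          bridges₃ : ∀ {x z} → Bridge S₃ x z → Bridge S x z
          bridges₃ B = bridges (Leaf.bridge-∖-leaf iso₂ w∈₂ v∈₂ (~-sym vw) w-leaf B)
            λ { (inj₁ (_ , refl)) → proj₂ (∖⁻ (Bridge.v∈ B)) refl ; (inj₂ (refl , _)) → proj₂ (∖⁻ (Bridge.u∈ B)) refl }
          no-two : ¬ ∃ λ t → ∃ λ t′ → t ∈ₛ S₃ × t′ ∈ₛ S₃ × t ≢ t′ × t ~ v × t′ ~ v
          no-two (t , t′ , t∈ , t′∈ , t≢t′ , tv , t′v) with t ≟ᶠ y | t′ ≟ᶠ y | ∖⁻ t∈ | ∖⁻ t′∈
          ... | yes refl | yes refl | _ | _ = t≢t′ refl
          ... | no t≢y | _ | p , t≢w | _ = let (t∈S , _ , t≢w′) = out₂ p in no-y′ t∈S tv t≢w t≢w′ t≢y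
          ... | _ | no t≢y | _ | p , t≢w = let (t∈S , _ , t≢w′) = out₂ p in no-y′ t∈S t′v t≢w t≢w′ t≢y

      hanging-C₄-⊥ : ⊥
      hanging-C₄-⊥ = no-C₄-component b∈ v∈ w∈ w′∈ b≢v w≢w′ bw bw′ vw vw′ Nb Nv Nw Nw′
        where
        Nv : ∀ {t} → t ∈ₛ S → t ~ v → t ≡ w ⊎ t ≡ w′
        Nv {t} t∈ tv with t ≟ᶠ w | t ≟ᶠ w′
        ... | yes e | _ = inj₁ e
        ... | _ | yes e = inj₂ e
        ... | no t≢w | no t≢w′ = ⊥-elim (degree-3 t∈ tv t≢w t≢w′ (degree≥4 t∈ tv t≢w t≢w′))

    open Hanging-C₄ using (hanging-C₄-⊥)

    -- Counting pairs at distance 2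

    some-nbr : ∀ {x} → x ∈ₛ S → ∃ λ w → w ∈ₛ S × w ~ x
    some-nbr {x} x∈ = toward pair
      where
      toward : HasPair S → ∃ λ w → w ∈ₛ S × w ~ x
      toward (p , q , p∈ , q∈ , dpq) with p ≟ᶠ x
      ... | yes refl = let (w , w∈ , xw , _) = iso p∈ q∈ (d2⇒≢ dpq) in w , w∈ , ~-sym xw
      ... | no p≢x = let (w , w∈ , xw , _) = iso x∈ p∈ (p≢x ∘ sym) in w , w∈ , ~-sym xw

    -- If x′ were the only vertex at distance 2 from x, all neighbours of x would have neighbourhood
    -- {x, x′}. They would be twins, two in number by `twins-⊥`, and form with x a C₄ attached at
    -- x′.
    two-at-distance-2 : ∀ {x} → x ∈ₛ S → ¬ (∀ {y z} → y ∈ₛ S → z ∈ₛ S → d x y ≡ 2 → d x z ≡ 2 → y ≡ z)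
    two-at-distance-2 {x} x∈ unique with some-nbr x∈
    ... | w , w∈ , wx = another-nbr x∈ w∈ wx λ {w′} w′∈ w′x w′≢w → another-nbr w∈ x∈ (~-sym wx) λ {x′} x′∈ x′w x′≢x →
      let
        dxx′ : d x x′ ≡ 2
        dxx′ = common-nbr⇒d2 (~-sym wx) x′w (x′≢x ∘ sym)
        N : ∀ {u t} → u ~ x → t ∈ₛ S → t ~ u → t ≡ x ⊎ t ≡ x′
        N {u} {t} ux t∈ tu = case-≟ t x (λ t≢x → unique t∈ x′∈ (common-nbr⇒d2 (~-sym ux) tu (t≢x ∘ sym)) dxx′)
        x′~ : ∀ {u} → u ∈ₛ S → u ~ x → x′ ~ u
        x′~ {u} u∈ ux = decidable-stable (x′ ~? u) λ ¬x′u → another-nbr u∈ x∈ (~-sym ux) λ {t} t∈ tu t≢x →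
          [ t≢x , (λ { refl → ¬x′u tu }) ]′ (N ux t∈ tu)
        dom : ∀ {u u′} → u ∈ₛ S → u ~ x → u′ ∈ₛ S → u′ ~ x → Dom S u u′
        dom {u} {u′} u∈ ux u′∈ u′x t∈ tu = [ (λ { refl → ~-sym u′x }) , (λ { refl → x′~ u′∈ u′x }) ]′ (N ux t∈ tu)
        Nx : ∀ {t} → t ∈ₛ S → t ~ x → t ≡ w ⊎ t ≡ w′
        Nx {t} t∈ tx = case-≟ t w λ t≢w → decidable-stable (t ≟ᶠ w′) λ t≢w′ →
          twins-⊥ w∈ w′∈ t∈ x∈ x′∈ (w′≢w ∘ sym) t≢w t≢w′ (dom w∈ wx w′∈ w′x) (dom w′∈ w′x w∈ wx) (dom w∈ wx t∈ tx)
            (x′≢x ∘ sym) (~-sym wx) x′w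
      in hanging-C₄-⊥ x∈ x′∈ w∈ w′∈ (x′≢x ∘ sym) (w′≢w ∘ sym) (~-sym wx) (~-sym w′x) x′w (x′~ w′∈ w′x) Nx (N wx) (N w′x)

    -- Two partners for each vertex give at least twice as many ordered pairs as vertices, hence at
    -- least as many unordered pairs as vertices; with distinct lines, S would be good.
    all-lines-distinct-⊥ : ¬ (∀ {a b c e} → a ∈ₛ S → b ∈ₛ S → c ∈ₛ S → e ∈ₛ S → d a b ≡ 2 → d c e ≡ 2 →
      ¬ SamePair a b c e → ¬ SameLine S a b c e)
    all-lines-distinct-⊥ distinct = bad (tokens (lines ps) (All-map⁺ ps-valid)
        (AllPairs-map⁺ (AllPairs-strengthen (λ {p} {q} → different {p} {q}) ps-ordered (Uniqueₚ.filter⁺ ordered? (Uniqueₚ.filter⁺ R? prod-unique))))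
      , ≤-trans half (≤-reflexive (sym (length-map _ ps))))
      where
      R : V → V → Set
      R x y = x ∈ₛ S × y ∈ₛ S × d x y ≡ 2
      R? : ∀ p → Dec (R (proj₁ p) (proj₂ p))
      R? (x , y) = (x ∈ₛ? S) ×-dec ((y ∈ₛ? S) ×-dec (d x y ≟ 2))
      ordered? : ∀ (p : V × V) → Dec (toℕ (proj₁ p) < toℕ (proj₂ p))
      ordered? (x , y) = toℕ x <? toℕ y
      prod os ps : List (V × V)
      prod = cartesianProduct (allFin N) (allFin N)
      os = filter R? prod
      ps = filter ordered? os
      prod-unique : Unique prod
      prod-unique = Uniqueₚ.cartesianProduct⁺ (Uniqueₚ.allFin⁺ N) (Uniqueₚ.allFin⁺ N)
      os⁺ : ∀ {x y} → R x y → (x , y) ∈ os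
      os⁺ r = ∈-filter⁺ R? (∈-cartesianProduct⁺ (∈-allFin _) (∈-allFin _)) r
      os⁻ : ∀ {p} → p ∈ os → R (proj₁ p) (proj₂ p)
      os⁻ = proj₂ ∘ ∈-filter⁻ R? {xs = prod}
      ps⁻ : ∀ {p} → p ∈ ps → p ∈ os × toℕ (proj₁ p) < toℕ (proj₂ p)
      ps⁻ = ∈-filter⁻ ordered? {xs = os}
      ps-valid : All (LinePair S) ps
      ps-valid = All.tabulate λ p∈ → os⁻ (proj₁ (ps⁻ p∈))
      ps-ordered : All (λ p → R (proj₁ p) (proj₂ p) × toℕ (proj₁ p) < toℕ (proj₂ p)) ps
      ps-ordered = All.tabulate λ p∈ → os⁻ (proj₁ (ps⁻ p∈)) , proj₂ (ps⁻ p∈)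
      different : ∀ {p q : V × V} → R (proj₁ p) (proj₂ p) × toℕ (proj₁ p) < toℕ (proj₂ p) →
        R (proj₁ q) (proj₂ q) × toℕ (proj₁ q) < toℕ (proj₂ q) → p ≢ q → DistinctLines S p q
      different ((a∈ , b∈ , dab) , a<b) ((c∈ , e∈ , dce) , c<e) p≢q = distinct a∈ b∈ c∈ e∈ dab dce
        λ { (inj₁ (refl , refl)) → p≢q refl ; (inj₂ (refl , refl)) → <-asym a<b c<e }
      swap : V × V → V × V
      swap (x , y) = y , x
      os⊆ : ∀ {p} → p ∈ os → p ∈ ps ++ map swap ps
      os⊆ {x , y} p∈ with <-cmp (toℕ x) (toℕ y)
      ... | tri< x<y _ _ = ∈-++⁺ˡ (∈-filter⁺ ordered? p∈ x<y)
      ... | tri≈ _ e _ = ⊥-elim (d2⇒≢ (proj₂ (proj₂ (os⁻ p∈))) (toℕ-injective e))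
      ... | tri> _ _ y<x = ∈-++⁺ʳ ps (∈-map⁺ swap (∈-filter⁺ ordered? (os⁺ (flipped (os⁻ p∈))) y<x))
        where
        flipped : R x y → R y x
        flipped (x∈ , y∈ , e) = y∈ , x∈ , trans (d-sym y x) e
      two : ∀ {x} → x ∈ members S → ∃ λ y → ∃ λ z → y ≢ z × R x y × R x z
      two {x} x∈ with filter (λ y → (y ∈ₛ? S) ×-dec (d x y ≟ 2)) (allFin N) | at2⁺ | at2⁻ | Uniqueₚ.filter⁺ (λ y → (y ∈ₛ? S) ×-dec (d x y ≟ 2)) (Uniqueₚ.allFin⁺ N)
        where
        at2? : ∀ y → Dec (y ∈ₛ S × d x y ≡ 2)
        at2? y = (y ∈ₛ? S) ×-dec (d x y ≟ 2)
        at2⁺ : ∀ {y} → y ∈ₛ S × d x y ≡ 2 → y ∈ filter at2? (allFin N)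
        at2⁺ r = ∈-filter⁺ at2? (∈-allFin _) r
        at2⁻ : ∀ {y} → y ∈ filter at2? (allFin N) → y ∈ₛ S × d x y ≡ 2
        at2⁻ = proj₂ ∘ ∈-filter⁻ at2? {xs = allFin N}
      ... | y ∷ z ∷ _ | _ | at2⁻ | (y≢z ∷ _) ∷ _ = y , z , y≢z , (members⁻ x∈ , at2⁻ (here refl)) , (members⁻ x∈ , at2⁻ (there (here refl)))
      ... | [] | at2⁺ | _ | _ = ⊥-elim (two-at-distance-2 (members⁻ x∈) λ y∈ z∈ dy dz → one (at2⁺ (y∈ , dy)))
        where
        one : ∀ {A : Set} {y : V} → y ∈ [] → A
        one ()
      ... | y₀ ∷ [] | at2⁺ | _ | _ = ⊥-elim (two-at-distance-2 (members⁻ x∈) λ y∈ z∈ dy dz → one (at2⁺ (y∈ , dy)) (at2⁺ (z∈ , dz)))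
        where
        one : ∀ {y z : V} → y ∈ y₀ ∷ [] → z ∈ y₀ ∷ [] → y ≡ z
        one (here refl) (here refl) = refl
      half : size S ≤ length ps
      half with size S ≤? length ps | two-each {R = R} (members S) (members-unique S) two
      ... | yes le | _ = le
      ... | no ¬le | qs , len , qs-unique , qs-ok = ⊥-elim (n≮n _ (≤-trans (+-mono-<-≤ (≰⇒> ¬le) (<⇒≤ (≰⇒> ¬le)))
        (≤-trans (≤-reflexive (sym len)) (≤-trans (unique-⊆⇒length≤ qs-unique (λ q∈ → os⊆ (os⁺ (proj₂ (qs-ok q∈)))))
          (≤-reflexive (trans (length-++ ps) (cong (length ps +_) (length-map swap ps))))))))

    -- A line now consists of a, b and their neighbours. By parity a different pair with the same
    -- line is formed by two of these neighbours; their own neighbours are on the line, hence are a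
    -- and b. The roles can be exchanged, so S is C₄.
    diameter-3-⊥ : ¬ (∀ {x y} → x ∈ₛ S → y ∈ₛ S → d x y ≤ 3)
    diameter-3-⊥ d≤3 = all-lines-distinct-⊥ distinct
      where
      parity : ∀ {x y z} → d x y ≡ 2 → d x z ≡ 2 → ¬ (y ~ z)
      parity {x} {y} {z} p q yz = lem p q (d-alternates yz x)
        where
        lem : ∀ {m n} → m ≡ 2 → n ≡ 2 → n ≡ suc m ⊎ m ≡ suc n → ⊥
        lem refl refl (inj₁ ())
        lem refl refl (inj₂ ())
      near-3 : ∀ {a b x} → a ∈ₛ S → b ∈ₛ S → x ∈ₛ S → Near a b x → x ≡ a ⊎ a ~ x
      near-3 {a} {b} {x} a∈ b∈ x∈ n = lem (d a x) refl (subst (_≤ 3) n (d≤3 b∈ x∈))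
        where
        lem : ∀ k → d a x ≡ k → 2 + d a x ≤ 3 → x ≡ a ⊎ a ~ x
        lem zero e _ = inj₁ (sym (d-zero e))
        lem (suc zero) e _ = inj₂ e
        lem (suc (suc k)) e le with subst (λ m → 2 + m ≤ 3) e le
        ... | s≤s (s≤s (s≤s ()))
      on-line : ∀ {a b x} → a ∈ₛ S → b ∈ₛ S → d a b ≡ 2 → x ∈ₛ S → ¬ NotOnLine a b x → (x ≡ a ⊎ x ≡ b) ⊎ (a ~ x ⊎ b ~ x)
      on-line {a} {b} {x} a∈ b∈ dab x∈ on with position dab x
      ... | off o = ⊥-elim (on o)
      ... | mid ax _ = inj₂ (inj₁ ax)
      ... | near₁ n = [ inj₁ ∘ inj₁ , inj₂ ∘ inj₁ ]′ (near-3 a∈ b∈ x∈ n)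
      ... | near₂ n = [ inj₁ ∘ inj₂ , inj₂ ∘ inj₂ ]′ (near-3 b∈ a∈ x∈ n)
      nbrs-in : ∀ {a b c e} → a ∈ₛ S → b ∈ₛ S → d a b ≡ 2 → SameLine S a b c e → a ~ c ⊎ b ~ c →
        ∀ {t} → t ∈ₛ S → t ~ c → t ≡ a ⊎ t ≡ b
      nbrs-in {a} {b} {c} a∈ b∈ dab L adj {t} t∈ tc with on-line a∈ b∈ dab t∈ (on-nbr (~-sym tc) ∘ proj₁ (L t∈))
      ... | inj₁ r = r
      ... | inj₂ r = ⊥-elim (cases adj r)
        where
        far : ∀ {p q} → d q p ≡ 2 → p ~ t → q ~ c → ⊥
        far {p} {q} dqp pt qc with p ≟ᶠ c
        ... | yes refl = d2⇒≁ dqp qc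
        ... | no p≢c = parity (trans (d-sym p q) dqp) (common-nbr⇒d2 pt (~-sym tc) p≢c) qc
        cases : a ~ c ⊎ b ~ c → a ~ t ⊎ b ~ t → ⊥
        cases (inj₁ ac) (inj₁ at) = nbrs≁ tc ac (~-sym at)
        cases (inj₂ bc) (inj₂ bt) = nbrs≁ tc bc (~-sym bt)
        cases (inj₁ ac) (inj₂ bt) = far dab bt ac
        cases (inj₂ bc) (inj₁ at) = far (trans (d-sym b a) dab) at bc
      both : ∀ {a b c} → a ∈ₛ S → b ∈ₛ S → c ∈ₛ S → a ~ c ⊎ b ~ c → (∀ {t} → t ∈ₛ S → t ~ c → t ≡ a ⊎ t ≡ b) → a ~ c × b ~ c
      both {a} {b} {c} a∈ b∈ c∈ adj N with a ~? c | b ~? c | adj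
      ... | yes p | yes q | _ = p , q
      ... | no ¬p | no ¬q | r = ⊥-elim ([ ¬p , ¬q ]′ r)
      ... | yes p | no ¬q | _ = ⊥-elim (another-nbr c∈ a∈ p λ t∈ tc t≢a → [ t≢a , (λ { refl → ¬q tc }) ]′ (N t∈ tc))
      ... | no ¬p | yes q | _ = ⊥-elim (another-nbr c∈ b∈ q λ t∈ tc t≢b → [ (λ { refl → ¬p tc }) , t≢b ]′ (N t∈ tc))
      distinct : ∀ {a b c e} → a ∈ₛ S → b ∈ₛ S → c ∈ₛ S → e ∈ₛ S → d a b ≡ 2 → d c e ≡ 2 → ¬ SamePair a b c e → ¬ SameLine S a b c e
      distinct {a} {b} {c} {e} a∈ b∈ c∈ e∈ dab dce ¬same L
        with on-line a∈ b∈ dab c∈ (on-self dce ∘ proj₁ (L c∈)) | on-line a∈ b∈ dab e∈ (on-self' dce ∘ proj₁ (L e∈))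
      ... | inj₁ (inj₁ refl) | inj₁ (inj₁ refl) = d2⇒≢ dce refl
      ... | inj₁ (inj₁ refl) | inj₁ (inj₂ refl) = ¬same (inj₁ (refl , refl))
      ... | inj₁ (inj₂ refl) | inj₁ (inj₁ refl) = ¬same (inj₂ (refl , refl))
      ... | inj₁ (inj₂ refl) | inj₁ (inj₂ refl) = d2⇒≢ dce refl
      ... | inj₁ (inj₁ refl) | inj₂ (inj₁ ae) = d2⇒≁ dce ae
      ... | inj₁ (inj₁ refl) | inj₂ (inj₂ be) = parity dab dce be
      ... | inj₁ (inj₂ refl) | inj₂ (inj₁ ae) = parity (trans (d-sym b a) dab) dce ae
      ... | inj₁ (inj₂ refl) | inj₂ (inj₂ be) = d2⇒≁ dce be
      ... | inj₂ (inj₁ ac) | inj₁ (inj₁ refl) = d2⇒≁ dce (~-sym ac)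
      ... | inj₂ (inj₂ bc) | inj₁ (inj₁ refl) = parity dab (trans (d-sym e c) dce) bc
      ... | inj₂ (inj₁ ac) | inj₁ (inj₂ refl) = parity (trans (d-sym b a) dab) (trans (d-sym e c) dce) ac
      ... | inj₂ (inj₂ bc) | inj₁ (inj₂ refl) = d2⇒≁ dce (~-sym bc)
      ... | inj₂ adjc | inj₂ adje with nbrs-in a∈ b∈ dab L adjc | nbrs-in a∈ b∈ dab (swap₂ {S} L) adje
      ... | Nc | Ne with both a∈ b∈ c∈ adjc Nc | both a∈ b∈ e∈ adje Ne
      ... | ac , bc | ae , be = no-C₄-component a∈ b∈ c∈ e∈ (d2⇒≢ dab) (d2⇒≢ dce) ac ae bc be
        (nbrs-in c∈ e∈ dce (sameLine-sym {S} L) (inj₁ (~-sym ac))) (nbrs-in c∈ e∈ dce (swap₂ {S} (sameLine-sym {S} L)) (inj₁ (~-sym bc))) Nc Ne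

    -- The parts share v, so their sizes add up to one more than that of S and one token may be
    -- lost. By `full`, a line common to both parts contains all of S₂, and at most one token of S₂
    -- has that property.
    split-⊥ : ∀ {S₁ S₂ v} → Split S S₁ S₂ v → ⊥
    split-⊥ {S₁} {S₂} {v} P =
      by-induction P λ (T₁ , le₁) → by-induction (split-sym P) λ (T₂ , le₂) →
        -- A universal token, if there is one, is dropped and the argument repeated; a second
        -- universal token would have the same line on S₂ as the first.
        finish T₁ le₁ T₂ (λ t∈ u → let (T₂′ , cnt , ok) = drop-token T₂ t∈ in
            finish T₁ le₁ T₂′ (λ t′∈ u′ → proj₂ (ok t′∈) λ z∈ → (λ o → ⊥-elim (u z∈ o)) , (λ o → ⊥-elim (u′ z∈ o)))
              (≤-trans le₂ (≤-reflexive cnt)))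
          (≤-trans le₂ (m≤n+m _ 1))
      where
      by-induction : ∀ {S₁ S₂ v} → Split S S₁ S₂ v → ¬ ¬ Good S₁
      by-induction {S₁} {S₂} {v} P ¬good = has-pair λ p → IH size₁ iso₁ p exc4 (λ e5 → hanging-K₂₃-⊥ sub₁ e5 v∈₁ closed₁) ¬good
        where
        open Split P
        open Part iso P
        has-pair : ¬ ¬ HasPair S₁
        has-pair ¬p with more₁
        ... | t , t∈ , t≢v with some-nbr (sub₁ t∈)
        ... | w , w∈ , wt = another-nbr (sub₁ t∈) w∈ wt λ {w′} w′∈ w′t w′≢w →
          ¬p (w , w′ , closed₁ t∈ t≢v w∈ wt , closed₁ t∈ t≢v w′∈ w′t , common-nbr⇒d2 wt w′t (w′≢w ∘ sym))
        hanging : ∀ {x y₁ y₂} → ¬ Biclique S₁ (v ∷ x ∷ []) (y₁ ∷ y₂ ∷ [])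
        hanging {x} {y₁} {y₂} K with Biclique.xs-unique K | Biclique.ys-unique K
        ... | (v≢x ∷ []) ∷ _ | (y₁≢y₂ ∷ []) ∷ _ = hanging-C₄-⊥ (sub₁ x∈) (sub₁ v∈₁) (sub₁ (ys-in (here refl))) (sub₁ (ys-in (there (here refl))))
          (v≢x ∘ sym) y₁≢y₂ (joined (there (here refl)) (here refl)) (joined (there (here refl)) (there (here refl)))
          (joined (here refl) (here refl)) (joined (here refl) (there (here refl)))
          (λ t∈ tx → Nx (cover (closed₁ x∈ (v≢x ∘ sym) t∈ tx)) tx)
          (λ t∈ ty → Ny (here refl) (cover (closed₁ (ys-in (here refl)) (λ { refl → ~-irrefl (joined (here refl) (here refl)) }) t∈ ty)) ty)
          (λ t∈ ty → Ny (there (here refl)) (cover (closed₁ (ys-in (there (here refl))) (λ { refl → ~-irrefl (joined (here refl) (there (here refl))) }) t∈ ty)) ty)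
          where
          open Biclique K
          x∈ = xs-in (there (here refl))
          Nx : ∀ {t} → t ∈ v ∷ x ∷ [] ⊎ t ∈ y₁ ∷ y₂ ∷ [] → t ~ x → t ≡ y₁ ⊎ t ≡ y₂
          Nx (inj₁ p) tx = ⊥-elim (nbrs≁ (joined p (here refl)) (joined (there (here refl)) (here refl)) tx)
          Nx (inj₂ (here e)) _ = inj₁ e
          Nx (inj₂ (there (here e))) _ = inj₂ e
          Ny : ∀ {y t} → y ∈ y₁ ∷ y₂ ∷ [] → t ∈ v ∷ x ∷ [] ⊎ t ∈ y₁ ∷ y₂ ∷ [] → t ~ y → t ≡ x ⊎ t ≡ v
          Ny y∈ (inj₂ q) ty = ⊥-elim (nbrs≁ (~-sym (joined (here refl) q)) (~-sym (joined (here refl) y∈)) ty)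
          Ny y∈ (inj₁ (here e)) _ = inj₂ e
          Ny y∈ (inj₁ (there (here e))) _ = inj₁ e
        exc4 : ¬ IsC₄ S₁
        exc4 (x₁ , x₂ , y₁ , y₂ , K) with Biclique.cover K v∈₁
        ... | inj₁ (here refl) = hanging K
        ... | inj₁ (there (here refl)) = hanging (swap-xs K)
        ... | inj₂ (here refl) = hanging (flip K)
        ... | inj₂ (there (here refl)) = hanging (swap-xs (flip K))
      open Split P
      module P₁ = Part iso P
      module P₂ = Part iso (split-sym P)
      Universal : Token → Set
      Universal (lineToken c e) = ∀ {z} → z ∈ₛ S₂ → ¬ NotOnLine c e z
      Universal (bridgeToken _ _) = ⊥
      conclude : (T₁ : Tokens S₁) → size S₁ ≤ Tokens.count T₁ → (T₂ : Tokens S₂) →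
        (∀ {t} → t ∈ Tokens.list T₂ → ¬ Universal t) → size S₂ ≤ suc (Tokens.count T₂) → ⊥
      conclude T₁ le₁ T₂ ¬u le₂ = bad (append L₁ L₂ D ,
        ≤-trans (size≤ {xs = members S₁ ++ members (S₂ ∖ v)} λ {x} x∈ → place x∈ (covers x∈) (x ≟ᶠ v))
          (≤-trans (≤-reflexive (length-++ (members S₁)))
            (≤-trans (+-mono-≤ le₁ (≤-pred (≤-trans (size-∖< v∈₂) le₂))) (≤-reflexive (sym (append-count L₁ L₂ D))))))
        where
        L₁ : Tokens S
        L₁ = lift sub₁ T₁ (λ _ → P₁.bridge₁)
        L₂ : Tokens S
        L₂ = lift sub₂ T₂ (λ _ → P₂.bridge₁)
        place : ∀ {x} → x ∈ₛ S → x ∈ₛ S₁ ⊎ x ∈ₛ S₂ → Dec (x ≡ v) → x ∈ members S₁ ++ members (S₂ ∖ v)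
        place x∈ (inj₁ p) _ = ∈-++⁺ˡ (members⁺ p)
        place x∈ (inj₂ q) (yes refl) = ∈-++⁺ˡ (members⁺ v∈₁)
        place x∈ (inj₂ q) (no x≢v) = ∈-++⁺ʳ (members S₁) (members⁺ (∖⁺ q x≢v))
        apart : ∀ s t → Valid S₁ s → Valid S₂ t → ¬ Universal t → Distinct S s t
        apart (lineToken a b) (lineToken c e) (a∈ , b∈ , dab) (c∈ , e∈ , dce) ¬u L = ¬u (P₁.full a∈ b∈ dab c∈ e∈ dce L)
        apart (lineToken _ _) (bridgeToken _ _) _ _ _ = tt
        apart (bridgeToken _ _) (lineToken _ _) _ _ _ = tt
        apart (bridgeToken u w) (bridgeToken u′ w′) B B′ _ (inj₁ (refl , refl)) =
          ~⇒≢ (Bridge.edge B) (trans (meet (Bridge.u∈ B) (Bridge.u∈ B′)) (sym (meet (Bridge.v∈ B) (Bridge.v∈ B′))))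
        apart (bridgeToken u w) (bridgeToken u′ w′) B B′ _ (inj₂ (refl , refl)) =
          ~⇒≢ (Bridge.edge B) (trans (meet (Bridge.u∈ B) (Bridge.v∈ B′)) (sym (meet (Bridge.v∈ B) (Bridge.u∈ B′))))
        D : All (λ s → All (Distinct S s) (Tokens.list T₂)) (Tokens.list T₁)
        D = All.tabulate λ {s} s∈ → All.tabulate λ {t} t∈ →
          apart s t (All.lookup (Tokens.valid T₁) s∈) (All.lookup (Tokens.valid T₂) t∈) (¬u t∈)
      finish : (T₁ : Tokens S₁) → size S₁ ≤ Tokens.count T₁ → (T₂ : Tokens S₂) →
        (∀ {c e} → lineToken c e ∈ Tokens.list T₂ → ¬ Universal (lineToken c e)) → size S₂ ≤ suc (Tokens.count T₂) → ⊥
      finish T₁ le₁ T₂ ¬u = conclude T₁ le₁ T₂ λ { {lineToken _ _} t∈ → ¬u t∈ ; {bridgeToken _ _} _ () }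

    no-cut : ¬ CutVertex S
    no-cut C = split-⊥ (cut-split C)

    -- Exceptional reducts excluded by the diameter

    nbr-dist : ∀ {x y z k} → x ~ y → d y z ≤ k → d x z ≤ suc k
    nbr-dist {x} {y} {z} xy le = ≤-trans (d-triangle x y z) (≤-trans (≤-reflexive (cong (_+ d y z) xy)) (s≤s le))

    -- A biclique has diameter at most 2, so one attached vertex gives at most 3. This, and
    -- `two-more-⊥` for two adjacent attached vertices, show that the reducts below are not
    -- exceptional.
    one-more-⊥ : ∀ {S′ b w x₀ y₀ xs ys} → Biclique S′ (x₀ ∷ xs) (y₀ ∷ ys) → w ∈ₛ S′ → b ~ w →
      (∀ {x} → x ∈ₛ S → x ∈ₛ S′ ⊎ x ≡ b) → ⊥
    one-more-⊥ {S′} {b} K w∈ bw cov = diameter-3-⊥ λ x∈ y∈ → go (cov x∈) (cov y∈)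
      where
      go : ∀ {x y} → x ∈ₛ S′ ⊎ x ≡ b → y ∈ₛ S′ ⊎ y ≡ b → d x y ≤ 3
      go (inj₁ p) (inj₁ q) = ≤-trans (biclique-d≤2 K p q) (m≤n+m _ 1)
      go (inj₂ refl) (inj₁ q) = nbr-dist bw (biclique-d≤2 K w∈ q)
      go {x} (inj₁ p) (inj₂ refl) = ≤-trans (≤-reflexive (d-sym x b)) (nbr-dist bw (biclique-d≤2 K w∈ p))
      go (inj₂ refl) (inj₂ refl) = ≤-trans (≤-reflexive (d-refl b)) z≤n

    two-more-⊥ : ∀ {S′ b w b′ w′ x₀ y₀ xs ys} → Biclique S′ (x₀ ∷ xs) (y₀ ∷ ys) → w ∈ₛ S′ → b ~ w → w′ ∈ₛ S′ → b′ ~ w′ →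
      b ~ b′ → (∀ {x} → x ∈ₛ S → x ∈ₛ S′ ⊎ x ≡ b ⊎ x ≡ b′) → ⊥
    two-more-⊥ {S′} {b} {w} {b′} {w′} K w∈ bw w′∈ bw′ bb′ cov = diameter-3-⊥ λ x∈ y∈ → go (cov x∈) (cov y∈)
      where
      sym≤ : ∀ {x y} → d y x ≤ 3 → d x y ≤ 3
      sym≤ {x} {y} = ≤-trans (≤-reflexive (d-sym x y))
      go : ∀ {x y} → x ∈ₛ S′ ⊎ x ≡ b ⊎ x ≡ b′ → y ∈ₛ S′ ⊎ y ≡ b ⊎ y ≡ b′ → d x y ≤ 3
      go (inj₁ p) (inj₁ q) = ≤-trans (biclique-d≤2 K p q) (m≤n+m _ 1)
      go (inj₂ (inj₁ refl)) (inj₁ q) = nbr-dist bw (biclique-d≤2 K w∈ q)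
      go (inj₂ (inj₂ refl)) (inj₁ q) = nbr-dist bw′ (biclique-d≤2 K w′∈ q)
      go (inj₁ p) (inj₂ (inj₁ refl)) = sym≤ (nbr-dist bw (biclique-d≤2 K w∈ p))
      go (inj₁ p) (inj₂ (inj₂ refl)) = sym≤ (nbr-dist bw′ (biclique-d≤2 K w′∈ p))
      go (inj₂ (inj₁ refl)) (inj₂ (inj₁ refl)) = ≤-trans (≤-reflexive (d-refl b)) z≤n
      go (inj₂ (inj₂ refl)) (inj₂ (inj₂ refl)) = ≤-trans (≤-reflexive (d-refl b′)) z≤n
      go (inj₂ (inj₁ refl)) (inj₂ (inj₂ refl)) = ≤-trans (≤-reflexive bb′) (s≤s z≤n)
      go (inj₂ (inj₂ refl)) (inj₂ (inj₁ refl)) = sym≤ (≤-trans (≤-reflexive bb′) (s≤s z≤n))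

    ∖-covers : ∀ {b x} → x ∈ₛ S → x ∈ₛ S ∖ b ⊎ x ≡ b
    ∖-covers {b} {x} x∈ with x ≟ᶠ b
    ... | yes e = inj₂ e
    ... | no n = inj₁ (∖⁺ x∈ n)

    ∖∖-covers : ∀ {b c x} → x ∈ₛ S → x ∈ₛ S ∖ b ∖ c ⊎ x ≡ b ⊎ x ≡ c
    ∖∖-covers {b} {c} {x} x∈ with x ≟ᶠ b | x ≟ᶠ c
    ... | yes e | _ = inj₂ (inj₁ e)
    ... | _ | yes e = inj₂ (inj₂ e)
    ... | no n | no m = inj₁ (∖⁺ (∖⁺ x∈ n) m)

    size-∖∖ : ∀ {b c} → b ∈ₛ S → c ∈ₛ S → c ≢ b → suc (size (S ∖ b ∖ c)) ≤ size S
    size-∖∖ {b} {c} b∈ c∈ c≢b = ≤-trans (≤-trans (m≤n+m _ 1) (s≤s (size-∖< (∖⁺ c∈ c≢b)))) (size-∖< b∈)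

    not-nearer-self : ∀ {u x} → ¬ Nearer u x u
    not-nearer-self {u} n with trans (sym (d-refl u)) n
    ... | ()

    nearer-adjacent : ∀ {t x u} → t ~ u → Nearer t x u → t ≡ x
    nearer-adjacent tu n = d-zero (suc-injective (trans (sym n) tu))

    -- Deleting w′ alone would turn b into a leaf, whose edge is a bridge of the reduct but not of
    -- S. So b goes as well, and two new lines are needed: those of w w′ and of w′ y, with y from
    -- `third-nbr`.
    module Twin-nbrs {b w w′ a₁ a₂} (b∈ : b ∈ₛ S) (w∈ : w ∈ₛ S) (w′∈ : w′ ∈ₛ S) (a₁∈ : a₁ ∈ₛ S) (a₂∈ : a₂ ∈ₛ S)
      (w≢w′ : w ≢ w′) (wb : w ~ b) (w′b : w′ ~ b) (Nb : ∀ {t} → t ∈ₛ S → t ~ b → t ≡ w ⊎ t ≡ w′)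
      (dom : Dom S w w′) (dom′ : Dom S w′ w) (a₁w : a₁ ~ w) (a₂w : a₂ ~ w) (a₁≢b : a₁ ≢ b) (a₂≢b : a₂ ≢ b) (a₁≢a₂ : a₁ ≢ a₂) where

      dww′ : d w w′ ≡ 2
      dww′ = common-nbr⇒d2 wb w′b w≢w′
      open Twins iso w∈ w′∈ dom dom′ dww′
      w≢b = ~⇒≢ wb
      w′≢b = ~⇒≢ w′b

      dom-b : ∀ {x} → x ∈ₛ S → x ~ w → Dom S b x
      dom-b x∈ xw t∈ tb = [ (λ { refl → ~-sym xw }) , (λ { refl → ~-sym (dom x∈ xw) }) ]′ (Nb t∈ tb)

      -- Otherwise x and b are twins with neighbourhood {w, w′}, and a₁ or a₂ is the third vertex
      -- for `twins-⊥`.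
      third-nbr : ∀ {x} → x ∈ₛ S → x ~ w → x ≢ b → ¬ (∀ {y} → y ∈ₛ S → y ~ x → y ≢ w → y ≢ w′ → ⊥)
      third-nbr {x} x∈ xw x≢b none = via (a₁ ≟ᶠ x)
        where
        dom-x : ∀ {z} → z ∈ₛ S → z ~ w → Dom S x z
        dom-x z∈ zw t∈ tx = [ (λ { refl → ~-sym zw }) , (λ { refl → ~-sym (dom z∈ zw) }) ]′
          (case-≟ _ w λ t≢w → decidable-stable (_ ≟ᶠ w′) (none t∈ tx t≢w))
        twin : ∀ {a} → a ∈ₛ S → a ~ w → a ≢ b → a ≢ x → ⊥
        twin a∈ aw a≢b a≢x = twins-⊥ b∈ x∈ a∈ w∈ w′∈ (x≢b ∘ sym) a≢b a≢x (dom-b x∈ xw) (dom-x b∈ (~-sym wb)) (dom-b a∈ aw) w≢w′ wb w′b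
        via : Dec (a₁ ≡ x) → ⊥
        via (yes refl) = twin a₂∈ a₂w a₂≢b (a₁≢a₂ ∘ sym)
        via (no a₁≢x) = twin a₁∈ a₁w a₁≢b a₁≢x

      S₂ : Subset
      S₂ = S ∖ b ∖ w′
      in₂ : ∀ {x} → x ∈ₛ S → x ≢ b → x ≢ w′ → x ∈ₛ S₂
      in₂ x∈ p q = ∖⁺ (∖⁺ x∈ p) q
      out₂ : ∀ {x} → x ∈ₛ S₂ → x ∈ₛ S × x ≢ b × x ≢ w′
      out₂ x∈ = let (p , x≢w′) = ∖⁻ x∈ ; (q , x≢b) = ∖⁻ p in q , x≢b , x≢w′
      w∈₂ : w ∈ₛ S₂
      w∈₂ = in₂ w∈ w≢b w≢w′
      iso₁ : Isometric (S ∖ b)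
      iso₁ = isometric-∖ iso a₁∈ b∈ a₁≢b (dom-b a₁∈ a₁w)
      iso₂ : Isometric S₂
      iso₂ = isometric-∖ iso₁ (∖⁺ w∈ w≢b) (∖⁺ w′∈ w′≢b) w≢w′ (dom′ ∘ ∖-⊆)

      -- The deleted b and w′ touch the far side of w x at most in x, and `third-nbr` gives a vertex
      -- beyond x; so x would be a cut vertex of S.
      no-bridge : ∀ {x} → Bridge S₂ w x → ⊥
      no-bridge {x} B with out₂ (Bridge.v∈ B)
      ... | x∈ , x≢b , _ = third-nbr x∈ (~-sym (Bridge.edge B)) x≢b λ {y} y∈ yx y≢w y≢w′ →
        no-cut (bridge-cut (∖-⊆ ∘ ∖-⊆) B out (in₂ y∈ (λ { refl → nbrs≁ (~-sym (Bridge.edge B)) (~-sym wb) (~-sym yx) }) y≢w′) yx y≢w)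
        where
        out : ∀ {s t} → s ∈ₛ S → ¬ (s ∈ₛ S₂) → t ∈ₛ S₂ → Nearer t x w → t ≢ x → ¬ (t ~ s)
        out {s} {t} s∈ s∉ t∈ nt t≢x ts with ∖∖-covers {b} {w′} s∈ | out₂ t∈
        ... | inj₁ p | _ = s∉ p
        ... | inj₂ (inj₁ refl) | t∈S , _ , t≢w′ = [ (λ { refl → not-nearer-self nt }) , t≢w′ ]′ (Nb t∈S ts)
        ... | inj₂ (inj₂ refl) | t∈S , _ , _ = t≢x (nearer-adjacent (dom′ t∈S ts) nt)

      bridges : ∀ {u v} → Bridge S₂ u v → Bridge S u v
      bridges {u} {v} B = bridge-∖-dominated iso a₁∈ b∈ a₁≢b (dom-b a₁∈ a₁w)
        (bridge-∖-dominated iso₁ (∖⁺ w∈ w≢b) (∖⁺ w′∈ w′≢b) w≢w′ (dom′ ∘ ∖-⊆) B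
          (λ { (refl , _) → no-bridge B }) (λ { (refl , _) → no-bridge (bridge-swap B) }))
        (λ { (_ , vb) → at-b (Bridge.v∈ B) vb (bridge-swap B) }) (λ { (_ , ub) → at-b (Bridge.u∈ B) ub B })
        where
        at-b : ∀ {t x} → t ∈ₛ S₂ → t ~ b → Bridge S₂ t x → ⊥
        at-b t∈ tb B with out₂ t∈
        ... | t∈S , _ , t≢w′ = [ (λ { refl → no-bridge B }) , t≢w′ ]′ (Nb t∈S tb)

      new-ww′ : New S₂ S (w , w′)
      new-ww′ {c} {e} c∈ e∈ dce with out₂ c∈ | out₂ e∈ | c ~? w
      ... | c∈S , c≢b , c≢w′ | e∈S , _ , e≢w′ | no ¬cw = twin-line-unique c∈S e∈S dce
        (λ { (inj₁ (_ , q)) → e≢w′ (sym q) ; (inj₂ (_ , q)) → c≢w′ (sym q) }) (λ wc _ → ⊥-elim (¬cw (~-sym wc)))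
      ... | c∈S , c≢b , c≢w′ | e∈S , _ , e≢w′ | yes cw = λ L → third-nbr c∈S cw c≢b λ t∈ tc t≢w t≢w′ → twin-line-unique c∈S e∈S dce
        (λ { (inj₁ (_ , q)) → e≢w′ (sym q) ; (inj₂ (_ , q)) → c≢w′ (sym q) }) (λ _ _ → _ , t∈ , t≢w , t≢w′ , inj₁ tc) L

      twin-nbrs-⊥ : ⊥
      twin-nbrs-⊥ = third-nbr a₁∈ a₁w a₁≢b λ {y} y∈ ya₁ y≢w y≢w′ →
        let
          dw′y : d w′ y ≡ 2
          dw′y = common-nbr⇒d2 (~-sym (dom a₁∈ a₁w)) ya₁ (y≢w′ ∘ sym)
          dwy : d w y ≡ 2
          dwy = common-nbr⇒d2 (~-sym a₁w) ya₁ (y≢w ∘ sym)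
        in IH (size-∖∖ b∈ w′∈ w′≢b) iso₂
          (a₁ , a₂ , a₁∈₂ , in₂ a₂∈ a₂≢b (~⇒≢ (dom a₂∈ a₂w)) , common-nbr⇒d2 a₁w a₂w a₁≢a₂)
          (λ (_ , _ , _ , _ , K) → exc K) (λ (_ , _ , _ , _ , _ , K) → exc K)
          λ (T , le) → bad (good-from (∖-⊆ ∘ ∖-⊆) T (λ _ → bridges) ((w , w′) ∷ (w′ , y) ∷ [])
            ((w∈ , w′∈ , dww′) ∷ (w′∈ , y∈ , dw′y) ∷ [])
            ((separating′ {S} w∈ (on-self dww′) (d2-off (trans (d-sym w′ w) dww′) (trans (d-sym y w) dwy)) ∷ []) ∷ [] ∷ [])
            (new-ww′ ∷ (λ c∈ e∈ dce → split-twins y∈ dw′y y≢w (proj₁ (out₂ c∈)) (proj₁ (out₂ e∈)) dce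
                (proj₂ (proj₂ (out₂ c∈))) (proj₂ (proj₂ (out₂ e∈)))) ∷ [])
            (≤-trans size-∖≤ (s≤s (≤-trans size-∖≤ (s≤s le)))))
        where
        a₁∈₂ : a₁ ∈ₛ S₂
        a₁∈₂ = in₂ a₁∈ a₁≢b (~⇒≢ (dom a₁∈ a₁w))
        exc : ∀ {x₀ y₀ xs ys} → ¬ Biclique S₂ (x₀ ∷ xs) (y₀ ∷ ys)
        exc K = two-more-⊥ K w∈₂ (~-sym wb) a₁∈₂ (~-sym (dom a₁∈ a₁w)) (~-sym w′b) ∖∖-covers

    -- The neighbours of b are mutual twins. `twins-⊥` leaves only two of them, `Twin-nbrs` leaves
    -- these only one neighbour besides b, and the result is a C₄ attached at that neighbour.
    twin-nbrhood-⊥ : ∀ {b} → b ∈ₛ S → ¬ (∀ {w w′} → w ∈ₛ S → w′ ∈ₛ S → w ~ b → w′ ~ b → Dom S w w′)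
    twin-nbrhood-⊥ {b} b∈ twins with some-nbr b∈
    ... | w , w∈ , wb = another-nbr b∈ w∈ wb λ {w′} w′∈ w′b w′≢w → another-nbr w∈ b∈ (~-sym wb) λ {a₁} a₁∈ a₁w a₁≢b →
      let
        dom = twins w∈ w′∈ wb w′b
        dom′ = twins w′∈ w∈ w′b wb
        Nb : ∀ {t} → t ∈ₛ S → t ~ b → t ≡ w ⊎ t ≡ w′
        Nb {t} t∈ tb = case-≟ t w λ t≢w → decidable-stable (t ≟ᶠ w′) λ t≢w′ →
          twins-⊥ w∈ w′∈ t∈ b∈ a₁∈ (w′≢w ∘ sym) t≢w t≢w′ dom dom′ (twins w∈ t∈ wb tb) (a₁≢b ∘ sym) (~-sym wb) a₁w
        Nw : ∀ {t} → t ∈ₛ S → t ~ w → t ≡ b ⊎ t ≡ a₁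
        Nw {t} t∈ tw = case-≟ t b λ t≢b → decidable-stable (t ≟ᶠ a₁) λ t≢a₁ →
          Twin-nbrs.twin-nbrs-⊥ b∈ w∈ w′∈ a₁∈ t∈ (w′≢w ∘ sym) wb w′b Nb dom dom′ a₁w tw a₁≢b t≢b (t≢a₁ ∘ sym)
      in hanging-C₄-⊥ b∈ a₁∈ w∈ w′∈ (a₁≢b ∘ sym) (w′≢w ∘ sym) (~-sym wb) (~-sym w′b) a₁w (dom a₁∈ a₁w) Nb Nw (λ t∈ tw′ → Nw t∈ (dom′ t∈ tw′))

    -- Strict domination

    nbrs : V → Subset
    nbrs b = S ∩ λ t → t ~? b

    nbrs⁺ : ∀ {b t} → t ∈ₛ S → t ~ b → t ∈ₛ nbrs b
    nbrs⁺ = ∈∩⁺ (λ t → t ~? _)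

    nbrs⁻ : ∀ {b t} → t ∈ₛ nbrs b → t ∈ₛ S × t ~ b
    nbrs⁻ {b} = ∈∩⁻ (λ t → t ~? b)

    module Dominated {a b y₀} (a∈ : a ∈ₛ S) (b∈ : b ∈ₛ S) (y₀∈ : y₀ ∈ₛ S) (a≢b : a ≢ b) (dom : Dom S b a) (y₀a : y₀ ~ a) (¬y₀b : ¬ (y₀ ~ b))
      (minimal : ∀ {a′ b′ y} → size (nbrs b′) < size (nbrs b) → a′ ∈ₛ S → b′ ∈ₛ S → a′ ≢ b′ → Dom S b′ a′ → y ∈ₛ S → y ~ a′ → ¬ (y ~ b′) → ⊥) where

      iso₁ : Isometric (S ∖ b)
      iso₁ = isometric-∖ iso a∈ b∈ a≢b dom

      -- x and b have degree two, so a x b w is an ear parallel to the edge a w.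
      module Ear {x w z} (x∈ : x ∈ₛ S) (w∈ : w ∈ₛ S) (z∈ : z ∈ₛ S) (xb : x ~ b) (wb : w ~ b) (zw : z ~ w) (z≢a : z ≢ a) (z≢b : z ≢ b)
        (Nx : ∀ {t} → t ∈ₛ S → t ~ x → t ≡ a ⊎ t ≡ b) (Nb : ∀ {t} → t ∈ₛ S → t ~ b → t ≡ x ⊎ t ≡ w) where

        S₂ : Subset
        S₂ = S ∖ b ∖ x
        in₂ : ∀ {t} → t ∈ₛ S → t ≢ b → t ≢ x → t ∈ₛ S₂
        in₂ t∈ p q = ∖⁺ (∖⁺ t∈ p) q
        out₂ : ∀ {t} → t ∈ₛ S₂ → t ∈ₛ S × t ≢ b × t ≢ x
        out₂ t∈ = let (p , t≢x) = ∖⁻ t∈ ; (q , t≢b) = ∖⁻ p in q , t≢b , t≢x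
        x≢b = ~⇒≢ xb
        w≢b = ~⇒≢ wb
        xa : x ~ a
        xa = dom x∈ xb
        wa : w ~ a
        wa = dom w∈ wb
        w≢x : w ≢ x
        w≢x refl = [ z≢a , z≢b ]′ (Nx z∈ zw)
        z≢x : z ≢ x
        z≢x refl = nbrs≁ xb wb zw
        ¬zx : ¬ (x ~ z)
        ¬zx xz = [ z≢a , z≢b ]′ (Nx z∈ (~-sym xz))
        a∈₁ : a ∈ₛ S ∖ b
        a∈₁ = ∖⁺ a∈ a≢b
        x∈₁ : x ∈ₛ S ∖ b
        x∈₁ = ∖⁺ x∈ x≢b
        x-leaf : ∀ {t} → t ∈ₛ S ∖ b → t ~ x → t ≡ a
        x-leaf t∈ tx = let (t∈S , t≢b) = ∖⁻ t∈ in [ (λ e → e) , (λ e → ⊥-elim (t≢b e)) ]′ (Nx t∈S tx)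
        iso₂ : Isometric S₂
        iso₂ = isometric-∖ iso₁ (∖⁺ w∈ w≢b) x∈₁ w≢x λ t∈ tx → subst (_~ w) (sym (x-leaf t∈ tx)) (~-sym wa)

        -- The ear is a detour around a w, so this bridge would be lost in S. But the ear meets the
        -- side of w only in w, and z lies beyond: w would be a cut vertex of S.
        no-bridge : ¬ Bridge S₂ a w
        no-bridge B = no-cut (bridge-cut (∖-⊆ ∘ ∖-⊆) B out (in₂ z∈ z≢b z≢x) zw z≢a)
          where
          out : ∀ {s t} → s ∈ₛ S → ¬ (s ∈ₛ S₂) → t ∈ₛ S₂ → Nearer t w a → t ≢ w → ¬ (t ~ s)
          out {s} {t} s∈ s∉ t∈ nt t≢w ts with ∖∖-covers {b} {x} s∈ | out₂ t∈
          ... | inj₁ p | _ = s∉ p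
          ... | inj₂ (inj₁ refl) | t∈S , _ , t≢x = [ t≢x , t≢w ]′ (Nb t∈S ts)
          ... | inj₂ (inj₂ refl) | t∈S , t≢b , _ = [ (λ { refl → not-nearer-self nt }) , t≢b ]′ (Nx t∈S ts)

        bridges : ∀ {u v} → Bridge S₂ u v → Bridge S u v
        bridges B = bridge-∖-dominated iso a∈ b∈ a≢b dom (Leaf.bridge-∖-leaf iso₁ x∈₁ a∈₁ xa x-leaf B)
          (λ { (refl , vb) → other B vb }) (λ { (refl , ub) → other (bridge-swap B) ub })
          where
          other : ∀ {v} → Bridge S₂ a v → v ~ b → ⊥
          other B vb with out₂ (Bridge.v∈ B)
          ... | v∈ , _ , v≢x = [ v≢x , (λ { refl → no-bridge B }) ]′ (Nb v∈ vb)

        dbz : d b z ≡ 2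
        dbz = common-nbr⇒d2 (~-sym wb) zw (z≢b ∘ sym)
        dxy : d x y₀ ≡ 2
        dxy = common-nbr⇒d2 xa y₀a λ { refl → ¬y₀b xb }
        -- Neither neighbourhood contains the other: x is adjacent to b but not to z, and a second
        -- neighbour of z is neither x nor w, hence not adjacent to b.
        unique-bz : ∀ {c e} → c ∈ₛ S → e ∈ₛ S → d c e ≡ 2 → ¬ SamePair b z c e → ¬ SameLine S b z c e
        unique-bz c∈ e∈ dce = line-unique iso no-cut b∈ z∈ c∈ e∈ dbz dce (λ D → ¬zx (D x∈ xb))
          λ D → another-nbr z∈ w∈ (~-sym zw) λ t∈ tz t≢w → [ (λ { refl → ¬zx tz }) , t≢w ]′ (Nb t∈ (D t∈ tz))
        unique-xy : ∀ {c e} → c ∈ₛ S → e ∈ₛ S → d c e ≡ 2 → ¬ SamePair x y₀ c e → ¬ SameLine S x y₀ c e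
        unique-xy c∈ e∈ dce = line-unique iso no-cut x∈ y₀∈ c∈ e∈ dxy dce (λ D → ¬y₀b (~-sym (D b∈ (~-sym xb))))
          λ D → another-nbr y₀∈ a∈ (~-sym y₀a) λ t∈ ty t≢a → [ t≢a , (λ { refl → ¬y₀b (~-sym ty) }) ]′ (Nx t∈ (D t∈ ty))

        exc : ∀ {x₀ y₀ xs ys} → ¬ Biclique S₂ (x₀ ∷ xs) (y₀ ∷ ys)
        exc K = two-more-⊥ K (in₂ w∈ w≢b w≢x) (~-sym wb) (in₂ a∈ a≢b (~⇒≢ xa ∘ sym)) xa (~-sym xb) ∖∖-covers

        ear-⊥ : ⊥
        ear-⊥ = IH (size-∖∖ b∈ x∈ x≢b) iso₂
          (a , z , in₂ a∈ a≢b (~⇒≢ xa ∘ sym) , in₂ z∈ z≢b z≢x , common-nbr⇒d2 (~-sym wa) zw (z≢a ∘ sym))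
          (λ (_ , _ , _ , _ , K) → exc K) (λ (_ , _ , _ , _ , _ , K) → exc K)
          λ (T , le) → bad (good-from (∖-⊆ ∘ ∖-⊆) T (λ _ → bridges) ((b , z) ∷ (x , y₀) ∷ [])
            ((b∈ , z∈ , dbz) ∷ (x∈ , y₀∈ , dxy) ∷ [])
            ((unique-bz x∈ y₀∈ dxy (λ { (inj₁ (e , _)) → x≢b (sym e) ; (inj₂ (_ , e)) → z≢x e }) ∷ []) ∷ [] ∷ [])
            ( (λ c∈ e∈ dce → unique-bz (proj₁ (out₂ c∈)) (proj₁ (out₂ e∈)) dce
                (λ { (inj₁ (e , _)) → proj₁ (proj₂ (out₂ c∈)) (sym e) ; (inj₂ (e , _)) → proj₁ (proj₂ (out₂ e∈)) (sym e) }))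
            ∷ (λ c∈ e∈ dce → unique-xy (proj₁ (out₂ c∈)) (proj₁ (out₂ e∈)) dce
                (λ { (inj₁ (e , _)) → proj₂ (proj₂ (out₂ c∈)) (sym e) ; (inj₂ (e , _)) → proj₂ (proj₂ (out₂ e∈)) (sym e) })) ∷ [])
            (≤-trans size-∖≤ (s≤s (≤-trans size-∖≤ (s≤s le)))))

      -- By `twin-nbrhood-⊥` some neighbour w of b has a neighbour z besides a and b. Then w
      -- strictly dominates x, which has degree two, so by minimality b has degree two as well and
      -- `Ear` applies.
      ear-end-⊥ : ∀ {x} → x ∈ₛ S → x ~ b → ¬ (∀ {t} → t ∈ₛ S → t ~ x → t ≡ a ⊎ t ≡ b)
      ear-end-⊥ {x} x∈ xb Nx = twin-nbrhood-⊥ b∈ λ {w} {w′} w∈ w′∈ wb w′b {t} t∈ tw →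
        [ (λ { refl → ~-sym (dom w′∈ w′b) }) , (λ { refl → ~-sym w′b }) ]′
          (case-≟ t a λ t≢a → decidable-stable (t ≟ᶠ b) λ t≢b → wide w∈ wb t∈ tw t≢a t≢b)
        where
        wide : ∀ {w z} → w ∈ₛ S → w ~ b → z ∈ₛ S → z ~ w → z ≢ a → z ≢ b → ⊥
        wide {w} {z} w∈ wb z∈ zw z≢a z≢b = Ear.ear-⊥ x∈ w∈ z∈ xb wb zw z≢a z≢b Nx Nb
          where
          ¬zx : ¬ (z ~ x)
          ¬zx zx = [ z≢a , z≢b ]′ (Nx z∈ zx)
          w≢x : w ≢ x
          w≢x refl = ¬zx zw
          Nb : ∀ {t} → t ∈ₛ S → t ~ b → t ≡ x ⊎ t ≡ w
          Nb {t} t∈ tb = case-≟ t x λ t≢x → decidable-stable (t ≟ᶠ w) λ t≢w →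
            minimal (≤-trans (s≤s (size≤ {xs = a ∷ b ∷ []} λ s∈ → let (s∈S , sx) = nbrs⁻ s∈ in
                        [ here , there ∘ here ]′ (Nx s∈S sx)))
                      (size≥ {xs = x ∷ w ∷ t ∷ []} (((w≢x ∘ sym) ∷ (t≢x ∘ sym) ∷ []) ∷ ((t≢w ∘ sym) ∷ []) ∷ [] ∷ [])
                        (λ { (here refl) → nbrs⁺ x∈ xb ; (there (here refl)) → nbrs⁺ w∈ wb ; (there (there (here refl))) → nbrs⁺ t∈ tb })))
              w∈ x∈ w≢x (λ s∈ sx → [ (λ { refl → ~-sym (dom w∈ wb) }) , (λ { refl → ~-sym wb }) ]′ (Nx s∈ sx)) z∈ zw ¬zx

      -- Only an edge a x with x adjacent to b is in danger. If x has a neighbour besides a and b,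
      -- it would be a cut vertex of S; if not, `ear-end-⊥` applies.
      bridges : ∀ {u v} → Bridge (S ∖ b) u v → Bridge S u v
      bridges B = bridge-∖-dominated iso a∈ b∈ a≢b dom B (λ { (refl , vb) → at-a B vb }) (λ { (refl , ub) → at-a (bridge-swap B) ub })
        where
        at-a : ∀ {x} → Bridge (S ∖ b) a x → x ~ b → ⊥
        at-a {x} B xb = ear-end-⊥ (∖-⊆ (Bridge.v∈ B)) xb λ {t} t∈ tx → case-≟ t a λ t≢a → decidable-stable (t ≟ᶠ b) λ t≢b →
          no-cut (bridge-cut ∖-⊆ B out (∖⁺ t∈ t≢b) tx t≢a)
          where
          out : ∀ {s t} → s ∈ₛ S → ¬ (s ∈ₛ S ∖ b) → t ∈ₛ S ∖ b → Nearer t x a → t ≢ x → ¬ (t ~ s)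
          out s∈ s∉ t∈ nt t≢x ts with ∖-covers {b} s∈
          ... | inj₁ p = s∉ p
          ... | inj₂ refl = t≢x (nearer-adjacent (dom (∖-⊆ t∈) ts) nt)

      -- Trade b for the line of b and z, where z is adjacent to one neighbour w of b but not to
      -- another one, w′. Minimality enters in `¬zb`: if b dominated z, it would do so strictly, and
      -- z has smaller degree.
      dominated-⊥ : ⊥
      dominated-⊥ = twin-nbrhood-⊥ b∈ λ {w} {w′} w∈ w′∈ wb w′b {z} z∈ zw → decidable-stable (z ~? w′) λ ¬zw′ →
        let
          z≢b : z ≢ b
          z≢b = λ { refl → ¬zw′ (~-sym w′b) }
          dbz : d b z ≡ 2
          dbz = common-nbr⇒d2 (~-sym wb) zw (z≢b ∘ sym)
          ¬zb : ¬ Dom S z b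
          ¬zb D = minimal (size≥ {xs = w′ ∷ members (nbrs z)}
                      (All.tabulate (λ { p refl → ¬zw′ (~-sym (proj₂ (nbrs⁻ (members⁻ p)))) }) ∷ members-unique (nbrs z))
                      (λ { (here refl) → nbrs⁺ w′∈ w′b ; (there p) → let (t∈ , tz) = nbrs⁻ (members⁻ p) in nbrs⁺ t∈ (D t∈ tz) }))
                    b∈ z∈ (z≢b ∘ sym) D w′∈ w′b (¬zw′ ∘ ~-sym)
          exc : ∀ {x₀ y₀ xs ys} → ¬ Biclique (S ∖ b) (x₀ ∷ xs) (y₀ ∷ ys)
          exc K = one-more-⊥ K (∖⁺ w∈ (~⇒≢ wb)) (~-sym wb) ∖-covers
        in IH (size-∖< b∈) iso₁
          (a , z , ∖⁺ a∈ a≢b , ∖⁺ z∈ z≢b , common-nbr⇒d2 (~-sym (dom w∈ wb)) zw (λ { refl → ¬zw′ (~-sym (dom w′∈ w′b)) }))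
          (λ (_ , _ , _ , _ , K) → exc K) (λ (_ , _ , _ , _ , _ , K) → exc K)
          λ (T , le) → bad (good-from ∖-⊆ T (λ _ → bridges) ((b , z) ∷ []) ((b∈ , z∈ , dbz) ∷ []) ([] ∷ [])
            ((λ c∈ e∈ dce → line-unique iso no-cut b∈ z∈ (∖-⊆ c∈) (∖-⊆ e∈) dbz dce (λ D → ¬zw′ (~-sym (D w′∈ w′b))) ¬zb
               (λ { (inj₁ (e , _)) → proj₂ (∖⁻ c∈) (sym e) ; (inj₂ (e , _)) → proj₂ (∖⁻ e∈) (sym e) })) ∷ [])
            (≤-trans size-∖≤ (s≤s le)))

    no-strict-domination : ∀ {a b y} → a ∈ₛ S → b ∈ₛ S → a ≢ b → Dom S b a → y ∈ₛ S → y ~ a → ¬ (y ~ b) → ⊥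
    no-strict-domination = go _ ≤-refl
      where
      go : ∀ k {a b y} → size (nbrs b) < k → a ∈ₛ S → b ∈ₛ S → a ≢ b → Dom S b a → y ∈ₛ S → y ~ a → ¬ (y ~ b) → ⊥
      go (suc k) le a∈ b∈ a≢b dom y∈ ya ¬yb = Dominated.dominated-⊥ a∈ b∈ y∈ a≢b dom ya ¬yb λ lt → go k (≤-trans lt (≤-pred le))

    -- Pairs are now either incomparable, where `line-unique` applies, or twins. A repeated line of
    -- twins a, b comes from two of their neighbours c, e with no neighbours besides a and b; by
    -- `twins-⊥` these are all neighbours of a, against `twin-nbrhood-⊥`.
    absurd : ⊥
    absurd = all-lines-distinct-⊥ distinct
      where
      module _ {a b c e} (a∈ : a ∈ₛ S) (b∈ : b ∈ₛ S) (c∈ : c ∈ₛ S) (e∈ : e ∈ₛ S) (dab : d a b ≡ 2) (dce : d c e ≡ 2)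
        (¬same : ¬ SamePair a b c e) (L : SameLine S a b c e) where
        twins : Dom S a b → Dom S b a → ⊥
        twins ab ba with c ~? a | e ~? a
        ... | no ¬ca | _ = twin-line-unique c∈ e∈ dce ¬same (λ ac _ → ⊥-elim (¬ca (~-sym ac))) L
          where open Twins iso a∈ b∈ ab ba dab
        ... | _ | no ¬ea = twin-line-unique c∈ e∈ dce ¬same (λ _ ae → ⊥-elim (¬ea (~-sym ae))) L
          where open Twins iso a∈ b∈ ab ba dab
        ... | yes ca | yes ea = twin-nbrhood-⊥ a∈ λ {u} {u′} u∈ u′∈ ua u′a t∈ tu →
          [ (λ { refl → ~-sym u′a }) , (λ { refl → ~-sym (ab u′∈ u′a) }) ]′ (nbr-of (Na u∈ ua) t∈ tu)
          where
          open Twins iso a∈ b∈ ab ba dab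
          nbr-of : ∀ {u t} → u ≡ c ⊎ u ≡ e → t ∈ₛ S → t ~ u → t ≡ a ⊎ t ≡ b
          nbr-of {u} {t} u≡ t∈ tu = case-≟ t a λ t≢a → decidable-stable (t ≟ᶠ b) λ t≢b →
            twin-line-unique c∈ e∈ dce ¬same (λ _ _ → t , t∈ , t≢a , t≢b , [ (λ { refl → inj₁ tu }) , (λ { refl → inj₂ tu }) ]′ u≡) L
          dom : ∀ {u u′} → u ≡ c ⊎ u ≡ e → u′ ∈ₛ S → u′ ~ a → Dom S u u′
          dom u≡ u′∈ u′a t∈ tu = [ (λ { refl → ~-sym u′a }) , (λ { refl → ~-sym (ab u′∈ u′a) }) ]′ (nbr-of u≡ t∈ tu)
          Na : ∀ {u} → u ∈ₛ S → u ~ a → u ≡ c ⊎ u ≡ e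
          Na {u} u∈ ua = case-≟ u c λ u≢c → decidable-stable (u ≟ᶠ e) λ u≢e →
            twins-⊥ c∈ e∈ u∈ a∈ b∈ (d2⇒≢ dce) u≢c u≢e (dom (inj₁ refl) e∈ ea) (dom (inj₂ refl) c∈ ca) (dom (inj₁ refl) u∈ ua)
              (d2⇒≢ dab) (~-sym ca) (~-sym (ab c∈ ca))
        reverse : ∀ {p q} → p ∈ₛ S → q ∈ₛ S → p ≢ q → Dom S p q → Dom S q p
        reverse {p} {q} p∈ q∈ p≢q pq {t} t∈ tq = decidable-stable (t ~? p) λ ¬tp → no-strict-domination q∈ p∈ (p≢q ∘ sym) pq t∈ tq ¬tp
        distinct′ : ⊥
        distinct′ = line-unique iso no-cut a∈ b∈ c∈ e∈ dab dce
          (λ ab → twins ab (reverse a∈ b∈ (d2⇒≢ dab) ab)) (λ ba → twins (reverse b∈ a∈ (d2⇒≢ dab ∘ sym) ba) ba) ¬same L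
      distinct : ∀ {a b c e} → a ∈ₛ S → b ∈ₛ S → c ∈ₛ S → e ∈ₛ S → d a b ≡ 2 → d c e ≡ 2 → ¬ SamePair a b c e → ¬ SameLine S a b c e
      distinct a∈ b∈ c∈ e∈ dab dce ¬same L = distinct′ a∈ b∈ c∈ e∈ dab dce ¬same L

  all-good : ∀ k {S} → size S ≤ k → Isometric S → HasPair S → ¬ IsC₄ S → ¬ IsK₂₃ S → ¬ ¬ Good S
  all-good zero {S} le _ (x , _ , x∈ , _) _ _ _ with ≤-trans (size≥ {S} {x ∷ []} ([] ∷ []) (λ { (here refl) → x∈ })) le
  ... | ()
  all-good (suc k) le iso pair ¬e4 ¬e5 bad = Step.absurd iso pair ¬e4 ¬e5 (λ lt → all-good k (≤-pred (≤-trans lt le))) bad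

-- The metric of a connected bipartite graph

does⁺ : {A : Set} (A? : Dec A) → A → T (does A?)
does⁺ (yes _) _ = tt
does⁺ (no ¬a) a = ¬a a

does⁻ : {A : Set} (A? : Dec A) → T (does A?) → A
does⁻ (yes a) _ = a

module _ {n : ℕ} (a : Fin n → Fin n → Bool) where

  -- A record, because `reach` computes and would hide the length and the ends from unification.
  record Walk (k : ℕ) (x y : Fin n) : Set where
    constructor walk
    field holds : T (reach a k x y)

  walk-refl : ∀ {x} → Walk 0 x x
  walk-refl {x} = walk (does⁺ (x ≟ᶠ x) refl)

  walk-zero : ∀ {x y} → Walk 0 x y → x ≡ y
  walk-zero {x} {y} (walk r) = does⁻ (x ≟ᶠ y) r

  walk-weaken : ∀ {k x y} → Walk k x y → Walk (suc k) x y
  walk-weaken (walk r) = walk (Equivalence.from T-∨ (inj₁ r))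

  walk-extend : ∀ {k x y z} → Walk k x y → T (a y z) → Walk (suc k) x z
  walk-extend {y = y} (walk r) e = walk (Equivalence.from T-∨ (inj₂ (any⁺ _ (lose (∈-allFin y) (Equivalence.from T-∧ (r , e))))))

  walk-last : ∀ {k x z} → Walk (suc k) x z → Walk k x z ⊎ ∃ λ y → Walk k x y × T (a y z)
  walk-last (walk r) with Equivalence.to T-∨ r
  ... | inj₁ s = inj₁ (walk s)
  ... | inj₂ s with find (any⁻ _ (allFin n) s)
  ...   | y , _ , t = let (r′ , e) = Equivalence.to T-∧ t in inj₂ (y , walk r′ , e)

  walk-trans : ∀ {k} l {x y z} → Walk k x y → Walk l y z → Walk (l + k) x z
  walk-trans zero r s = subst (Walk _ _) (walk-zero s) r
  walk-trans (suc l) r s with walk-last s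
  ... | inj₁ s′ = walk-weaken (walk-trans l r s′)
  ... | inj₂ (w , s′ , e) = walk-extend (walk-trans l r s′) e

  walk-sym : (∀ x y → a x y ≡ a y x) → ∀ k {x y} → Walk k x y → Walk k y x
  walk-sym a-sym zero r with walk-zero r
  ... | refl = r
  walk-sym a-sym (suc k) {x} {y} r with walk-last r
  ... | inj₁ s = walk-weaken (walk-sym a-sym k s)
  ... | inj₂ (w , s , e) = subst (λ m → Walk m y x) (+-comm k 1)
    (walk-trans k (walk-extend walk-refl (subst T (a-sym w y) e)) (walk-sym a-sym k s))

  distFrom-≤ : ∀ k f {x y j} → k ≤ j → Walk j x y → distFrom a k f x y ≤ j
  distFrom-≤ k zero le r = le
  distFrom-≤ k (suc f) {x} {y} {j} le r with reach a k x y in eq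
  ... | true = le
  ... | false = distFrom-≤ (suc k) f (≤∧≢⇒< le λ { refl → subst T eq (Walk.holds r) }) r

  -- The hypothesis covers the fallback value too: when the fuel is spent, it provides a walk for
  -- the returned `k`.
  distFrom-walk : ∀ k f {x y} → Walk (f + k) x y → Walk (distFrom a k f x y) x y
  distFrom-walk k zero r = r
  distFrom-walk k (suc f) {x} {y} r with reach a k x y in eq
  ... | true = walk (Equivalence.from T-≡ eq)
  ... | false = distFrom-walk (suc k) f (subst (λ m → Walk m x y) (sym (+-suc f k)) r)

module _ {n : ℕ} (G : Graph n) (connected : Connected G) (bipartite : Bipartite G) where

  private
    δ : Fin n → Fin n → ℕ
    δ = dist G

    δ-walk : ∀ x y → Walk (adj G) (δ x y) x y
    δ-walk x y = distFrom-walk (adj G) 0 n (subst (λ m → Walk (adj G) m x y) (sym (+-identityʳ n)) (walk (connected x y)))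

    δ-≤ : ∀ {x y} j → Walk (adj G) j x y → δ x y ≤ j
    δ-≤ j = distFrom-≤ (adj G) 0 n z≤n

    δ-refl : ∀ x → δ x x ≡ 0
    δ-refl x with δ x x | δ-≤ {x} 0 (walk-refl (adj G))
    ... | zero | _ = refl

    δ-zero : ∀ {x y} → δ x y ≡ 0 → x ≡ y
    δ-zero {x} {y} e = walk-zero (adj G) (subst (λ m → Walk (adj G) m x y) e (δ-walk x y))

    δ-sym : ∀ x y → δ x y ≡ δ y x
    δ-sym x y = ≤-antisym (δ-≤ _ (walk-sym (adj G) (Graph.sym G) _ (δ-walk y x))) (δ-≤ _ (walk-sym (adj G) (Graph.sym G) _ (δ-walk x y)))

    δ-triangle : ∀ x y z → δ x z ≤ δ x y + δ y z
    δ-triangle x y z = ≤-trans (δ-≤ _ (walk-trans (adj G) (δ y z) (δ-walk x y) (δ-walk y z))) (≤-reflexive (+-comm (δ y z) (δ x y)))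

    adj⇒δ : ∀ {x y} → T (adj G x y) → δ x y ≡ 1
    adj⇒δ {x} {y} e with δ x y in eq | δ-≤ 1 (walk-extend (adj G) (walk-refl (adj G)) e)
    ... | suc zero | _ = refl
    ... | suc (suc _) | s≤s ()
    ... | zero | _ with δ-zero eq
    ...   | refl = ⊥-elim (subst T (irrefl G x) e)

    δ⇒adj : ∀ {x y} → δ x y ≡ 1 → T (adj G x y)
    δ⇒adj {x} {y} e with walk-last (adj G) (subst (λ m → Walk (adj G) m x y) e (δ-walk x y))
    ... | inj₁ r with walk-zero (adj G) r
    ...   | refl = ⊥-elim (lem (trans (sym e) (δ-refl x)))
      where
      lem : ¬ (1 ≡ 0)
      lem ()
    δ⇒adj {x} {y} e | inj₂ (z , r , a) with walk-zero (adj G) r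
    ...   | refl = a

    δ-step : ∀ {x y k} → δ x y ≡ suc k → ∃ λ z → δ x z ≡ 1 × δ z y ≡ k
    δ-step {x} {y} {k} e with walk-last (adj G) (subst (λ m → Walk (adj G) m y x) (trans (δ-sym y x) e) (δ-walk y x))
    ... | inj₁ r = ⊥-elim (n≮n k (≤-trans (≤-reflexive (trans (sym e) (δ-sym x y))) (δ-≤ k r)))
    ... | inj₂ (z , r , a) = z , xz , ≤-antisym (≤-trans (≤-reflexive (δ-sym z y)) (δ-≤ k r))
            (≤-pred (≤-trans (≤-reflexive (sym e)) (≤-trans (δ-triangle x z y) (≤-reflexive (cong (_+ δ z y) xz)))))
      where
      xz = adj⇒δ (subst T (Graph.sym G z x) a)

    toggle : ℕ → Bool → Bool
    toggle zero b = b
    toggle (suc k) b = toggle k (not b)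

    colour = proj₁ bipartite

    adj⇒not : ∀ {x y} → δ x y ≡ 1 → colour y ≡ not (colour x)
    adj⇒not {x} {y} e = Boolₚ.¬-not (proj₂ bipartite x y (δ⇒adj e) ∘ sym)

    colour-δ : ∀ k {x y} → δ x y ≡ k → colour y ≡ toggle k (colour x)
    colour-δ zero e with δ-zero e
    ... | refl = refl
    colour-δ (suc k) e with δ-step e
    ... | z , xz , zy = trans (colour-δ k zy) (cong (toggle k) (adj⇒not xz))

    -- The distances from x to adjacent vertices differ by at most 1, and if they were equal,
    -- `colour-δ` would give both ends the same colour.
    δ-alternates : ∀ {u v} → δ u v ≡ 1 → ∀ x → δ x v ≡ suc (δ x u) ⊎ δ x u ≡ suc (δ x v)
    δ-alternates {u} {v} uv x = lem (δ x u) (δ x v)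
      (≤-trans (δ-triangle x u v) (≤-reflexive (trans (cong (δ x u +_) uv) (+-comm (δ x u) 1))))
      (≤-trans (δ-triangle x v u) (≤-reflexive (trans (cong (δ x v +_) (trans (δ-sym v u) uv)) (+-comm (δ x v) 1))))
      λ e → Boolₚ.not-¬ refl (trans (colour-δ _ refl) (trans (cong (λ k → toggle k (colour x)) e) (trans (sym (colour-δ _ refl)) (adj⇒not uv))))
      where
      lem : ∀ p q → q ≤ suc p → p ≤ suc q → p ≢ q → q ≡ suc p ⊎ p ≡ suc q
      lem zero zero _ _ n = ⊥-elim (n refl)
      lem zero (suc zero) _ _ _ = inj₁ refl
      lem zero (suc (suc q)) (s≤s ()) _ _
      lem (suc zero) zero _ _ _ = inj₂ refl
      lem (suc (suc p)) zero _ (s≤s ()) _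
      lem (suc p) (suc q) (s≤s a) (s≤s b) n with lem p q a b (n ∘ cong suc)
      ... | inj₁ e = inj₁ (cong suc e)
      ... | inj₂ e = inj₂ (cong suc e)

  metric : BipartiteMetric n
  metric = record
    { d = δ ; d-refl = δ-refl ; d-zero = δ-zero ; d-sym = δ-sym ; d-triangle = δ-triangle ; d-step = δ-step ; d-alternates = δ-alternates }

  open Metric metric

  full : Subset
  full _ = true

  all∈ : ∀ {x} → x ∈ₛ full
  all∈ = mem refl

  full-isometric : Isometric full
  full-isometric {x} {y} _ _ x≢y with δ x y in eq
  ... | zero = ⊥-elim (x≢y (δ-zero eq))
  ... | suc k with δ-step eq
  ...   | z , xz , zy = z , all∈ , xz , trans (δ-sym y x) (trans eq (cong suc (trans (sym zy) (δ-sym z y))))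

  far-pair : ∀ {x y k} → δ x y ≡ suc (suc k) → HasPair full
  far-pair {x} e with δ-step e
  ... | u , xu , uy with δ-step uy
  ...   | v , uv , vy = x , v , all∈ , all∈ , common-nbr⇒d2 xu (~-sym uv) λ { refl → lem (trans (sym vy) e) }
    where
    lem : ∀ {k} → k ≡ suc (suc k) → ⊥
    lem ()

  -- There is no triangle, so one of the three distances is at least 2, and a geodesic then contains
  -- vertices at distance exactly 2.
  full-pair : ∀ {x y z} → x ≢ y → y ≢ z → x ≢ z → HasPair full
  full-pair {x} {y} {z} x≢y y≢z x≢z with δ x y in xy | δ y z in yz | δ x z in xz
  ... | zero | _ | _ = ⊥-elim (x≢y (δ-zero xy))
  ... | _ | zero | _ = ⊥-elim (y≢z (δ-zero yz))
  ... | _ | _ | zero = ⊥-elim (x≢z (δ-zero xz))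
  ... | suc zero | suc zero | suc zero = ⊥-elim (nbrs≁ xz yz xy)
  ... | suc (suc k) | _ | _ = far-pair xy
  ... | _ | suc (suc k) | _ = far-pair yz
  ... | _ | _ | suc (suc k) = far-pair xz

  -- Recognising the exceptional graphs

  biclique-iso : ∀ {x₀ y₀ xs ys} → Biclique full (x₀ ∷ xs) (y₀ ∷ ys) → (vs : List (Fin n)) → Unique vs → (∀ v → v ∈ vs) →
    (s : Fin (length vs) → Bool) → (∀ i → s i ≡ true × lookup vs i ∈ x₀ ∷ xs ⊎ s i ≡ false × lookup vs i ∈ y₀ ∷ ys) → G ≅ sideGraph s
  biclique-iso {x₀} {y₀} {xs} {ys} K vs u all s side = mk↔ₛ′ to (lookup vs) to-from from-to , λ x y →
      trans (cong₂ (adj G) (sym (from-to x)) (sym (from-to y))) (edges (to x) (to y))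
    where
    open Biclique K
    to : Fin n → Fin (length vs)
    to v = index (all v)
    from-to : ∀ v → lookup vs (to v) ≡ v
    from-to v = sym (lookup-index (all v))
    to-from : ∀ i → to (lookup vs i) ≡ i
    to-from i = lookup-injective u _ _ (from-to _)
    yes-edge : ∀ {x y} → x ~ y → adj G x y ≡ true
    yes-edge e = Equivalence.to T-≡ (δ⇒adj e)
    no-edge : ∀ {x y} → ¬ (x ~ y) → adj G x y ≡ false
    no-edge ¬e = Boolₚ.¬-not (¬e ∘ adj⇒δ ∘ Equivalence.from T-≡)
    edges : ∀ i j → adj G (lookup vs i) (lookup vs j) ≡ s i xor s j
    edges i j with side i | side j
    ... | inj₁ (e , p) | inj₁ (e′ , q) rewrite e | e′ = no-edge (nbrs≁ (joined p (here refl)) (joined q (here refl)))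
    ... | inj₂ (e , p) | inj₂ (e′ , q) rewrite e | e′ = no-edge (nbrs≁ (~-sym (joined (here refl) p)) (~-sym (joined (here refl) q)))
    ... | inj₁ (e , p) | inj₂ (e′ , q) rewrite e | e′ = yes-edge (joined p q)
    ... | inj₂ (e , p) | inj₁ (e′ , q) rewrite e | e′ = yes-edge (~-sym (joined q p))

  -- The classes alternate in the list because the sides of `C4` are the even and the odd numbers.
  isC₄⇒C4 : IsC₄ full → G ≅ C4
  isC₄⇒C4 (x₁ , x₂ , y₁ , y₂ , K) = biclique-iso K (x₁ ∷ y₁ ∷ x₂ ∷ y₂ ∷ [])
    ((across (here refl) (here refl) ∷ lk xs-unique ∷ across (here refl) (there (here refl)) ∷ [])
      ∷ ((across (there (here refl)) (here refl) ∘ sym) ∷ lk ys-unique ∷ []) ∷ (across (there (here refl)) (there (here refl)) ∷ []) ∷ [] ∷ [])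
    (λ v → place (cover all∈)) (λ i → toℕ i % 2 ≡ᵇ 0)
    λ { Fin.zero → inj₁ (refl , here refl) ; (Fin.suc Fin.zero) → inj₂ (refl , here refl)
      ; (Fin.suc (Fin.suc Fin.zero)) → inj₁ (refl , there (here refl)) ; (Fin.suc (Fin.suc (Fin.suc Fin.zero))) → inj₂ (refl , there (here refl)) }
    where
    open Biclique K
    across : ∀ {x y} → x ∈ x₁ ∷ x₂ ∷ [] → y ∈ y₁ ∷ y₂ ∷ [] → x ≢ y
    across p q = ~⇒≢ (joined p q)
    lk : ∀ {a b : Fin n} → Unique (a ∷ b ∷ []) → a ≢ b
    lk ((a≢b ∷ []) ∷ _) = a≢b
    place : ∀ {v} → v ∈ x₁ ∷ x₂ ∷ [] ⊎ v ∈ y₁ ∷ y₂ ∷ [] → v ∈ x₁ ∷ y₁ ∷ x₂ ∷ y₂ ∷ []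
    place (inj₁ (here e)) = here e
    place (inj₁ (there (here e))) = there (there (here e))
    place (inj₂ (here e)) = there (here e)
    place (inj₂ (there (here e))) = there (there (there (here e)))

  isK₂₃⇒K23 : IsK₂₃ full → G ≅ K23
  isK₂₃⇒K23 (x₁ , x₂ , y₁ , y₂ , y₃ , K) = biclique-iso K (x₁ ∷ x₂ ∷ y₁ ∷ y₂ ∷ y₃ ∷ [])
    (AllPairs-++⁺ xs-unique ys-unique (All.tabulate λ p → All.tabulate λ q → ~⇒≢ (joined p q)))
    (λ v → place (cover all∈)) (λ i → toℕ i <ᵇ 2)
    λ { Fin.zero → inj₁ (refl , here refl) ; (Fin.suc Fin.zero) → inj₁ (refl , there (here refl))
      ; (Fin.suc (Fin.suc Fin.zero)) → inj₂ (refl , here refl) ; (Fin.suc (Fin.suc (Fin.suc Fin.zero))) → inj₂ (refl , there (here refl))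
      ; (Fin.suc (Fin.suc (Fin.suc (Fin.suc Fin.zero)))) → inj₂ (refl , there (there (here refl))) }
    where
    open Biclique K
    place : ∀ {v} → v ∈ x₁ ∷ x₂ ∷ [] ⊎ v ∈ y₁ ∷ y₂ ∷ y₃ ∷ [] → v ∈ x₁ ∷ x₂ ∷ y₁ ∷ y₂ ∷ y₃ ∷ []
    place (inj₁ (here e)) = here e
    place (inj₁ (there (here e))) = there (here e)
    place (inj₂ q) = there (there q)

  -- From tokens to the numbers of lines and bridges

  ∈-pairs : ∀ x y → (x , y) ∈ pairs
  ∈-pairs x y = ∈-concatMap⁺ (λ x → map (x ,_) (allFin n)) (lose (∈-allFin x) (∈-map⁺ (x ,_) (∈-allFin y)))

  entry : ∀ x y z → Bool
  entry x y z = (δ x y ≡ᵇ (δ x z + δ z y)) ∨ (δ x y ≡ᵇ ∣ δ x z - δ z y ∣)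

  -- With both distances equal to k, the sum is 2 only for k = 1, and the difference is 0.
  off⇒entry : ∀ {a b z} → δ a b ≡ 2 → NotOnLine a b z → entry a b z ≡ false
  off⇒entry {a} {b} {z} dab (e , ¬1) rewrite dab | δ-sym z b | sym e | ∣n-n∣≡0 (δ a z) = lem (δ a z) ¬1
    where
    lem : ∀ k → k ≢ 1 → (2 ≡ᵇ (k + k)) ∨ false ≡ false
    lem zero _ = refl
    lem (suc zero) n = ⊥-elim (n refl)
    lem (suc (suc k)) _ rewrite +-suc k (suc k) = refl

  on⇒entry : ∀ {a b z} → δ a b ≡ 2 → ¬ NotOnLine a b z → entry a b z ≡ true
  on⇒entry {a} {b} {z} dab on with position dab z
  ... | off o = ⊥-elim (on o)
  ... | mid az bz rewrite dab | δ-sym z b | az | bz = refl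
  ... | near₁ m rewrite dab | δ-sym z b | m = gap (δ a z)
    where
    gap : ∀ k → (2 ≡ᵇ (k + (2 + k))) ∨ (2 ≡ᵇ ∣ k - 2 + k ∣) ≡ true
    gap k = trans (cong ((2 ≡ᵇ (k + (2 + k))) ∨_) (diff k)) (Boolₚ.∨-zeroʳ _)
      where
      diff : ∀ k → (2 ≡ᵇ ∣ k - 2 + k ∣) ≡ true
      diff zero = refl
      diff (suc k) = diff k
  ... | near₂ m rewrite dab | δ-sym z b | m = gap (δ b z)
    where
    gap : ∀ k → (2 ≡ᵇ (2 + k + k)) ∨ (2 ≡ᵇ ∣ 2 + k - k ∣) ≡ true
    gap k = trans (cong ((2 ≡ᵇ (2 + k + k)) ∨_) (diff k)) (Boolₚ.∨-zeroʳ _)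
      where
      diff : ∀ k → (2 ≡ᵇ ∣ 2 + k - k ∣) ≡ true
      diff zero = refl
      diff (suc k) = diff k

  same-vector : ∀ {a b c e} → δ a b ≡ 2 → δ c e ≡ 2 → line G a b ≡ line G c e → SameLine full a b c e
  same-vector {a} {b} {c} {e} dab dce eq {z} _ = transfer dab dce entries , transfer dce dab (sym entries)
    where
    entries : entry a b z ≡ entry c e z
    entries = trans (sym (Vecₚ.lookup∘tabulate (entry a b) z)) (trans (cong (λ v → lookupᵛ v z) eq) (Vecₚ.lookup∘tabulate (entry c e) z))
    off? : ∀ p q → Dec (NotOnLine p q z)
    off? p q = (δ p z ≟ δ q z) ×-dec ¬? (δ p z ≟ 1)
    transfer : ∀ {a b c e} → δ a b ≡ 2 → δ c e ≡ 2 → entry a b z ≡ entry c e z → NotOnLine a b z → NotOnLine c e z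
    transfer {a} {b} {c} {e} dab dce eq o with off? c e
    ... | yes o′ = o′
    ... | no on with trans (sym (off⇒entry dab o)) (trans eq (on⇒entry dce on))
    ...   | ()

  lines≤ℓ₂ : (ps : List (Fin n × Fin n)) → All (LinePair full) ps → AllPairs (DistinctLines full) ps → length ps ≤ ℓ₂ G
  lines≤ℓ₂ ps val dis = ≤-trans (≤-reflexive (sym (length-map vector ps))) (unique-⊆⇒length≤
      (AllPairs-map⁺ (AllPairs-strengthen (λ (_ , _ , dab) (_ , _ , dce) D eq → D (same-vector dab dce eq)) val dis)) inside)
    where
    vector : Fin n × Fin n → _
    vector (a , b) = line G a b
    inside : ∀ {v} → v ∈ map vector ps → _
    inside v∈ with ∈-map⁻ vector v∈
    ... | (a , b) , p∈ , refl = ∈-deduplicate⁺ (Vecₚ.≡-dec Boolₚ._≟_) (∈-map⁺ vector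
      (∈-filter⁺ (T? ∘ λ p → dist G (proj₁ p) (proj₂ p) ≡ᵇ 2) (∈-pairs a b) (≡⇒≡ᵇ (δ a b) 2 (proj₂ (proj₂ (All.lookup val p∈))))))

  -- A walk from u that avoids the edge uv stays nearer to u, since by `only` no other edge crosses;
  -- so it never reaches v.
  bridge⇒isBridge : ∀ {u v} → Bridge full u v → T (isBridge G u v)
  bridge⇒isBridge {u} {v} B = Equivalence.from T-∧ (δ⇒adj (Bridge.edge B) , ¬T⇒T-not λ r → not-far (stays n (walk r)))
    where
    ¬T⇒T-not : ∀ {b} → ¬ T b → T (not b)
    ¬T⇒T-not {true} f = ⊥-elim (f tt)
    ¬T⇒T-not {false} _ = tt
    not-far : ¬ Nearer v u v
    not-far e with trans (sym (δ-refl v)) e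
    ... | ()
    stays : ∀ k {x} → Walk (removeEdge G u v) k u x → Nearer x u v
    stays zero r with walk-zero (removeEdge G u v) r
    ... | refl = trans (Bridge.edge B) (cong suc (sym (δ-refl u)))
    stays (suc k) {x} r with walk-last (removeEdge G u v) r
    ... | inj₁ s = stays k s
    ... | inj₂ (z , s , e) with Equivalence.to T-∧ e | δ-alternates (Bridge.edge B) x
    ...   | _ | inj₁ near = near
    ...   | zx , kept | inj₂ far with Bridge.only B all∈ all∈ (adj⇒δ zx) (stays k s) far
    ...     | refl , refl = ⊥-elim (removed (u ≟ᶠ u) (v ≟ᶠ v) kept)
      where
      removed : ∀ {c} (p : Dec (u ≡ u)) (q : Dec (v ≡ v)) → ¬ T (not ((does p ∧ does q) ∨ c))
      removed (yes _) (yes _) ()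
      removed (no ¬p) _ _ = ¬p refl
      removed _ (no ¬q) _ = ¬q refl

  -- `br` counts an edge with its smaller end first, while a token may carry either orientation;
  -- `orient` reconciles them.
  bridges≤br : (ps : List (Fin n × Fin n)) → All (λ (u , v) → Bridge full u v) ps →
    AllPairs (λ (u , v) (u′ , v′) → ¬ SamePair u v u′ v′) ps → length ps ≤ br G
  bridges≤br ps val dis = ≤-trans (≤-reflexive (sym (length-map orient ps))) (unique-⊆⇒length≤
      (AllPairs-map⁺ (AllPairs-strengthen {P = λ _ → ⊤} (λ {p} {q} _ _ D eq → D (same p q eq)) (All.tabulate λ _ → tt) dis)) inside)
    where
    orient : Fin n × Fin n → Fin n × Fin n
    orient (u , v) with toℕ u <? toℕ v
    ... | yes _ = u , v
    ... | no _ = v , u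
    same : ∀ p q → orient p ≡ orient q → SamePair (proj₁ p) (proj₂ p) (proj₁ q) (proj₂ q)
    same (u , v) (u′ , v′) eq with toℕ u <? toℕ v | toℕ u′ <? toℕ v′ | eq
    ... | yes _ | yes _ | refl = inj₁ (refl , refl)
    ... | yes _ | no _ | refl = inj₂ (refl , refl)
    ... | no _ | yes _ | refl = inj₂ (refl , refl)
    ... | no _ | no _ | refl = inj₁ (refl , refl)
    P? : ∀ (p : Fin n × Fin n) → Dec (T ((toℕ (proj₁ p) <ᵇ toℕ (proj₂ p)) ∧ isBridge G (proj₁ p) (proj₂ p)))
    P? p = T? ((toℕ (proj₁ p) <ᵇ toℕ (proj₂ p)) ∧ isBridge G (proj₁ p) (proj₂ p))
    ok : ∀ {u v} → Bridge full u v → orient (u , v) ∈ filter P? pairs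
    ok {u} {v} B with toℕ u <? toℕ v
    ... | yes u<v = ∈-filter⁺ P? (∈-pairs u v) (Equivalence.from T-∧ (<⇒<ᵇ u<v , bridge⇒isBridge B))
    ... | no u≮v = ∈-filter⁺ P? (∈-pairs v u) (Equivalence.from T-∧
          (<⇒<ᵇ (≤∧≢⇒< (≮⇒≥ u≮v) λ e → ~⇒≢ (Bridge.edge B) (sym (toℕ-injective e))) , bridge⇒isBridge (bridge-swap B)))
    inside : ∀ {q} → q ∈ map orient ps → q ∈ filter P? pairs
    inside q∈ with ∈-map⁻ orient q∈
    ... | (u , v) , p∈ , refl = ok (All.lookup val p∈)

  record Sorted (ts : List Token) : Set where
    field
      ls bs : List (Fin n × Fin n)
      total : length ts ≡ length ls + length bs
      ls-in : ∀ {a b} → (a , b) ∈ ls → lineToken a b ∈ ts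
      bs-in : ∀ {u v} → (u , v) ∈ bs → bridgeToken u v ∈ ts
      ls-distinct : AllPairs (DistinctLines full) ls
      bs-distinct : AllPairs (λ (u , v) (u′ , v′) → ¬ SamePair u v u′ v′) bs

  sort : ∀ {ts} → AllPairs (Distinct full) ts → Sorted ts
  sort [] = record { ls = [] ; bs = [] ; total = refl ; ls-in = λ () ; bs-in = λ () ; ls-distinct = [] ; bs-distinct = [] }
  sort {lineToken a b ∷ ts} (new ∷ dis) = record
    { ls = (a , b) ∷ ls ; bs = bs ; total = cong suc total
    ; ls-in = λ { (here refl) → here refl ; (there p) → there (ls-in p) } ; bs-in = there ∘ bs-in
    ; ls-distinct = All.tabulate (λ p → All.lookup new (ls-in p)) ∷ ls-distinct ; bs-distinct = bs-distinct }
    where open Sorted (sort dis)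
  sort {bridgeToken u v ∷ ts} (new ∷ dis) = record
    { ls = ls ; bs = (u , v) ∷ bs ; total = trans (cong suc total) (sym (+-suc (length ls) (length bs)))
    ; ls-in = there ∘ ls-in ; bs-in = λ { (here refl) → here refl ; (there p) → there (bs-in p) }
    ; ls-distinct = ls-distinct ; bs-distinct = All.tabulate (λ p → All.lookup new (bs-in p)) ∷ bs-distinct }
    where open Sorted (sort dis)

  good⇒bound : Good full → n ≤ ℓ₂ G + br G
  good⇒bound (tokens ts val dis , le) =
    ≤-trans (≤-reflexive (sym (length-tabulate {n = n} (λ i → i))))
      (≤-trans (size≥ (Uniqueₚ.allFin⁺ n) (λ _ → all∈)) (≤-trans le (≤-trans (≤-reflexive total)
        (+-mono-≤ (lines≤ℓ₂ ls (All.tabulate λ p → All.lookup val (ls-in p)) ls-distinct)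
                  (bridges≤br bs (All.tabulate λ p → All.lookup val (bs-in p)) bs-distinct)))))
    where open Sorted (sort dis)

theorem3 : (n : ℕ) → (G : Graph n) → Connected G → Bipartite G → n ≥ 3 →
    ¬ (G ≅ C4) → ¬ (G ≅ K23) → ℓ₂ G + br G ≥ n
theorem3 (suc (suc (suc n))) G con bip (s≤s (s≤s (s≤s _))) ¬C4 ¬K23 = decidable-stable (_ ≤? _) λ ¬bound →
  Metric.all-good (metric G con bip) _ ≤-refl (full-isometric G con bip)
    (full-pair G con bip {Fin.zero} {Fin.suc Fin.zero} {Fin.suc (Fin.suc Fin.zero)} (λ ()) (λ ()) (λ ()))
    (¬C4 ∘ isC₄⇒C4 G con bip) (¬K23 ∘ isK₂₃⇒K23 G con bip) (¬bound ∘ good⇒bound G con bip)
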